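{- Let $r\ge 5$, $2\le t\le s$, and $a,b$ integers with $a+b=r$ and $b<a<r-1$. Let $T$ be a tree with bipartition $(U,V)$, $|U|=s$, $|V|=t$, and let $\mathcal T=T(a,b)$ be its $(a,b)$-blowup. Suppose $T$ has a critical leaf, i.e. a vertex $x\in V$ with $\deg_T(x)=1$. Then for all sufficiently large $n$ (depending on $T$, $a$, $b$), \[{\rm ex}_r(n,\mathcal T)\le \binom{n}{r}-\binom{n-t+1}{r}.\] If, in addition, $\tau(\mathcal T)=t$, then equality holds and $\Psi_{t-1}(n,r)$ is (up to isomorphism) the only $n$-vertex $\mathcal T$-free $r$-graph with $\binom{n}{r}-\binom{n-t+1}{r}$ edges.
   Context: An $r$-graph is a family of $r$-element subsets of a finite vertex set; ${\rm ex}_r(n,\mathcal T)$ is the maximum number of edges of an $r$-graph on $n$ vertices containing no copy of $\mathcal T$. For a bipartite graph $T$ with parts $U=\{u_1,\dots,u_s\}$ and $V=\{v_1,\dots,v_t\}$, the $(a,b)$-blowup $T(a,b)$ is the $(a+b)$-graph obtained by taking pairwise disjoint sets $U_1,\dots,U_s,V_1,\dots,V_t$ with $|U_i|=a$, $|V_j|=b$, with edge set $\{U_i\cup V_j: u_iv_j\in E(T)\}$. For a hypergraph $\mathcal H$, $\tau(\mathcal H)$ is the minimum size of a vertex set meeting every edge of $\mathcal H$. $\Psi_{c}(n,r)$ is the $r$-graph on $[n]$ consisting of all $r$-subsets of $[n]$ that meet $[c]=\{1,\dots,c\}$; it has $\binom{n}{r}-\binom{n-c}{r}$ edges. -}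

module Defs where

open import Data.Nat using (ℕ; zero; suc; _+_; _≤_; _<ᵇ_; _≡ᵇ_)
open import Data.Nat.Combinatorics using (_C_)
open import Data.Bool using (Bool; true; false; _∧_; if_then_else_)
open import Data.Fin using (Fin; toℕ)
open import Data.Fin.Subset using (Subset; ⁅_⁆; _∪_; ⋃; ∣_∣)
open import Data.Fin.Permutation using (Permutation′; _⟨$⟩ˡ_)
open import Data.Vec using (Vec; []; _∷_; lookup; tabulate)
open import Data.List using (List; []; _∷_; [_]; _++_; map; length; allFin)
open import Data.Nat.ListAction using (sum)
open import Data.Bool.ListAction using (any)
open import Data.List.Membership.Propositional using (_∈_)
open import Data.List.Relation.Unary.Unique.Propositional using (Unique)
open import Data.Product using (Σ; ∃; _×_; _,_)
open import Data.Sum using (_⊎_; inj₁; inj₂)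
open import Data.Unit using (⊤)
open import Data.Empty using (⊥)
open import Relation.Binary.PropositionalEquality using (_≡_)
open import Relation.Nullary using (¬_)
open import Function.Definitions using (Injective)

allSubsets : (n : ℕ) → List (Subset n)
allSubsets zero = [ [] ]
allSubsets (suc n) = map (false ∷_) (allSubsets n) ++ map (true ∷_) (allSubsets n)

record RGraph (n r : ℕ) : Set where
  field
    edge    : Subset n → Bool
    uniform : ∀ S → edge S ≡ true → ∣ S ∣ ≡ r
open RGraph public

numEdges : ∀ {n r} → RGraph n r → ℕ
numEdges {n} H = sum (map (λ S → if edge H S then 1 else 0) (allSubsets n))

mapSubset : ∀ {n} → Permutation′ n → Subset n → Subset n
mapSubset π S = tabulate (λ y → lookup S (π ⟨$⟩ˡ y))

_≅_ : ∀ {n r} → RGraph n r → RGraph n r → Set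
_≅_ {n} H G = Σ (Permutation′ n) λ π → ∀ S → edge H S ≡ edge G (mapSubset π S)

Ψ : (c n r : ℕ) → RGraph n r
Ψ c n r = record
  { edge = λ S → (∣ S ∣ ≡ᵇ r) ∧ any (λ i → (toℕ i <ᵇ c) ∧ lookup S i) (allFin n)
  ; uniform = uniformΨ }
  where
    open import Data.Nat.Properties using (≡ᵇ⇒≡)
    open import Relation.Binary.PropositionalEquality using (subst; cong)
    uniformΨ : ∀ S → ((∣ S ∣ ≡ᵇ r) ∧ any (λ i → (toℕ i <ᵇ c) ∧ lookup S i) (allFin n)) ≡ true → ∣ S ∣ ≡ r
    uniformΨ S eq with ∣ S ∣ ≡ᵇ r in e
    ... | true = ≡ᵇ⇒≡ ∣ S ∣ r (subst (λ b → Data.Bool.T b) (Relation.Binary.PropositionalEquality.sym e) Data.Unit.tt)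
    ... | false with eq
    ... | ()

BipGraph : ℕ → ℕ → Set
BipGraph s t = Fin s → Fin t → Bool

Vtx : ℕ → ℕ → Set
Vtx s t = Fin s ⊎ Fin t

Adj : ∀ {s t} → BipGraph s t → Vtx s t → Vtx s t → Set
Adj E (inj₁ u) (inj₂ v) = E u v ≡ true
Adj E (inj₂ v) (inj₁ u) = E u v ≡ true
Adj E (inj₁ _) (inj₁ _) = ⊥
Adj E (inj₂ _) (inj₂ _) = ⊥

data Reach {s t} (E : BipGraph s t) (x : Vtx s t) : Vtx s t → Set where
  here : Reach E x x
  step : ∀ {y z} → Reach E x y → Adj E y z → Reach E x z

Connected : ∀ {s t} → BipGraph s t → Set
Connected E = ∀ x y → Reach E x y

WalkAdj : ∀ {s t} → BipGraph s t → List (Vtx s t) → Set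
WalkAdj E [] = ⊤
WalkAdj E (x ∷ []) = ⊤
WalkAdj E (x ∷ y ∷ zs) = Adj E x y × WalkAdj E (y ∷ zs)

IsCycle : ∀ {s t} → BipGraph s t → List (Vtx s t) → Set
IsCycle E [] = ⊥
IsCycle E (x ∷ ys) = 2 ≤ length ys × Unique (x ∷ ys) × WalkAdj E (x ∷ ys ++ [ x ])

Acyclic : ∀ {s t} → BipGraph s t → Set
Acyclic E = ∀ xs → ¬ IsCycle E xs

IsTree : ∀ {s t} → BipGraph s t → Set
IsTree E = Connected E × Acyclic E

degV : ∀ {s t} → BipGraph s t → Fin t → ℕ
degV {s} E v = sum (map (λ u → if E u v then 1 else 0) (allFin s))

HasCriticalLeaf : ∀ {s t} → BipGraph s t → Set
HasCriticalLeaf {t = t} E = Σ (Fin t) λ x → degV E x ≡ 1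

-- the (a,b)-blowup T(a,b): vertices U_i = {i} × Fin a, V_j = {j} × Fin b,
-- edges U_i ∪ V_j for each edge u_i v_j of T

BVtx : (s t a b : ℕ) → Set
BVtx s t a b = (Fin s × Fin a) ⊎ (Fin t × Fin b)

InBEdge : ∀ {s t a b} → Fin s → Fin t → BVtx s t a b → Set
InBEdge u v (inj₁ (u' , _)) = u' ≡ u
InBEdge u v (inj₂ (v' , _)) = v' ≡ v

imgEdge : ∀ {s t a b n} → (BVtx s t a b → Fin n) → Fin s → Fin t → Subset n
imgEdge {a = a} {b = b} φ u v =
  ⋃ (map (λ k → ⁅ φ (inj₁ (u , k)) ⁆) (allFin a) ++ map (λ k → ⁅ φ (inj₂ (v , k)) ⁆) (allFin b))

ContainsBlowup : ∀ {n r s t} → BipGraph s t → (a b : ℕ) → RGraph n r → Set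
ContainsBlowup {n} {s = s} {t = t} E a b H =
  Σ (BVtx s t a b → Fin n) λ φ → Injective _≡_ _≡_ φ ×
    (∀ u v → E u v ≡ true → edge H (imgEdge φ u v) ≡ true)

Free : ∀ {n r s t} → BipGraph s t → (a b : ℕ) → RGraph n r → Set
Free E a b H = ¬ ContainsBlowup E a b H

Transversal : ∀ {s t a b} → BipGraph s t → List (BVtx s t a b) → Set
Transversal E C = ∀ u v → E u v ≡ true → ∃ λ w → w ∈ C × InBEdge u v w

TauEq : ∀ {s t} → BipGraph s t → (a b m : ℕ) → Set
TauEq {s} {t} E a b m =
  (Σ (List (BVtx s t a b)) λ C → Unique C × length C ≡ m × Transversal E C) ×
  (∀ (C : List (BVtx s t a b)) → Unique C → Transversal E C → m ≤ length C)

ExEq : ∀ {s t} → BipGraph s t → (a b n r m : ℕ) → Set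
ExEq E a b n r m =
  (∀ (H : RGraph n r) → Free E a b H → numEdges H ≤ m) ×
  (Σ (RGraph n r) λ H → Free E a b H × numEdges H ≡ m)

{-# OPTIONS --safe #-}
module Submission where

open import Defs
open import Data.Nat using (ℕ; zero; suc; _+_; _*_; _^_; _∸_; _≤_; _<_; _≤?_; _<?_; _≟_; _<ᵇ_; _≡ᵇ_; z≤n; s≤s; _!; NonZero; >-nonZero)
open import Data.Nat.Properties hiding (_≤?_; _<?_; _≟_)
open import Data.Nat.Combinatorics using (_C_; nCk+nC[k+1]≡[n+1]C[k+1])
open import Data.Nat.ListAction using (sum)
open import Data.Nat.Solver using (module +-*-Solver)
open import Algebra.Properties.CommutativeSemigroup *-commutativeSemigroup using (x∙yz≈y∙xz)
open import Data.Bool as Bool using (Bool; true; false; if_then_else_; _∧_; not)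
open import Data.Bool.Properties using (¬-not; T-≡)
import Data.Bool.ListAction as Bool
open import Data.Fin using (Fin; zero; suc; punchIn; punchOut; toℕ; fromℕ)
import Data.Fin.Properties as Fin
open import Data.Fin.Permutation as Perm using (Permutation′; _⟨$⟩ʳ_; _⟨$⟩ˡ_)
open import Data.Fin.Subset using (Subset; ⁅_⁆; _∪_; _∩_; ∁; _─_; _-_; ∣_∣; _∈_; _∉_; _⊆_; ⊥; ⊤; ⋃; Nonempty)
open import Data.Fin.Subset.Properties
open import Data.Vec as Vec using (Vec; []; _∷_; lookup; insertAt; removeAt)
open import Data.Vec.Properties using (≡-dec; []=⇒lookup; lookup⇒[]=; lookup∘tabulate; lookup-map; insertAt-lookup; insertAt-punchIn; removeAt-insertAt; insertAt-removeAt; take++drop≡id)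
open import Data.List using (List; []; _∷_; [_]; map; length; allFin; upTo; concatMap; _++_)
open import Data.List.Properties using (length-++; length-map; length-tabulate; length-upTo; map-tabulate)
open import Data.List.Membership.Propositional renaming (_∈_ to _∈ˡ_; _∉_ to _∉ˡ_) using ()
open import Data.List.Membership.Propositional.Properties using (∈-allFin; ∈-map⁺; ∈-map⁻; ∈-++⁺ˡ; ∈-++⁺ʳ; ∈-++⁻; ∈-concat⁺′; ∈-upTo⁺)
import Data.List.Membership.DecPropositional as DecMembership
open import Data.List.Relation.Unary.Any as Any using (here; there)
import Data.List.Relation.Unary.Any.Properties as Any
open import Data.List.Relation.Unary.All as All using (All; []; _∷_)
import Data.List.Relation.Unary.All.Properties as All
open import Data.List.Relation.Unary.AllPairs using ([]; _∷_)
open import Data.List.Relation.Unary.Unique.Propositional using (Unique)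
import Data.List.Relation.Unary.Unique.Propositional.Properties as Unique
open import Data.Product using (Σ; ∃; _×_; _,_; proj₁; proj₂)
open import Data.Sum using (_⊎_; inj₁; inj₂; [_,_]′)
import Data.Sum.Properties as Sum
open import Data.Unit using (tt)
import Data.Empty
open import Data.Empty using (⊥-elim)
open import Function using (_∘_; id; case_of_)
open import Function.Bundles using (Equivalence)
open import Function.Definitions using (Injective)
open import Relation.Nullary using (¬_; Dec; yes; no; does)
open import Relation.Nullary.Decidable using (map′; ¬?; _×-dec_; _→-dec_; _⊎-dec_; ⌊_⌋; decidable-stable)
open import Relation.Binary.PropositionalEquality using (_≡_; _≢_; refl; sym; trans; cong; cong₂; subst; module ≡-Reasoning)

-- Peel the pairs (P , Q) with |P| = a, |Q| = b and P ∪ Q an edge: as long as the pairs of some P (or Q) are all met by a set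
-- of bounded size, discard them. If some pairs survived, T could be embedded greedily among them. So every pair is discarded,
-- which gives sets C(P) of bounded size such that every splitting P ∪ Q of an edge has Q ∩ C(P) ≠ ∅ or P ∩ C(Q) ≠ ∅.
-- Up to O(n^(r-2)) exceptions it follows that an edge F has a centre c with c ∈ C(P) for all a-sets P ⊆ F ∖ {c}, and
-- Loomis–Whitney shows that almost all edges are centred in a set W of bounded size. For an (r-1)-set D let f(D) be the set
-- of w ∈ W with D ∪ {w} an edge. Peeling the (r-1)-sets with a given f shows that |f(D)| ≥ t is rare, so the number of edges
-- forces |f(D)| = t - 1 for almost all D; because of the critical leaf, two typical D with a common a-set have the same f,
-- hence f is almost always the same set L. Finally let B be the edges disjoint from L and M the non-edges meeting L. Every
-- a-subset P of an edge in B lies in few edges P ∪ {l} ∪ Z for some l ∈ L, for otherwise T is found with its critical leaf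
-- at that edge. Such P are rare and each of them accounts for many members of M, and so 2|B| ≤ |M| by Loomis–Whitney again.
-- Hence a graph with the extremal number of edges has B = M = ∅.

-- Finite sums

-- The extremal number has order n^(r-1), and so has the bound that comes from a single arrow in
-- every edge, but with a far larger constant. The difficulty is to gain an arbitrary constant
-- factor over that bound. This is why one vertex c has to be the head for all a-subsets of F
-- without c: if c is the head for a small fraction of all a-sets only, Loomis-Whitney makes the
-- (a+1)-sets all of whose a-subsets point to c rarer by any prescribed factor, and only boundedly
-- many c are not of this kind. The same gain yields the factor 2 in 2|B| ≤ |M|. The critical leaf
-- accounts for t - 1: once its part is placed in a pendant edge, the other t - 1 parts V_j need one
-- vertex of L each, and the rest of the embedding deals with (b-1)-sets. Counting is over ordered
-- tuples with repetition, where an entry confined to a bounded set costs exactly one factor n. A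
-- parameter `M` is the reciprocal of a tolerated density; every step fixes it for the steps it
-- relies on, down to Loomis-Whitney.

opaque
  ∑ : {A : Set} → List A → (A → ℕ) → ℕ
  ∑ xs f = sum (map f xs)

  ∑-sum : ∀ {A : Set} (xs : List A) (f : A → ℕ) → ∑ xs f ≡ sum (map f xs)
  ∑-sum xs f = refl

  ∑-[] : ∀ {A : Set} (f : A → ℕ) → ∑ [] f ≡ 0
  ∑-[] f = refl

  ∑-cons : ∀ {A : Set} x xs (f : A → ℕ) → ∑ (x ∷ xs) f ≡ f x + ∑ xs f
  ∑-cons x xs f = refl

∑-syntax = ∑
syntax ∑-syntax xs (λ x → e) = ∑[ x ∈ xs ] e
infix 5 ∑-syntax

module _ {A : Set} where

  opaque
    unfolding ∑

    ∑-mono : ∀ (xs : List A) {f g : A → ℕ} → (∀ x → f x ≤ g x) → ∑ xs f ≤ ∑ xs g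
    ∑-mono [] h = z≤n
    ∑-mono (x ∷ xs) h = +-mono-≤ (h x) (∑-mono xs h)

    ∑-cong : ∀ (xs : List A) {f g : A → ℕ} → (∀ x → f x ≡ g x) → ∑ xs f ≡ ∑ xs g
    ∑-cong [] h = refl
    ∑-cong (x ∷ xs) h = cong₂ _+_ (h x) (∑-cong xs h)

    ∑-+ : ∀ (xs : List A) (f g : A → ℕ) → (∑[ x ∈ xs ] (f x + g x)) ≡ ∑ xs f + ∑ xs g
    ∑-+ [] f g = refl
    ∑-+ (x ∷ xs) f g = trans (cong ((f x + g x) +_) (∑-+ xs f g))
      (solve 4 (λ a b c d → (a :+ b) :+ (c :+ d) := (a :+ c) :+ (b :+ d)) refl (f x) (g x) (∑ xs f) (∑ xs g))
      where open +-*-Solver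

    ∑-*ˡ : ∀ (xs : List A) c (f : A → ℕ) → (∑[ x ∈ xs ] (c * f x)) ≡ c * ∑ xs f
    ∑-*ˡ [] c f = sym (*-zeroʳ c)
    ∑-*ˡ (x ∷ xs) c f = trans (cong (c * f x +_) (∑-*ˡ xs c f)) (sym (*-distribˡ-+ c (f x) _))

    ∑-*ʳ : ∀ (xs : List A) c (f : A → ℕ) → (∑[ x ∈ xs ] (f x * c)) ≡ ∑ xs f * c
    ∑-*ʳ xs c f = trans (∑-cong xs (λ x → *-comm (f x) c)) (trans (∑-*ˡ xs c f) (*-comm c _))

    ∑-const : ∀ (xs : List A) c → (∑[ x ∈ xs ] c) ≡ length xs * c
    ∑-const [] c = refl
    ∑-const (x ∷ xs) c = cong (c +_) (∑-const xs c)

    ∑-≤const : ∀ (xs : List A) {f : A → ℕ} {c} → (∀ x → f x ≤ c) → ∑ xs f ≤ length xs * c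
    ∑-≤const xs {c = c} h = ≤-trans (∑-mono xs h) (≤-reflexive (∑-const xs c))

    ∑-++ : ∀ (xs ys : List A) (f : A → ℕ) → ∑ (xs ++ ys) f ≡ ∑ xs f + ∑ ys f
    ∑-++ [] ys f = refl
    ∑-++ (x ∷ xs) ys f = trans (cong (f x +_) (∑-++ xs ys f)) (sym (+-assoc (f x) _ _))

    ∑-∈ : ∀ {xs : List A} (f : A → ℕ) {x} → x ∈ˡ xs → f x ≤ ∑ xs f
    ∑-∈ f (here refl) = m≤m+n _ _
    ∑-∈ f {x} (there {x = y} p) = ≤-trans (∑-∈ f p) (m≤n+m _ (f y))

    -- Discarding an entry above `c` leaves the rest with average at most `c`, so the search ends
    -- before the list does.
    ∑-average : ∀ (xs : List A) (f : A → ℕ) {c} → 0 < length xs → ∑ xs f ≤ length xs * c → ∃ λ x → f x ≤ c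
    ∑-average (x ∷ xs) f {c} _ le with f x ≤? c
    ... | yes p = x , p
    ... | no ¬p with xs
    ...   | [] = ⊥-elim (¬p (≤-trans (m≤m+n _ _) (≤-trans le (≤-reflexive (+-identityʳ c)))))
    ...   | y ∷ ys = ∑-average (y ∷ ys) f (s≤s z≤n)
                       (+-cancelˡ-≤ c _ _ (≤-trans (+-monoˡ-≤ _ (<⇒≤ (≰⇒> ¬p))) le))

module _ {A B : Set} where

  opaque
    unfolding ∑

    ∑-map : ∀ (g : A → B) (xs : List A) (f : B → ℕ) → ∑ (map g xs) f ≡ ∑[ x ∈ xs ] f (g x)
    ∑-map g [] f = refl
    ∑-map g (x ∷ xs) f = cong (f (g x) +_) (∑-map g xs f)

    ∑-concatMap : ∀ (g : A → List B) (xs : List A) (f : B → ℕ) → ∑ (concatMap g xs) f ≡ ∑[ x ∈ xs ] ∑ (g x) f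
    ∑-concatMap g [] f = refl
    ∑-concatMap g (x ∷ xs) f = trans (∑-++ (g x) (concatMap g xs) f) (cong (∑ (g x) f +_) (∑-concatMap g xs f))

    ∑-swap : ∀ (xs : List A) (ys : List B) (f : A → B → ℕ) →
      (∑[ x ∈ xs ] ∑[ y ∈ ys ] f x y) ≡ (∑[ y ∈ ys ] ∑[ x ∈ xs ] f x y)
    ∑-swap [] ys f = sym (trans (∑-const ys 0) (*-zeroʳ (length ys)))
    ∑-swap (x ∷ xs) ys f = trans (cong (∑ ys (f x) +_) (∑-swap xs ys f)) (sym (∑-+ ys (f x) _))

opaque
  ι : {P : Set} → Dec P → ℕ
  ι d = if does d then 1 else 0

  ι-yes : {P : Set} (d : Dec P) → P → ι d ≡ 1
  ι-yes (yes _) p = refl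
  ι-yes (no ¬p) p = ⊥-elim (¬p p)

  ι-no : {P : Set} (d : Dec P) → ¬ P → ι d ≡ 0
  ι-no (yes p) ¬p = ⊥-elim (¬p p)
  ι-no (no _) ¬p = refl

module _ {P : Set} where

  ι-≥1 : (d : Dec P) → P → 1 ≤ ι d
  ι-≥1 d p = ≤-reflexive (sym (ι-yes d p))

  ι≤1 : (d : Dec P) → ι d ≤ 1
  ι≤1 (yes p) = ≤-reflexive (ι-yes (yes p) p)
  ι≤1 (no ¬p) = ≤-trans (≤-reflexive (ι-no (no ¬p) ¬p)) z≤n

  ι-≤ : (d : Dec P) {k : ℕ} → (P → 1 ≤ k) → ι d ≤ k
  ι-≤ (yes p) h = ≤-trans (ι≤1 (yes p)) (h p)
  ι-≤ (no ¬p) h = ≤-trans (≤-reflexive (ι-no (no ¬p) ¬p)) z≤n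

  ι≡0⇒¬ : (d : Dec P) → ι d ≡ 0 → ¬ P
  ι≡0⇒¬ d e p with trans (sym e) (ι-yes d p)
  ... | ()

ι-mono : {P Q : Set} (d : Dec P) (e : Dec Q) → (P → Q) → ι d ≤ ι e
ι-mono d e h = ι-≤ d (λ p → ≤-reflexive (sym (ι-yes e (h p))))

ι-cong : {P Q : Set} (d : Dec P) (e : Dec Q) → (P → Q) → (Q → P) → ι d ≡ ι e
ι-cong d e f g = ≤-antisym (ι-mono d e f) (ι-mono e d g)

ι-⊎ : {P Q R : Set} (d : Dec P) (e : Dec Q) (f : Dec R) → (P → Q ⊎ R) → ι d ≤ ι e + ι f
ι-⊎ d e f h = ι-≤ d λ p → case h p of λ where
  (inj₁ q) → ≤-trans (≤-reflexive (sym (ι-yes e q))) (m≤m+n _ _)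
  (inj₂ r) → ≤-trans (≤-reflexive (sym (ι-yes f r))) (m≤n+m _ _)

ι-× : {P Q R : Set} (d : Dec P) (e : Dec Q) (f : Dec R) → (P → Q × R) → ι d ≤ ι e * ι f
ι-× d e f h = ι-≤ d λ p → ≤-reflexive (sym (cong₂ _*_ (ι-yes e (proj₁ (h p))) (ι-yes f (proj₂ (h p)))))

ι-∃ : {P A : Set} {Q : A → Set} (d : Dec P) (xs : List A) (e : ∀ x → Dec (Q x)) →
  (P → ∃ λ x → x ∈ˡ xs × Q x) → ι d ≤ ∑[ x ∈ xs ] ι (e x)
ι-∃ d xs e h = ι-≤ d λ p → case h p of λ where
  (x , x∈ , q) → ≤-trans (ι-≥1 (e x) q) (∑-∈ (λ x → ι (e x)) x∈)

length-allFin : ∀ n → length (allFin n) ≡ n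
length-allFin n = length-tabulate (λ (i : Fin n) → i)

∑-allFin-const : ∀ n c → (∑[ x ∈ allFin n ] c) ≡ n * c
∑-allFin-const n c = trans (∑-const (allFin n) c) (cong (_* c) (length-allFin n))

opaque
  -- Repetitions are allowed, so that there are exactly n ^ m tuples and any coordinate can be
  -- summed out independently of the others. The passage to sets, at the price of a factor r !, is
  -- left to `∑-distinct-tuples`.
  tuples : ∀ n m → List (Vec (Fin n) m)
  tuples n zero = [ [] ]
  tuples n (suc m) = concatMap (λ x → map (x ∷_) (tuples n m)) (allFin n)

  ∑-nil : ∀ {n} (f : Vec (Fin n) 0 → ℕ) → ∑ (tuples n 0) f ≡ f []
  ∑-nil f = trans (∑-cons [] [] f) (trans (cong (f [] +_) (∑-[] f)) (+-identityʳ _))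

  ∑-∷ : ∀ {n} m (f : Vec (Fin n) (suc m) → ℕ) →
    ∑ (tuples n (suc m)) f ≡ ∑[ x ∈ allFin n ] ∑[ v ∈ tuples n m ] f (x ∷ v)
  ∑-∷ {n} m f = trans (∑-concatMap (λ x → map (x ∷_) (tuples n m)) (allFin n) f)
    (∑-cong (allFin n) (λ x → ∑-map (x ∷_) (tuples n m) f))

  ∈-tuples : ∀ {n m} (v : Vec (Fin n) m) → v ∈ˡ tuples n m
  ∈-tuples [] = here refl
  ∈-tuples {n} {suc m} (x ∷ v) =
    ∈-concat⁺′ (∈-map⁺ (x ∷_) (∈-tuples v)) (∈-map⁺ (λ x → map (x ∷_) (tuples n m)) (∈-allFin x))

module _ {n : ℕ} where

  ∑-insertAt : ∀ m (i : Fin (suc m)) (f : Vec (Fin n) (suc m) → ℕ) →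
    ∑ (tuples n (suc m)) f ≡ ∑[ v ∈ tuples n m ] ∑[ y ∈ allFin n ] f (insertAt v i y)
  ∑-insertAt m zero f = trans (∑-∷ m f) (∑-swap (allFin n) (tuples n m) (λ x v → f (x ∷ v)))
  ∑-insertAt (suc m) (suc i) f = trans (∑-∷ (suc m) f)
    (trans (∑-cong (allFin n) (λ x → ∑-insertAt m i (λ v → f (x ∷ v))))
      (sym (∑-∷ m (λ v → ∑[ y ∈ allFin n ] f (insertAt v (suc i) y)))))

  ∑-++ᵛ : ∀ k m (f : Vec (Fin n) (k + m) → ℕ) →
    ∑ (tuples n (k + m)) f ≡ ∑[ v ∈ tuples n k ] ∑[ w ∈ tuples n m ] f (v Vec.++ w)
  ∑-++ᵛ zero m f = sym (∑-nil _)
  ∑-++ᵛ (suc k) m f = trans (∑-∷ (k + m) f)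
    (trans (∑-cong (allFin n) (λ x → ∑-++ᵛ k m (λ v → f (x ∷ v))))
      (sym (∑-∷ k (λ v → ∑[ w ∈ tuples n m ] f (v Vec.++ w)))))

∑-tuples-const : ∀ n m c → (∑[ v ∈ tuples n m ] c) ≡ n ^ m * c
∑-tuples-const n zero c = trans (∑-nil {n} (λ _ → c)) (sym (+-identityʳ c))
∑-tuples-const n (suc m) c = trans (∑-∷ m (λ _ → c))
  (trans (∑-cong (allFin n) (λ _ → ∑-tuples-const n m c))
    (trans (∑-allFin-const n (n ^ m * c)) (sym (*-assoc n (n ^ m) c))))

length-tuples : ∀ n m → length (tuples n m) ≡ n ^ m
length-tuples n m = trans (sym (*-identityʳ _)) (trans (sym (∑-const (tuples n m) 1)) (trans (∑-tuples-const n m 1) (*-identityʳ _)))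

∑-tuples-≤ : ∀ n m {f : Vec (Fin n) m → ℕ} {c} → (∀ v → f v ≤ c) → ∑ (tuples n m) f ≤ n ^ m * c
∑-tuples-≤ n m {c = c} h = ≤-trans (∑-mono (tuples n m) h) (≤-reflexive (∑-tuples-const n m c))

hybrid : ∀ {A : Set} {m} → ℕ → Vec A m → Vec A m → Vec A m
hybrid zero xs ys = xs
hybrid (suc k) [] [] = []
hybrid (suc k) (x ∷ xs) (y ∷ ys) = y ∷ hybrid k xs ys

-- A hybrid forgets the first k entries of x and the last m - k of y (all of x if k exceeds m), and
-- these m free entries make the factor n ^ m. In other words, a hybrid of two independent uniform
-- tuples is uniform.
∑-hybrid : ∀ n m k (f : Vec (Fin n) m → ℕ) →
  (∑[ x ∈ tuples n m ] ∑[ y ∈ tuples n m ] f (hybrid k x y)) ≡ n ^ m * ∑ (tuples n m) f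
∑-hybrid n m zero f = trans (∑-cong (tuples n m) (λ x → ∑-tuples-const n m (f x))) (∑-*ˡ (tuples n m) (n ^ m) f)
∑-hybrid n zero (suc k) f = trans (∑-nil {n} _) (trans (∑-nil _) (sym (trans (+-identityʳ _) (∑-nil f))))
∑-hybrid n (suc m) (suc k) f = begin
  (∑[ x ∈ tuples n (suc m) ] ∑[ y ∈ tuples n (suc m) ] f (hybrid (suc k) x y))
    ≡⟨ ∑-∷ m _ ⟩
  (∑[ x₀ ∈ allFin n ] ∑[ x ∈ tuples n m ] ∑[ y ∈ tuples n (suc m) ] f (hybrid (suc k) (x₀ ∷ x) y))
    ≡⟨ ∑-cong (allFin n) (λ _ → ∑-cong (tuples n m) (λ x → ∑-∷ m _)) ⟩
  (∑[ x₀ ∈ allFin n ] ∑[ x ∈ tuples n m ] ∑[ y₀ ∈ allFin n ] ∑[ y ∈ tuples n m ] f (y₀ ∷ hybrid k x y))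
    ≡⟨ ∑-allFin-const n _ ⟩
  n * (∑[ x ∈ tuples n m ] ∑[ y₀ ∈ allFin n ] ∑[ y ∈ tuples n m ] f (y₀ ∷ hybrid k x y))
    ≡⟨ cong (n *_) (∑-swap (tuples n m) (allFin n) _) ⟩
  n * (∑[ y₀ ∈ allFin n ] ∑[ x ∈ tuples n m ] ∑[ y ∈ tuples n m ] f (y₀ ∷ hybrid k x y))
    ≡⟨ cong (n *_) (∑-cong (allFin n) (λ y₀ → ∑-hybrid n m k (λ v → f (y₀ ∷ v)))) ⟩
  n * (∑[ y₀ ∈ allFin n ] (n ^ m * (∑[ v ∈ tuples n m ] f (y₀ ∷ v))))
    ≡⟨ cong (n *_) (∑-*ˡ (allFin n) (n ^ m) _) ⟩
  n * (n ^ m * (∑[ y₀ ∈ allFin n ] ∑[ v ∈ tuples n m ] f (y₀ ∷ v)))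
    ≡⟨ *-assoc n (n ^ m) _ ⟨
  n ^ suc m * (∑[ y₀ ∈ allFin n ] ∑[ v ∈ tuples n m ] f (y₀ ∷ v))
    ≡⟨ cong (n ^ suc m *_) (∑-∷ m f) ⟨
  n ^ suc m * ∑ (tuples n (suc m)) f ∎
  where open ≡-Reasoning

-- Subsets and tuples

∣⊥∣≤ : ∀ n {k} → ∣ ⊥ {n} ∣ ≤ k
∣⊥∣≤ n = ≤-trans (≤-reflexive (∣⊥∣≡0 n)) z≤n

Meets Disjoint : ∀ {n} → Subset n → Subset n → Set
Meets P Q = ∃ λ x → x ∈ P × x ∈ Q
Disjoint P Q = ∀ {x} → x ∈ P → x ∉ Q

meets? : ∀ {n} (P Q : Subset n) → Dec (Meets P Q)
meets? P Q = map′ (λ (x , p) → x , x∈p∩q⁻ P Q p) (λ (x , p) → x , x∈p∩q⁺ p) (nonempty? (P ∩ Q))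

¬meets⇒disjoint : ∀ {n} {P Q : Subset n} → ¬ Meets P Q → Disjoint P Q
¬meets⇒disjoint ¬m p q = ¬m (_ , p , q)

disjoint? : ∀ {n} (P Q : Subset n) → Dec (Disjoint P Q)
disjoint? P Q = map′ ¬meets⇒disjoint (λ d (x , p , q) → d p q) (¬? (meets? P Q))

disjoint-sym : ∀ {n} {P Q : Subset n} → Disjoint P Q → Disjoint Q P
disjoint-sym d q p = d p q

disjoint-∪ʳ : ∀ {n} {P} (Q R : Subset n) → Disjoint P Q → Disjoint P R → Disjoint P (Q ∪ R)
disjoint-∪ʳ Q R d e p q = [ d p , e p ]′ (x∈p∪q⁻ Q R q)

∈-∪ˡ : ∀ {n} {x : Fin n} {P Q} → x ∈ P → x ∈ P ∪ Q
∈-∪ˡ p = x∈p∪q⁺ (inj₁ p)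

∈-∪ʳ : ∀ {n} {x : Fin n} P {Q} → x ∈ Q → x ∈ P ∪ Q
∈-∪ʳ P q = x∈p∪q⁺ {p = P} (inj₂ q)

∈-─⁻ : ∀ {n} (P Q : Subset n) {x} → x ∈ P ─ Q → x ∈ P × x ∉ Q
∈-─⁻ P Q {x} p = p─q⊆p P Q p , go P Q p
  where
  go : ∀ {n} (P Q : Subset n) {x} → x ∈ P ─ Q → x ∉ Q
  go (_ ∷ P) (true ∷ Q) {zero} () Vec.here
  go (_ ∷ P) (_ ∷ Q) {suc x} (Vec.there p) (Vec.there q) = go P Q p q

∪-─ : ∀ {n} {P Q : Subset n} → P ⊆ Q → P ∪ (Q ─ P) ≡ Q
∪-─ {P = P} {Q} s = ⊆-antisym (λ p → [ s , p─q⊆p Q P ]′ (x∈p∪q⁻ P (Q ─ P) p))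
  (λ {x} q → case x ∈? P of λ where
    (yes p) → ∈-∪ˡ p
    (no ¬p) → ∈-∪ʳ P (x∈p∧x∉q⇒x∈p─q q ¬p))

disjoint-─ : ∀ {n} (P Q : Subset n) → Disjoint P (Q ─ P)
disjoint-─ P Q p q = proj₂ (∈-─⁻ Q P q) p

∣∪∣+∣∩∣ : ∀ {n} (P Q : Subset n) → ∣ P ∪ Q ∣ + ∣ P ∩ Q ∣ ≡ ∣ P ∣ + ∣ Q ∣
∣∪∣+∣∩∣ [] [] = refl
∣∪∣+∣∩∣ (false ∷ P) (false ∷ Q) = ∣∪∣+∣∩∣ P Q
∣∪∣+∣∩∣ (false ∷ P) (true ∷ Q) = trans (cong suc (∣∪∣+∣∩∣ P Q)) (sym (+-suc ∣ P ∣ ∣ Q ∣))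
∣∪∣+∣∩∣ (true ∷ P) (false ∷ Q) = cong suc (∣∪∣+∣∩∣ P Q)
∣∪∣+∣∩∣ (true ∷ P) (true ∷ Q) =
  cong suc (trans (+-suc _ _) (trans (cong suc (∣∪∣+∣∩∣ P Q)) (sym (+-suc ∣ P ∣ ∣ Q ∣))))

∣∪∣≤ : ∀ {n} (P Q : Subset n) → ∣ P ∪ Q ∣ ≤ ∣ P ∣ + ∣ Q ∣
∣∪∣≤ P Q = ≤-trans (m≤m+n _ ∣ P ∩ Q ∣) (≤-reflexive (∣∪∣+∣∩∣ P Q))

disjoint⇒∣∪∣ : ∀ {n} (P Q : Subset n) → Disjoint P Q → ∣ P ∪ Q ∣ ≡ ∣ P ∣ + ∣ Q ∣
disjoint⇒∣∪∣ {n} P Q d = trans (sym (+-identityʳ _)) (trans (cong (∣ P ∪ Q ∣ +_) (sym e)) (∣∪∣+∣∩∣ P Q))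
  where
  e : ∣ P ∩ Q ∣ ≡ 0
  e = trans (cong ∣_∣ (Empty-unique {p = P ∩ Q} (λ (x , p) → let (y , z) = x∈p∩q⁻ P Q p in d y z))) (∣⊥∣≡0 n)

∣─∣ : ∀ {n} {P Q : Subset n} → P ⊆ Q → ∣ P ∣ + ∣ Q ─ P ∣ ≡ ∣ Q ∣
∣─∣ {P = P} {Q} s = trans (sym (disjoint⇒∣∪∣ P (Q ─ P) (disjoint-─ P Q))) (cong ∣_∣ (∪-─ s))

disjoint-⁅⁆ : ∀ {n} {x : Fin n} {P} → x ∉ P → Disjoint ⁅ x ⁆ P
disjoint-⁅⁆ {x = x} x∉ p q rewrite x∈⁅y⁆⇒x≡y x p = x∉ q

∣⁅⁆∪∣ : ∀ {n} (x : Fin n) P → x ∉ P → ∣ ⁅ x ⁆ ∪ P ∣ ≡ suc ∣ P ∣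
∣⁅⁆∪∣ x P x∉ = trans (disjoint⇒∣∪∣ ⁅ x ⁆ P (disjoint-⁅⁆ x∉)) (cong (_+ ∣ P ∣) (∣⁅x⁆∣≡1 x))

∈⇒⁅⁆∪ : ∀ {n} (x : Fin n) P → x ∈ P → ⁅ x ⁆ ∪ P ≡ P
∈⇒⁅⁆∪ x P p = ⊆-antisym (λ q → [ (λ e → subst (_∈ P) (sym (x∈⁅y⁆⇒x≡y x e)) p) , id ]′ (x∈p∪q⁻ ⁅ x ⁆ P q)) (∈-∪ʳ ⁅ x ⁆)

∣-∣ : ∀ {n} {x : Fin n} {P} → x ∈ P → suc ∣ P - x ∣ ≡ ∣ P ∣
∣-∣ {x = x} {P} p = trans (cong (_+ ∣ P - x ∣) (sym (∣⁅x⁆∣≡1 x)))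
  (∣─∣ {P = ⁅ x ⁆} λ q → subst (_∈ P) (sym (x∈⁅y⁆⇒x≡y x q)) p)

nonempty-size : ∀ {n} (P : Subset n) → 0 < ∣ P ∣ → Nonempty P
nonempty-size {n} P lt = case nonempty? P of λ where
  (yes p) → p
  (no ¬p) → ⊥-elim (<-irrefl (sym (trans (cong ∣_∣ (Empty-unique ¬p)) (∣⊥∣≡0 n))) lt)

⊆-size⇒⊇ : ∀ {n} {P Q : Subset n} → P ⊆ Q → ∣ Q ∣ ≤ ∣ P ∣ → Q ⊆ P
⊆-size⇒⊇ {P = P} {Q} s le {x} q with x ∈? P
... | yes p = p
... | no ¬p = ⊥-elim (<⇒≱ (p⊂q⇒∣p∣<∣q∣ (s , x , q , ¬p)) le)

interpolate : ∀ {n} (I J : Subset n) k → I ⊆ J → ∣ I ∣ ≤ k → k ≤ ∣ J ∣ →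
  ∃ λ S → I ⊆ S × S ⊆ J × ∣ S ∣ ≡ k
interpolate [] [] k s p q = [] , id , id , ≤-antisym p q
interpolate (true ∷ I) (false ∷ J) k s p q = case s Vec.here of λ ()
interpolate (false ∷ I) (false ∷ J) k s p q with interpolate I J k (drop-∷-⊆ s) p q
... | S , a , b , c = false ∷ S , s⊆s a , s⊆s b , c
interpolate (true ∷ I) (true ∷ J) (suc k) s (s≤s p) (s≤s q) with interpolate I J k (drop-∷-⊆ s) p q
... | S , a , b , c = true ∷ S , s⊆s a , s⊆s b , cong suc c
interpolate (false ∷ I) (true ∷ J) k s p q with k ≤? ∣ J ∣
-- An element of J that I lacks is left out whenever the rest of J can still supply k elements.
... | yes q' with interpolate I J k (drop-∷-⊆ s) p q'
...   | S , a , b , c = false ∷ S , s⊆s a , out⊆ b , c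
interpolate (false ∷ I) (true ∷ J) zero s p q | no ¬q = ⊥-elim (¬q z≤n)
interpolate (false ∷ I) (true ∷ J) (suc k) s p (s≤s q) | no ¬q
  with interpolate I J k (drop-∷-⊆ s) (≤-trans (p⊆q⇒∣p∣≤∣q∣ (drop-∷-⊆ s)) (≤-pred (≰⇒> ¬q))) q
...   | S , a , b , c = true ∷ S , out⊆ a , s⊆s b , cong suc c

img : ∀ {n m} → Vec (Fin n) m → Subset n
img [] = ⊥
img (x ∷ v) = ⁅ x ⁆ ∪ img v

-- S consists of positions rather than vertices: entries outside S can then vary while the set read
-- off at S stays fixed.
imgOn : ∀ {n m} → Subset m → Vec (Fin n) m → Subset n
imgOn [] [] = ⊥
imgOn (true ∷ S) (x ∷ v) = ⁅ x ⁆ ∪ imgOn S v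
imgOn (false ∷ S) (x ∷ v) = imgOn S v

-- In terms of cardinality, because `uniform` then gives it at once for every tuple that spans an
-- edge.
Distinct : ∀ {n m} → Vec (Fin n) m → Set
Distinct {m = m} v = ∣ img v ∣ ≡ m

distinct? : ∀ {n m} (v : Vec (Fin n) m) → Dec (Distinct v)
distinct? {m = m} v = ∣ img v ∣ ≟ m

module _ {n : ℕ} where

  ∈-⁅⁆∪⁻ : ∀ {x y : Fin n} {P} → x ∈ ⁅ y ⁆ ∪ P → x ≡ y ⊎ x ∈ P
  ∈-⁅⁆∪⁻ {x} {y} {P} p = [ inj₁ ∘ x∈⁅y⁆⇒x≡y y , inj₂ ]′ (x∈p∪q⁻ ⁅ y ⁆ P p)

  ∈-imgOn⁺ : ∀ {m} (S : Subset m) (v : Vec (Fin n) m) {i} → i ∈ S → lookup v i ∈ imgOn S v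
  ∈-imgOn⁺ (true ∷ S) (x ∷ v) {zero} p = ∈-∪ˡ (x∈⁅x⁆ x)
  ∈-imgOn⁺ (true ∷ S) (x ∷ v) {suc i} (Vec.there p) = ∈-∪ʳ ⁅ x ⁆ (∈-imgOn⁺ S v p)
  ∈-imgOn⁺ (false ∷ S) (x ∷ v) {suc i} (Vec.there p) = ∈-imgOn⁺ S v p

  ∈-imgOn⁻ : ∀ {m} (S : Subset m) (v : Vec (Fin n) m) {x} → x ∈ imgOn S v → ∃ λ i → i ∈ S × lookup v i ≡ x
  ∈-imgOn⁻ [] [] p = ⊥-elim (∉⊥ p)
  ∈-imgOn⁻ (true ∷ S) (y ∷ v) p with ∈-⁅⁆∪⁻ p
  ... | inj₁ e = zero , Vec.here , sym e
  ... | inj₂ q with ∈-imgOn⁻ S v q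
  ...   | i , i∈ , e = suc i , Vec.there i∈ , e
  ∈-imgOn⁻ (false ∷ S) (y ∷ v) p with ∈-imgOn⁻ S v p
  ... | i , i∈ , e = suc i , Vec.there i∈ , e

  ∈-img⁺ : ∀ {m} (v : Vec (Fin n) m) i → lookup v i ∈ img v
  ∈-img⁺ (x ∷ v) zero = ∈-∪ˡ (x∈⁅x⁆ x)
  ∈-img⁺ (x ∷ v) (suc i) = ∈-∪ʳ ⁅ x ⁆ (∈-img⁺ v i)

  ∈-img⁻ : ∀ {m} (v : Vec (Fin n) m) {x} → x ∈ img v → ∃ λ i → lookup v i ≡ x
  ∈-img⁻ [] p = ⊥-elim (∉⊥ p)
  ∈-img⁻ (y ∷ v) p with ∈-⁅⁆∪⁻ p
  ... | inj₁ e = zero , sym e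
  ... | inj₂ q with ∈-img⁻ v q
  ...   | i , e = suc i , e

  ∣img∣≤ : ∀ {m} (v : Vec (Fin n) m) → ∣ img v ∣ ≤ m
  ∣img∣≤ [] = ≤-reflexive (∣⊥∣≡0 n)
  ∣img∣≤ (x ∷ v) = ≤-trans (∣∪∣≤ ⁅ x ⁆ (img v)) (+-mono-≤ (≤-reflexive (∣⁅x⁆∣≡1 x)) (∣img∣≤ v))

  distinct-∷⁻ : ∀ {m} x (v : Vec (Fin n) m) → Distinct (x ∷ v) → x ∉ img v × Distinct v
  distinct-∷⁻ {m} x v d = x∉ , suc-injective (trans (sym (∣⁅⁆∪∣ x (img v) x∉)) d)
    where
    x∉ : x ∉ img v
    x∉ p = <-irrefl refl (≤-trans (≤-reflexive (sym (trans (cong ∣_∣ (sym (∈⇒⁅⁆∪ x (img v) p))) d))) (∣img∣≤ v))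

  distinct-∷⁺ : ∀ {m} x (v : Vec (Fin n) m) → x ∉ img v → Distinct v → Distinct (x ∷ v)
  distinct-∷⁺ x v x∉ d = trans (∣⁅⁆∪∣ x (img v) x∉) (cong suc d)

  distinct⇒injective : ∀ {m} (v : Vec (Fin n) m) → Distinct v → ∀ {i j} → lookup v i ≡ lookup v j → i ≡ j
  distinct⇒injective (x ∷ v) d {zero} {zero} e = refl
  distinct⇒injective (x ∷ v) d {zero} {suc j} e = ⊥-elim (proj₁ (distinct-∷⁻ x v d) (subst (_∈ img v) (sym e) (∈-img⁺ v j)))
  distinct⇒injective (x ∷ v) d {suc i} {zero} e = ⊥-elim (proj₁ (distinct-∷⁻ x v d) (subst (_∈ img v) e (∈-img⁺ v i)))
  distinct⇒injective (x ∷ v) d {suc i} {suc j} e = cong suc (distinct⇒injective v (proj₂ (distinct-∷⁻ x v d)) e)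

  imgOn⊆img : ∀ {m} (S : Subset m) (v : Vec (Fin n) m) → imgOn S v ⊆ img v
  imgOn⊆img S v p with ∈-imgOn⁻ S v p
  ... | i , _ , refl = ∈-img⁺ v i

  ∣imgOn∣ : ∀ {m} (S : Subset m) (v : Vec (Fin n) m) → Distinct v → ∣ imgOn S v ∣ ≡ ∣ S ∣
  ∣imgOn∣ [] [] d = ∣⊥∣≡0 n
  ∣imgOn∣ (true ∷ S) (x ∷ v) d with distinct-∷⁻ x v d
  ... | x∉ , d' = trans (∣⁅⁆∪∣ x (imgOn S v) (x∉ ∘ imgOn⊆img S v)) (cong suc (∣imgOn∣ S v d'))
  ∣imgOn∣ (false ∷ S) (x ∷ v) d = ∣imgOn∣ S v (proj₂ (distinct-∷⁻ x v d))

  imgOn-∪-∁ : ∀ {m} (S : Subset m) (v : Vec (Fin n) m) → imgOn S v ∪ imgOn (∁ S) v ≡ img v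
  imgOn-∪-∁ S v = ⊆-antisym
    (λ p → [ imgOn⊆img S v , imgOn⊆img (∁ S) v ]′ (x∈p∪q⁻ (imgOn S v) _ p))
    (λ p → case ∈-img⁻ v p of λ where
      (i , refl) → case i ∈? S of λ where
        (yes q) → ∈-∪ˡ (∈-imgOn⁺ S v q)
        (no ¬q) → ∈-∪ʳ (imgOn S v) (∈-imgOn⁺ (∁ S) v (x∉p⇒x∈∁p ¬q)))

  imgOn-disjoint-∁ : ∀ {m} (S : Subset m) (v : Vec (Fin n) m) → Distinct v → Disjoint (imgOn S v) (imgOn (∁ S) v)
  imgOn-disjoint-∁ S v d p q with ∈-imgOn⁻ S v p | ∈-imgOn⁻ (∁ S) v q
  ... | i , i∈ , e | j , j∈ , e' with distinct⇒injective v d (trans e (sym e'))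
  ...   | refl = x∈p⇒x∉∁p i∈ j∈

  imgOn-insertAt : ∀ {m} (S : Subset (suc m)) c (v : Vec (Fin n) m) y → c ∉ S →
    imgOn S (insertAt v c y) ≡ imgOn (removeAt S c) v
  imgOn-insertAt (true ∷ S) zero v y c∉ = ⊥-elim (c∉ Vec.here)
  imgOn-insertAt (false ∷ S) zero v y c∉ = refl
  imgOn-insertAt (true ∷ s ∷ S) (suc c) (x ∷ v) y c∉ = cong (⁅ x ⁆ ∪_) (imgOn-insertAt (s ∷ S) c v y (drop-not-there c∉))
  imgOn-insertAt (false ∷ s ∷ S) (suc c) (x ∷ v) y c∉ = imgOn-insertAt (s ∷ S) c v y (drop-not-there c∉)

  img-insertAt : ∀ {m} (v : Vec (Fin n) m) i y → img (insertAt v i y) ≡ ⁅ y ⁆ ∪ img v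
  img-insertAt v zero y = refl
  img-insertAt (x ∷ v) (suc i) y = trans (cong (⁅ x ⁆ ∪_) (img-insertAt v i y))
    (trans (sym (∪-assoc ⁅ x ⁆ ⁅ y ⁆ (img v))) (trans (cong (_∪ img v) (∪-comm ⁅ x ⁆ ⁅ y ⁆)) (∪-assoc ⁅ y ⁆ ⁅ x ⁆ (img v))))

  img-++ : ∀ {k m} (v : Vec (Fin n) k) (w : Vec (Fin n) m) → img (v Vec.++ w) ≡ img v ∪ img w
  img-++ [] w = sym (∪-identityˡ (img w))
  img-++ (x ∷ v) w = trans (cong (⁅ x ⁆ ∪_) (img-++ v w)) (sym (∪-assoc ⁅ x ⁆ (img v) (img w)))

  imgOn-∁⊥ : ∀ {m} (v : Vec (Fin n) m) → imgOn (∁ ⊥) v ≡ img v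
  imgOn-∁⊥ [] = refl
  imgOn-∁⊥ (x ∷ v) = cong (⁅ x ⁆ ∪_) (imgOn-∁⊥ v)

  imgOn-++ʳ : ∀ {k m} (v : Vec (Fin n) k) (w : Vec (Fin n) m) → imgOn (∁ (⊤ {k} Vec.++ ⊥)) (v Vec.++ w) ≡ img w
  imgOn-++ʳ [] w = imgOn-∁⊥ w
  imgOn-++ʳ (x ∷ v) w = imgOn-++ʳ v w

  -- Passes from subsets of `img v` to positions, where the counting lemmas apply; `imgOn-pullback`
  -- leads back.
  pullback : ∀ {m} → Subset n → Vec (Fin n) m → Subset m
  pullback P v = Vec.map (lookup P) v

  ∈-pullback⁺ : ∀ {m} P (v : Vec (Fin n) m) {i} → lookup v i ∈ P → i ∈ pullback P v
  ∈-pullback⁺ P v {i} p = lookup⇒[]= i _ (trans (lookup-map i (lookup P) v) ([]=⇒lookup p))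

  ∈-pullback⁻ : ∀ {m} P (v : Vec (Fin n) m) {i} → i ∈ pullback P v → lookup v i ∈ P
  ∈-pullback⁻ P v {i} p = lookup⇒[]= _ P (trans (sym (lookup-map i (lookup P) v)) ([]=⇒lookup p))

  imgOn-pullback : ∀ {m} P (v : Vec (Fin n) m) → P ⊆ img v → imgOn (pullback P v) v ≡ P
  imgOn-pullback P v s = ⊆-antisym
    (λ p → case ∈-imgOn⁻ _ v p of λ where (i , i∈ , refl) → ∈-pullback⁻ P v i∈)
    (λ p → case ∈-img⁻ v (s p) of λ where (i , refl) → ∈-imgOn⁺ _ v (∈-pullback⁺ P v p))

∣⊤++⊥∣ : ∀ k m → ∣ ⊤ {k} Vec.++ ⊥ {m} ∣ ≡ k
∣⊤++⊥∣ zero m = ∣⊥∣≡0 m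
∣⊤++⊥∣ (suc k) m = cong suc (∣⊤++⊥∣ k m)

img-suc : ∀ {n m} (v : Vec (Fin n) m) → img (Vec.map suc v) ≡ false ∷ img v
img-suc [] = refl
img-suc (x ∷ v) = cong (⁅ suc x ⁆ ∪_) (img-suc v)

enumerate : ∀ {n} (S : Subset n) → ∃ λ (v : Vec (Fin n) ∣ S ∣) → img v ≡ S
enumerate [] = [] , refl
enumerate (false ∷ S) = let (v , e) = enumerate S in Vec.map suc v , trans (img-suc v) (cong (false ∷_) e)
enumerate (true ∷ S) = let (v , e) = enumerate S in zero ∷ Vec.map suc v ,
  trans (cong (⁅ zero ⁆ ∪_) (img-suc v)) (cong (true ∷_) (trans (∪-identityˡ _) e))

∈-allSubsets : ∀ {n} (S : Subset n) → S ∈ˡ allSubsets n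
∈-allSubsets [] = here refl
∈-allSubsets (false ∷ S) = ∈-++⁺ˡ (∈-map⁺ _ (∈-allSubsets S))
∈-allSubsets (true ∷ S) = ∈-++⁺ʳ (map (false ∷_) (allSubsets _)) (∈-map⁺ _ (∈-allSubsets S))

∑-allSubsets-zero : (f : Subset 0 → ℕ) → ∑ (allSubsets 0) f ≡ f []
∑-allSubsets-zero f = trans (∑-cons [] [] f) (trans (cong (f [] +_) (∑-[] f)) (+-identityʳ _))

∑-zero : ∀ {A : Set} {xs : List A} {f : A → ℕ} → (∀ x → f x ≡ 0) → ∑ xs f ≡ 0
∑-zero {xs = xs} h = trans (∑-cong xs h) (trans (∑-const xs 0) (*-zeroʳ (length xs)))

∑-allSubsets-suc : ∀ n (f : Subset (suc n) → ℕ) →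
  ∑ (allSubsets (suc n)) f ≡ (∑[ S ∈ allSubsets n ] f (false ∷ S)) + (∑[ S ∈ allSubsets n ] f (true ∷ S))
∑-allSubsets-suc n f = trans (∑-++ (map (false ∷_) (allSubsets n)) _ f)
  (cong₂ _+_ (∑-map (false ∷_) (allSubsets n) f) (∑-map (true ∷_) (allSubsets n) f))

∑-allFin-suc : ∀ n (f : Fin (suc n) → ℕ) → ∑ (allFin (suc n)) f ≡ f zero + (∑[ i ∈ allFin n ] f (suc i))
∑-allFin-suc n f = trans (∑-cons zero _ f) (cong (f zero +_)
  (trans (cong (λ xs → ∑ xs f) (sym (map-tabulate (λ (i : Fin n) → i) suc))) (∑-map suc (allFin n) f)))

∑-∈-size : ∀ {n} (S : Subset n) → (∑[ x ∈ allFin n ] ι (x ∈? S)) ≡ ∣ S ∣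
∑-∈-size [] = ∑-[] _
∑-∈-size {suc n} (s ∷ S) = trans (∑-allFin-suc n _)
  (trans (cong (ι (zero ∈? (s ∷ S)) +_)
    (trans (∑-cong (allFin n) (λ x → ι-cong (suc x ∈? (s ∷ S)) (x ∈? S) drop-there Vec.there)) (∑-∈-size S))) (go s))
  where
  go : ∀ s → ι (zero ∈? (s ∷ S)) + ∣ S ∣ ≡ ∣ s ∷ S ∣
  go true = cong (_+ ∣ S ∣) (ι-yes (zero ∈? (true ∷ S)) Vec.here)
  go false = cong (_+ ∣ S ∣) (ι-no (zero ∈? (false ∷ S)) (λ ()))

∑-subsets-of : ∀ {n} (W : Subset n) → (∑[ X ∈ allSubsets n ] ι (X ⊆? W)) ≡ 2 ^ ∣ W ∣
∑-subsets-of [] = trans (∑-allSubsets-zero _) (ι-yes ([] ⊆? []) id)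
∑-subsets-of {suc n} (true ∷ W) = trans (∑-allSubsets-suc n _) (cong₂ _+_
  (trans (∑-cong (allSubsets n) (λ X → ι-cong ((false ∷ X) ⊆? (true ∷ W)) (X ⊆? W) drop-∷-⊆ out⊆)) (∑-subsets-of W))
  (trans (∑-cong (allSubsets n) (λ X → ι-cong ((true ∷ X) ⊆? (true ∷ W)) (X ⊆? W) drop-∷-⊆ s⊆s))
    (trans (∑-subsets-of W) (sym (+-identityʳ _)))))
∑-subsets-of {suc n} (false ∷ W) = trans (∑-allSubsets-suc n _) (trans (cong₂ _+_
  (trans (∑-cong (allSubsets n) (λ X → ι-cong ((false ∷ X) ⊆? (false ∷ W)) (X ⊆? W) drop-∷-⊆ s⊆s)) (∑-subsets-of W))
  (trans (∑-cong (allSubsets n) (λ X → ι-no ((true ∷ X) ⊆? (false ∷ W)) (λ s → case s Vec.here of λ ())))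
    (∑-zero {xs = allSubsets n} (λ _ → refl)))) (+-identityʳ _))

length-allSubsets : ∀ n → length (allSubsets n) ≡ 2 ^ n
length-allSubsets n = trans (sym (*-identityʳ _)) (trans (sym (∑-const (allSubsets n) 1))
  (trans (∑-cong (allSubsets n) (λ S → sym (ι-yes (S ⊆? ⊤) ⊆⊤))) (trans (∑-subsets-of ⊤) (cong (2 ^_) (∣⊤∣≡n n)))))

-- Adjoining x is a bijection from the sets without x onto the sets with x.
∑-adjoin : ∀ {n} (x : Fin n) (g : Subset n → ℕ) →
  (∑[ S ∈ allSubsets n ] (ι (¬? (x ∈? S)) * g (⁅ x ⁆ ∪ S))) ≡ (∑[ S ∈ allSubsets n ] (ι (x ∈? S) * g S))
∑-adjoin {suc n} zero g = trans (∑-allSubsets-suc n _) (trans (cong₂ _+_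
    (∑-cong (allSubsets n) (λ S → cong₂ _*_ (ι-cong (¬? (zero ∈? (false ∷ S))) (zero ∈? (true ∷ S)) (λ _ → Vec.here) (λ _ ()))
      (cong (λ S → g (true ∷ S)) (∪-identityˡ S))))
    (∑-zero (λ S → cong (_* g (true ∷ (⊥ ∪ S))) (ι-no (¬? (zero ∈? (true ∷ S))) (λ z∉ → z∉ Vec.here)))))
  (trans (+-comm _ 0) (sym (trans (∑-allSubsets-suc n _) (cong (_+ (∑[ S ∈ allSubsets n ] (ι (zero ∈? (true ∷ S)) * g (true ∷ S))))
    (∑-zero (λ S → cong (_* g (false ∷ S)) (ι-no (zero ∈? (false ∷ S)) (λ ())))))))))
∑-adjoin {suc n} (suc x) g = trans (∑-allSubsets-suc n _) (trans (cong₂ _+_ (part false) (part true)) (sym (∑-allSubsets-suc n _)))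
  where
  part : ∀ s → (∑[ S ∈ allSubsets n ] (ι (¬? (suc x ∈? (s ∷ S))) * g (⁅ suc x ⁆ ∪ (s ∷ S))))
             ≡ (∑[ S ∈ allSubsets n ] (ι (suc x ∈? (s ∷ S)) * g (s ∷ S)))
  part s = trans
    (∑-cong (allSubsets n) (λ S → cong (_* g (s ∷ (⁅ x ⁆ ∪ S)))
      (ι-cong (¬? (suc x ∈? (s ∷ S))) (¬? (x ∈? S)) (λ x∉ p → x∉ (Vec.there p)) (λ x∉ p → x∉ (drop-there p)))))
    (trans (∑-adjoin x (λ S → g (s ∷ S)))
      (∑-cong (allSubsets n) (λ S → cong (_* g (s ∷ S)) (ι-cong (x ∈? S) (suc x ∈? (s ∷ S)) Vec.there drop-there))))

-- Induction on the first entry: by `∑-adjoin` a set of size suc r arises once for each of its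
-- elements as first entry, and this turns r ! into suc r !.
∑-distinct-tuples : ∀ {n} r (p : Subset n → ℕ) →
  (∑[ v ∈ tuples n r ] (ι (distinct? v) * p (img v))) ≡ r ! * (∑[ S ∈ allSubsets n ] (ι (∣ S ∣ ≟ r) * p S))
∑-distinct-tuples {n} zero p = trans (∑-nil _) (trans (cong (_* p ⊥) (ι-yes (∣ ⊥ {n} ∣ ≟ 0) (∣⊥∣≡0 n))) (cong (_+ 0) (go n p)))
  where
  go : ∀ n (p : Subset n → ℕ) → p ⊥ ≡ (∑[ S ∈ allSubsets n ] (ι (∣ S ∣ ≟ 0) * p S))
  go zero p = sym (trans (∑-allSubsets-zero _) (trans (cong (_* p []) (ι-yes (0 ≟ 0) refl)) (+-identityʳ _)))
  go (suc n) p = sym (trans (∑-allSubsets-suc n _) (trans (cong₂ _+_ (sym (go n (λ S → p (false ∷ S))))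
    (∑-zero (λ S → cong (_* p (true ∷ S)) (ι-no (∣ true ∷ S ∣ ≟ 0) (λ ()))))) (+-identityʳ _)))
∑-distinct-tuples {n} (suc r) p = begin
  (∑[ v ∈ tuples n (suc r) ] (ι (distinct? v) * p (img v)))
    ≡⟨ ∑-∷ r _ ⟩
  (∑[ x ∈ allFin n ] ∑[ v ∈ tuples n r ] (ι (distinct? (x ∷ v)) * p (⁅ x ⁆ ∪ img v)))
    ≡⟨ ∑-cong (allFin n) (λ x → ∑-cong (tuples n r) (λ v → trans (cong (_* p (⁅ x ⁆ ∪ img v)) (split x v)) (*-assoc (ι (distinct? v)) _ _))) ⟩
  (∑[ x ∈ allFin n ] ∑[ v ∈ tuples n r ] (ι (distinct? v) * (ι (¬? (x ∈? img v)) * p (⁅ x ⁆ ∪ img v))))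
    ≡⟨ ∑-cong (allFin n) (λ x → ∑-distinct-tuples r (λ S → ι (¬? (x ∈? S)) * p (⁅ x ⁆ ∪ S))) ⟩
  (∑[ x ∈ allFin n ] (r ! * (∑[ S ∈ allSubsets n ] (ι (∣ S ∣ ≟ r) * (ι (¬? (x ∈? S)) * p (⁅ x ⁆ ∪ S))))))
    ≡⟨ ∑-*ˡ (allFin n) (r !) _ ⟩
  r ! * (∑[ x ∈ allFin n ] ∑[ S ∈ allSubsets n ] (ι (∣ S ∣ ≟ r) * (ι (¬? (x ∈? S)) * p (⁅ x ⁆ ∪ S))))
    ≡⟨ cong (r ! *_) (∑-cong (allFin n) (λ x → trans (∑-cong (allSubsets n) (shuffle x)) (∑-adjoin x (λ S → ι (∣ S ∣ ≟ suc r) * p S)))) ⟩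
  r ! * (∑[ x ∈ allFin n ] ∑[ S ∈ allSubsets n ] (ι (x ∈? S) * (ι (∣ S ∣ ≟ suc r) * p S)))
    ≡⟨ cong (r ! *_) (∑-swap (allFin n) (allSubsets n) _) ⟩
  r ! * (∑[ S ∈ allSubsets n ] ∑[ x ∈ allFin n ] (ι (x ∈? S) * (ι (∣ S ∣ ≟ suc r) * p S)))
    ≡⟨ cong (r ! *_) (∑-cong (allSubsets n) size) ⟩
  r ! * (∑[ S ∈ allSubsets n ] (suc r * (ι (∣ S ∣ ≟ suc r) * p S)))
    ≡⟨ cong (r ! *_) (∑-*ˡ (allSubsets n) (suc r) _) ⟩
  r ! * (suc r * (∑[ S ∈ allSubsets n ] (ι (∣ S ∣ ≟ suc r) * p S)))
    ≡⟨ *-assoc (r !) (suc r) _ ⟨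
  r ! * suc r * (∑[ S ∈ allSubsets n ] (ι (∣ S ∣ ≟ suc r) * p S))
    ≡⟨ cong (_* (∑[ S ∈ allSubsets n ] (ι (∣ S ∣ ≟ suc r) * p S))) (*-comm (r !) (suc r)) ⟩
  suc r ! * (∑[ S ∈ allSubsets n ] (ι (∣ S ∣ ≟ suc r) * p S)) ∎
  where
  open ≡-Reasoning
  split : ∀ x (v : Vec (Fin n) r) → ι (distinct? (x ∷ v)) ≡ ι (distinct? v) * ι (¬? (x ∈? img v))
  split x v = case distinct? v of λ where
    (no ¬d) → trans (ι-no (distinct? (x ∷ v)) (λ e → ¬d (proj₂ (distinct-∷⁻ x v e)))) (sym (cong (_* ι (¬? (x ∈? img v))) (ι-no (distinct? v) ¬d)))
    (yes d) → trans (ι-cong (distinct? (x ∷ v)) (¬? (x ∈? img v)) (λ e → proj₁ (distinct-∷⁻ x v e)) (λ x∉ → distinct-∷⁺ x v x∉ d))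
      (sym (trans (cong (_* ι (¬? (x ∈? img v))) (ι-yes (distinct? v) d)) (+-identityʳ _)))
  shuffle : ∀ x S → ι (∣ S ∣ ≟ r) * (ι (¬? (x ∈? S)) * p (⁅ x ⁆ ∪ S))
                  ≡ ι (¬? (x ∈? S)) * (ι (∣ ⁅ x ⁆ ∪ S ∣ ≟ suc r) * p (⁅ x ⁆ ∪ S))
  shuffle x S = trans (swap₁₂ (ι (∣ S ∣ ≟ r)) (ι (¬? (x ∈? S))) (p (⁅ x ⁆ ∪ S))) (case x ∈? S of λ where
    (yes x∈) → let z = ι-no (¬? (x ∈? S)) (λ x∉ → x∉ x∈) in
      trans (cong (_* (ι (∣ S ∣ ≟ r) * p (⁅ x ⁆ ∪ S))) z) (sym (cong (_* (ι (∣ ⁅ x ⁆ ∪ S ∣ ≟ suc r) * p (⁅ x ⁆ ∪ S))) z))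
    (no x∉) → cong (λ k → ι (¬? (x ∈? S)) * (k * p (⁅ x ⁆ ∪ S))) (ι-cong (∣ S ∣ ≟ r) (∣ ⁅ x ⁆ ∪ S ∣ ≟ suc r)
       (λ e → trans (∣⁅⁆∪∣ x S x∉) (cong suc e)) (λ e → suc-injective (trans (sym (∣⁅⁆∪∣ x S x∉)) e))))
    where
    swap₁₂ : ∀ a b c → a * (b * c) ≡ b * (a * c)
    swap₁₂ a b c = trans (sym (*-assoc a b c)) (trans (cong (_* c) (*-comm a b)) (*-assoc b a c))
  size : ∀ S → (∑[ x ∈ allFin n ] (ι (x ∈? S) * (ι (∣ S ∣ ≟ suc r) * p S))) ≡ suc r * (ι (∣ S ∣ ≟ suc r) * p S)
  size S = trans (∑-*ʳ (allFin n) _ (λ x → ι (x ∈? S))) (trans (cong (_* (ι (∣ S ∣ ≟ suc r) * p S)) (∑-∈-size S)) go)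
    where
    go : ∣ S ∣ * (ι (∣ S ∣ ≟ suc r) * p S) ≡ suc r * (ι (∣ S ∣ ≟ suc r) * p S)
    go = case ∣ S ∣ ≟ suc r of λ where
      (yes e) → cong (_* (ι (∣ S ∣ ≟ suc r) * p S)) e
      (no ¬e) → let z = cong (_* p S) (ι-no (∣ S ∣ ≟ suc r) ¬e) in
        trans (trans (cong (∣ S ∣ *_) z) (*-zeroʳ ∣ S ∣)) (sym (trans (cong (suc r *_) z) (*-zeroʳ (suc r))))

-- Counting tuples

∑-∈-≤ : ∀ {n} (P : Subset n) {N} c → ∣ P ∣ ≤ N → (∑[ y ∈ allFin n ] (ι (y ∈? P) * c)) ≤ N * c
∑-∈-≤ {n} P c le = ≤-trans (≤-reflexive (trans (∑-*ʳ (allFin n) c _) (cong (_* c) (∑-∈-size P)))) (*-monoˡ-≤ c le)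

-- By `imgOn-insertAt` the set `𝒞 (imgOn S v)` does not depend on the entry at c, which is therefore
-- left with N values instead of n. The weight `q` carries a second condition that survives the
-- deletion of c and can be counted afterwards.
count-determined : ∀ {n m N} (𝒞 : Subset n → Subset n) → (∀ P → ∣ 𝒞 P ∣ ≤ N) →
  ∀ (S : Subset (suc m)) c → c ∉ S → (q : Vec (Fin n) (suc m) → ℕ) (q' : Vec (Fin n) m → ℕ) →
  (∀ D y → q (insertAt D c y) ≤ q' D) →
  (∑[ v ∈ tuples n (suc m) ] (ι (lookup v c ∈? 𝒞 (imgOn S v)) * q v)) ≤ N * (∑[ D ∈ tuples n m ] q' D)
count-determined {n} {m} {N} 𝒞 C≤ S c c∉ q q' q≤ = begin
  (∑[ v ∈ tuples n (suc m) ] (ι (lookup v c ∈? 𝒞 (imgOn S v)) * q v))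
    ≡⟨ ∑-insertAt m c _ ⟩
  (∑[ D ∈ tuples n m ] ∑[ y ∈ allFin n ] (ι (lookup (insertAt D c y) c ∈? 𝒞 (imgOn S (insertAt D c y))) * q (insertAt D c y)))
    ≤⟨ ∑-mono (tuples n m) (λ D → ≤-trans (∑-mono (allFin n) (λ y → *-mono-≤
         (ι-mono (lookup (insertAt D c y) c ∈? 𝒞 (imgOn S (insertAt D c y))) (y ∈? 𝒞 (imgOn (removeAt S c) D))
           (λ p → subst (_∈ 𝒞 (imgOn (removeAt S c) D)) (insertAt-lookup D c y)
              (subst (λ P → lookup (insertAt D c y) c ∈ 𝒞 P) (imgOn-insertAt S c D y c∉) p)))
         (q≤ D y)))
         (∑-∈-≤ (𝒞 (imgOn (removeAt S c) D)) (q' D) (C≤ _))) ⟩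
  (∑[ D ∈ tuples n m ] (N * q' D))
    ≡⟨ ∑-*ˡ (tuples n m) N q' ⟩
  N * (∑[ D ∈ tuples n m ] q' D) ∎
  where open ≤-Reasoning

count-determined₁ : ∀ {n m N} (𝒞 : Subset n → Subset n) → (∀ P → ∣ 𝒞 P ∣ ≤ N) →
  ∀ (S : Subset (suc m)) c → c ∉ S →
  (∑[ v ∈ tuples n (suc m) ] ι (lookup v c ∈? 𝒞 (imgOn S v))) ≤ N * n ^ m
count-determined₁ {n} {m} {N} 𝒞 C≤ S c c∉ = ≤-trans
  (≤-reflexive (∑-cong (tuples n (suc m)) (λ v → sym (*-identityʳ _))))
  (≤-trans (count-determined 𝒞 C≤ S c c∉ (λ _ → 1) (λ _ → 1) (λ _ _ → ≤-refl))
    (*-monoʳ-≤ N (≤-reflexive (trans (∑-tuples-const n m 1) (*-identityʳ _)))))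

-- The side of the partition of the positions into S and ∁ S that misses c. An arrow always leads
-- from one side to a vertex of the other.
opposite : ∀ {m} → Subset m → Fin m → Subset m
opposite S c with c ∈? S
... | yes _ = ∁ S
... | no _ = S

∉-opposite : ∀ {m} (S : Subset m) c → c ∉ opposite S c
∉-opposite S c with c ∈? S
... | yes p = x∈p⇒x∉∁p p
... | no ¬p = ¬p

opposite-∈ : ∀ {m} (S : Subset m) {c} → c ∈ S → opposite S c ≡ ∁ S
opposite-∈ S {c} c∈ with c ∈? S
... | yes _ = refl
... | no ¬p = ⊥-elim (¬p c∈)

opposite-∉ : ∀ {m} (S : Subset m) {c} → c ∉ S → opposite S c ≡ S
opposite-∉ S {c} c∉ with c ∈? S
... | yes p = ⊥-elim (c∉ p)
... | no _ = refl

ArrowAt : ∀ {n m} → (Subset n → Subset n) → Subset m → Vec (Fin n) m → Fin m → Set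
ArrowAt 𝒞 S v c = lookup v c ∈ 𝒞 (imgOn (opposite S c) v)

arrowAt? : ∀ {n m} (𝒞 : Subset n → Subset n) (S : Subset m) (v : Vec (Fin n) m) c → Dec (ArrowAt 𝒞 S v c)
arrowAt? 𝒞 S v c = lookup v c ∈? 𝒞 (imgOn (opposite S c) v)

arrow? : ∀ {n m} (𝒞 : Subset n → Subset n) (S : Subset m) (v : Vec (Fin n) m) → Dec (∃ (ArrowAt 𝒞 S v))
arrow? 𝒞 S v = Fin.any? (arrowAt? 𝒞 S v)

count-arrow : ∀ {n m N} (𝒞 : Subset n → Subset n) → (∀ P → ∣ 𝒞 P ∣ ≤ N) → ∀ (S : Subset (suc m)) →
  (∑[ v ∈ tuples n (suc m) ] ι (arrow? 𝒞 S v)) ≤ suc m * (N * n ^ m)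
count-arrow {n} {m} {N} 𝒞 C≤ S = begin
  (∑[ v ∈ tuples n (suc m) ] ι (arrow? 𝒞 S v))
    ≤⟨ ∑-mono (tuples n (suc m)) (λ v → ι-∃ (arrow? 𝒞 S v) (allFin (suc m)) (arrowAt? 𝒞 S v) (λ (c , p) → c , ∈-allFin c , p)) ⟩
  (∑[ v ∈ tuples n (suc m) ] ∑[ c ∈ allFin (suc m) ] ι (arrowAt? 𝒞 S v c))
    ≡⟨ ∑-swap (tuples n (suc m)) (allFin (suc m)) _ ⟩
  (∑[ c ∈ allFin (suc m) ] ∑[ v ∈ tuples n (suc m) ] ι (arrowAt? 𝒞 S v c))
    ≤⟨ ∑-mono (allFin (suc m)) (λ c → count-determined₁ 𝒞 C≤ (opposite S c) c (∉-opposite S c)) ⟩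
  (∑[ c ∈ allFin (suc m) ] (N * n ^ m))
    ≡⟨ ∑-allFin-const (suc m) _ ⟩
  suc m * (N * n ^ m) ∎
  where open ≤-Reasoning

Generic : ∀ {n m} → Subset n → Vec (Fin n) m → Set
Generic Y v = Distinct v × Disjoint (img v) Y

generic? : ∀ {n m} (Y : Subset n) (v : Vec (Fin n) m) → Dec (Generic Y v)
generic? Y v = distinct? v ×-dec disjoint? (img v) Y

-- A new entry does harm only on at most m + |Y| vertices, and m such losses, each a fraction 1 / n
-- of all tuples, add up. The factor n stands on the left to avoid division.
count-¬generic : ∀ {n} (Y : Subset n) m →
  n * (∑[ v ∈ tuples n m ] ι (¬? (generic? Y v))) ≤ m * (m + ∣ Y ∣) * n ^ m
count-¬generic {n} Y zero = ≤-reflexive (trans (cong (n *_) (trans (∑-nil _)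
  (ι-no (¬? (generic? Y [])) (λ ¬g → ¬g (∣⊥∣≡0 n , λ p → ⊥-elim (∉⊥ p)))))) (*-zeroʳ n))
count-¬generic {n} Y (suc m) = begin
  n * (∑[ v ∈ tuples n (suc m) ] ι (¬? (generic? Y v)))
    ≡⟨ cong (n *_) (∑-insertAt m zero _) ⟩
  n * (∑[ v ∈ tuples n m ] ∑[ x ∈ allFin n ] ι (¬? (generic? Y (x ∷ v))))
    ≤⟨ *-monoʳ-≤ n (∑-mono (tuples n m) (λ v → ∑-mono (allFin n) (λ x →
         ι-⊎ (¬? (generic? Y (x ∷ v))) (x ∈? (img v ∪ Y)) (¬? (generic? Y v)) (cases x v)))) ⟩
  n * (∑[ v ∈ tuples n m ] ∑[ x ∈ allFin n ] (ι (x ∈? (img v ∪ Y)) + ι (¬? (generic? Y v))))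
    ≡⟨ cong (n *_) (∑-cong (tuples n m) (λ v → trans (∑-+ (allFin n) _ _) (cong₂ _+_ (∑-∈-size (img v ∪ Y)) (∑-allFin-const n _)))) ⟩
  n * (∑[ v ∈ tuples n m ] (∣ img v ∪ Y ∣ + n * ι (¬? (generic? Y v))))
    ≡⟨ cong (n *_) (∑-+ (tuples n m) _ _) ⟩
  n * ((∑[ v ∈ tuples n m ] ∣ img v ∪ Y ∣) + (∑[ v ∈ tuples n m ] (n * ι (¬? (generic? Y v)))))
    ≤⟨ *-monoʳ-≤ n (+-mono-≤
         (∑-tuples-≤ n m (λ v → ≤-trans (∣∪∣≤ (img v) Y) (+-monoˡ-≤ ∣ Y ∣ (∣img∣≤ v))))
         (≤-trans (≤-reflexive (∑-*ˡ (tuples n m) n _)) (count-¬generic Y m))) ⟩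
  n * (n ^ m * (m + ∣ Y ∣) + m * (m + ∣ Y ∣) * n ^ m)
    ≡⟨ solve 4 (λ n p y m → n :* (p :* y :+ m :* y :* p) := (con 1 :+ m) :* y :* (n :* p)) refl n (n ^ m) (m + ∣ Y ∣) m ⟩
  suc m * (m + ∣ Y ∣) * n ^ suc m
    ≤⟨ *-monoˡ-≤ (n ^ suc m) (*-monoʳ-≤ (suc m) (n≤1+n (m + ∣ Y ∣))) ⟩
  suc m * (suc m + ∣ Y ∣) * n ^ suc m ∎
  where
  open ≤-Reasoning
  open +-*-Solver using (solve; _:*_; _:+_; _:=_; con)
  cases : ∀ x v → ¬ Generic Y (x ∷ v) → x ∈ img v ∪ Y ⊎ ¬ Generic Y v
  cases x v ¬g with x ∈? (img v ∪ Y)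
  ... | yes p = inj₁ p
  ... | no ¬p = inj₂ λ (d , e) → ¬g (distinct-∷⁺ x v (¬p ∘ ∈-∪ˡ) d ,
          λ q y → [ (λ eq → ¬p (∈-∪ʳ (img v) (subst (_∈ Y) eq y))) , (λ q → e q y) ]′ (∈-⁅⁆∪⁻ q))

removeAt-suc : ∀ {A : Set} {m} x (w : Vec A (suc m)) j → removeAt (x ∷ w) (suc j) ≡ x ∷ removeAt w j
removeAt-suc x (y ∷ w) j = refl

Deletions : ∀ {A : Set} {m} → (Vec A m → Set) → Vec A (suc m) → Set
Deletions 𝒮 w = ∀ j → 𝒮 (removeAt w j)

deletions? : ∀ {A : Set} {m} {𝒮 : Vec A m → Set} → (∀ v → Dec (𝒮 v)) → ∀ w → Dec (Deletions 𝒮 w)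
deletions? 𝒮? w = Fin.all? (λ j → 𝒮? (removeAt w j))

-- A soft form of the Loomis–Whitney inequality: a slice of 𝒮 over a first coordinate is either sparse, so that
-- induction applies to it, or so dense that there are few such slices.
loomis-whitney : ∀ m M → ∃ λ G → ∀ n {𝒮 : Vec (Fin n) m → Set} (𝒮? : ∀ v → Dec (𝒮 v)) →
  G * (∑[ v ∈ tuples n m ] ι (𝒮? v)) ≤ n ^ m →
  M * (∑[ w ∈ tuples n (suc m) ] ι (deletions? 𝒮? w)) ≤ n * (∑[ v ∈ tuples n m ] ι (𝒮? v))
-- For m = 0 the hypothesis reads 2 * |𝒮| ≤ 1, so 𝒮 is empty.
loomis-whitney zero M = 2 , λ n 𝒮? small → ≤-trans (≤-reflexive (trans (cong (M *_) (∑-zero (λ { (x ∷ []) →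
    ι-no (deletions? 𝒮? (x ∷ [])) (λ d → empty n 𝒮? small (d zero)) }))) (*-zeroʳ M))) z≤n
  where
  empty : ∀ n {𝒮 : Vec (Fin n) 0 → Set} (𝒮? : ∀ v → Dec (𝒮 v)) → 2 * (∑[ v ∈ tuples n 0 ] ι (𝒮? v)) ≤ 1 → ¬ 𝒮 []
  empty n 𝒮? small s with subst (λ k → 2 * k ≤ 1) (trans (∑-nil (λ v → ι (𝒮? v))) (ι-yes (𝒮? []) s)) small
  ... | s≤s ()
-- Sparse and dense slices each receive half of the budget, whence 2 * M.
loomis-whitney (suc m) M with loomis-whitney m (2 * M)
... | g , ih = 2 * M * g , bound
  where
  bound : ∀ n {𝒮 : Vec (Fin n) (suc m) → Set} (𝒮? : ∀ v → Dec (𝒮 v)) →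
    2 * M * g * (∑[ v ∈ tuples n (suc m) ] ι (𝒮? v)) ≤ n ^ suc m →
    M * (∑[ w ∈ tuples n (2 + m) ] ι (deletions? 𝒮? w)) ≤ n * (∑[ v ∈ tuples n (suc m) ] ι (𝒮? v))
  bound zero 𝒮? small = ≤-trans (*-monoʳ-≤ M (∑-tuples-≤ 0 (2 + m) (λ w → ι≤1 (deletions? 𝒮? w)))) (≤-reflexive (*-zeroʳ M))
  bound n@(suc _) {𝒮} 𝒮? small = *-cancelˡ-≤ (2 * n ^ m) {{m*n≢0 2 (n ^ m) {{_}} {{m^n≢0 n m}}}} (begin
    2 * n ^ m * (M * d)
      ≡⟨ solve 3 (λ p M d → con 2 :* p :* (M :* d) := con 2 :* M :* p :* d) refl (n ^ m) M d ⟩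
    2 * M * n ^ m * d
      ≡⟨ cong (2 * M * n ^ m *_) (∑-∷ (suc m) _) ⟩
    2 * M * n ^ m * (∑[ z ∈ allFin n ] δ z)
      ≡⟨ ∑-*ˡ (allFin n) (2 * M * n ^ m) δ ⟨
    (∑[ z ∈ allFin n ] (2 * M * n ^ m * δ z))
      ≤⟨ ∑-mono (allFin n) fibre ⟩
    (∑[ z ∈ allFin n ] ((n * n ^ m + 2 * M * g * s) * σ z))
      ≡⟨ ∑-*ˡ (allFin n) (n * n ^ m + 2 * M * g * s) σ ⟩
    (n * n ^ m + 2 * M * g * s) * (∑[ z ∈ allFin n ] σ z)
      ≡⟨ cong ((n * n ^ m + 2 * M * g * s) *_) (∑-∷ m _) ⟨
    (n * n ^ m + 2 * M * g * s) * s
      ≤⟨ *-monoˡ-≤ s (+-monoʳ-≤ (n * n ^ m) small) ⟩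
    (n * n ^ m + n * n ^ m) * s
      ≡⟨ solve 3 (λ n p s → (n :* p :+ n :* p) :* s := con 2 :* p :* (n :* s)) refl n (n ^ m) s ⟩
    2 * n ^ m * (n * s) ∎)
    where
    open ≤-Reasoning
    open +-*-Solver using (solve; _:*_; _:+_; _:=_; con)
    s = ∑[ v ∈ tuples n (suc m) ] ι (𝒮? v)
    d = ∑[ w ∈ tuples n (2 + m) ] ι (deletions? 𝒮? w)
    σ δ : Fin n → ℕ
    σ z = ∑[ v ∈ tuples n m ] ι (𝒮? (z ∷ v))
    δ z = ∑[ w ∈ tuples n (suc m) ] ι (deletions? 𝒮? (z ∷ w))
    fibre : ∀ z → 2 * M * n ^ m * δ z ≤ (n * n ^ m + 2 * M * g * s) * σ z
    fibre z with g * σ z ≤? n ^ m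
    ... | yes sparse = begin
      2 * M * n ^ m * δ z
        ≡⟨ solve 3 (λ M p d → con 2 :* M :* p :* d := p :* (con 2 :* M :* d)) refl M (n ^ m) (δ z) ⟩
      n ^ m * (2 * M * δ z)
        ≤⟨ *-monoʳ-≤ (n ^ m) (≤-trans (*-monoʳ-≤ (2 * M) (∑-mono (tuples n (suc m)) (λ w →
             ι-mono (deletions? 𝒮? (z ∷ w)) (deletions? (λ v → 𝒮? (z ∷ v)) w) (λ D j → subst 𝒮 (removeAt-suc z w j) (D (suc j))))))
             (ih n (λ v → 𝒮? (z ∷ v)) sparse)) ⟩
      n ^ m * (n * σ z)
        ≡⟨ solve 3 (λ p n x → p :* (n :* x) := n :* p :* x) refl (n ^ m) n (σ z) ⟩
      n * n ^ m * σ z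
        ≤⟨ *-monoˡ-≤ (σ z) (m≤m+n (n * n ^ m) (2 * M * g * s)) ⟩
      (n * n ^ m + 2 * M * g * s) * σ z ∎
    -- Deleting z itself puts w into 𝒮, so `δ z` is at most s, while density pays for the factor n ^
    -- m.
    ... | no ¬sparse = begin
      2 * M * n ^ m * δ z
        ≤⟨ *-mono-≤ (*-monoʳ-≤ (2 * M) (<⇒≤ (≰⇒> ¬sparse))) (∑-mono (tuples n (suc m)) (λ w →
             ι-mono (deletions? 𝒮? (z ∷ w)) (𝒮? w) (λ D → D zero))) ⟩
      2 * M * (g * σ z) * s
        ≡⟨ solve 4 (λ M g x s → con 2 :* M :* (g :* x) :* s := con 2 :* M :* g :* s :* x) refl M g (σ z) s ⟩
      2 * M * g * s * σ z
        ≤⟨ *-monoˡ-≤ (σ z) (m≤n+m (2 * M * g * s) (n * n ^ m)) ⟩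
      (n * n ^ m + 2 * M * g * s) * σ z ∎

-- Functions of a tuple that rarely change with a single entry

hybrid-step : ∀ {A : Set} {m} k (xs ys : Vec A (suc m)) → k ≤ m →
  ∃ λ D → ∃ λ i → ∃ λ p → ∃ λ q → hybrid k xs ys ≡ insertAt D i p × hybrid (suc k) xs ys ≡ insertAt D i q
hybrid-step zero (x ∷ xs) (y ∷ ys) le = xs , zero , x , y , refl , refl
hybrid-step {m = suc m} (suc k) (x ∷ xs) (y ∷ ys) (s≤s le) with hybrid-step k xs ys le
... | D , i , p , q , e , e' = y ∷ D , suc i , p , q , cong (y ∷_) e , cong (y ∷_) e'

hybrid-full : ∀ {A : Set} {m} (xs ys : Vec A m) → hybrid m xs ys ≡ ys
hybrid-full [] [] = refl
hybrid-full (x ∷ xs) (y ∷ ys) = cong (y ∷_) (hybrid-full xs ys)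

-- Consecutive hybrids differ in one entry, so on the way from x to y the value of f can change only
-- next to a bad hybrid, which the first alternative reports.
hybrid-walk : ∀ {B A : Set} {m} (f : Vec B (suc m) → A) {Bad : Vec B (suc m) → Set} (bad? : ∀ v → Dec (Bad v)) →
  (∀ D i p q → ¬ Bad (insertAt D i p) → ¬ Bad (insertAt D i q) → f (insertAt D i p) ≡ f (insertAt D i q)) →
  ∀ x y → ¬ Bad x → ∀ k → k ≤ suc m →
  (∃ λ j → j ≤ suc m × Bad (hybrid j x y)) ⊎ (¬ Bad (hybrid k x y) × f (hybrid k x y) ≡ f x)
hybrid-walk f bad? agree x y good zero le = inj₂ (good , refl)
hybrid-walk f {Bad} bad? agree x y good (suc k) le with hybrid-walk f bad? agree x y good k (≤-trans (n≤1+n k) le)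
... | inj₁ b = inj₁ b
... | inj₂ (g , e) with bad? (hybrid (suc k) x y)
...   | yes b = inj₁ (suc k , le , b)
...   | no g' with hybrid-step k x y (≤-pred le)
...     | D , i , p , q , ep , eq = inj₂ (g' , trans (cong f eq)
            (trans (sym (agree D i p q (subst (¬_ ∘ Bad) ep g) (subst (¬_ ∘ Bad) eq g'))) (trans (cong f (sym ep)) e)))

-- For random x and y each of the hybrids on the way from x to y is a uniformly random tuple, hence rarely bad.
almost-constant : ∀ {n m} {A : Set} (_≟ᴬ_ : (x y : A) → Dec (x ≡ y)) (f : Vec (Fin n) (suc m) → A)
  {Bad : Vec (Fin n) (suc m) → Set} (bad? : ∀ v → Dec (Bad v)) →
  (∀ D i p q → ¬ Bad (insertAt D i p) → ¬ Bad (insertAt D i q) → f (insertAt D i p) ≡ f (insertAt D i q)) →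
  (2 + m) * (∑[ v ∈ tuples n (suc m) ] ι (bad? v)) < n ^ suc m →
  ∃ λ x → ¬ Bad x × (∑[ y ∈ tuples n (suc m) ] ι (¬? (f y ≟ᴬ f x))) ≤ (2 + m) * (∑[ v ∈ tuples n (suc m) ] ι (bad? v))
almost-constant {n} {m} _≟ᴬ_ f {Bad} bad? agree few = x , good , ≤-trans (∑-mono Ts near) x≤
  where
  Ts = tuples n (suc m)
  β = ∑[ v ∈ Ts ] ι (bad? v)
  path : ∀ x → ℕ
  path x = ∑[ y ∈ Ts ] ∑[ k ∈ upTo (2 + m) ] ι (bad? (hybrid k x y))
  total : ∑ Ts path ≡ length Ts * ((2 + m) * β)
  total = begin
    (∑[ x ∈ Ts ] ∑[ y ∈ Ts ] ∑[ k ∈ upTo (2 + m) ] ι (bad? (hybrid k x y)))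
      ≡⟨ ∑-cong Ts (λ x → ∑-swap Ts (upTo (2 + m)) _) ⟩
    (∑[ x ∈ Ts ] ∑[ k ∈ upTo (2 + m) ] ∑[ y ∈ Ts ] ι (bad? (hybrid k x y)))
      ≡⟨ ∑-swap Ts (upTo (2 + m)) _ ⟩
    (∑[ k ∈ upTo (2 + m) ] ∑[ x ∈ Ts ] ∑[ y ∈ Ts ] ι (bad? (hybrid k x y)))
      ≡⟨ ∑-cong (upTo (2 + m)) (λ k → ∑-hybrid n (suc m) k (λ v → ι (bad? v))) ⟩
    (∑[ k ∈ upTo (2 + m) ] (n ^ suc m * β))
      ≡⟨ ∑-const (upTo (2 + m)) _ ⟩
    length (upTo (2 + m)) * (n ^ suc m * β)
      ≡⟨ cong₂ (λ a b → a * (b * β)) (length-upTo (2 + m)) (sym (length-tuples n (suc m))) ⟩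
    (2 + m) * (length Ts * β)
      ≡⟨ x∙yz≈y∙xz (2 + m) (length Ts) β ⟩
    length Ts * ((2 + m) * β) ∎
    where
    open ≡-Reasoning
  -- Some x meets at most the average number of bad hybrids, counted over all y.
  average = ∑-average Ts path (≤-trans (s≤s z≤n) (≤-trans few (≤-reflexive (sym (length-tuples n (suc m)))))) (≤-reflexive total)
  x = proj₁ average
  x≤ : path x ≤ (2 + m) * β
  x≤ = proj₂ average
  hit : ∀ y k → k ≤ suc m → Bad (hybrid k x y) → 1 ≤ ∑[ k ∈ upTo (2 + m) ] ι (bad? (hybrid k x y))
  hit y k le b = ≤-trans (ι-≥1 (bad? (hybrid k x y)) b) (∑-∈ (λ k → ι (bad? (hybrid k x y))) (∈-upTo⁺ (s≤s le)))
  -- The hybrid for k = 0 is x itself, so a bad x would be met once for every y, against `few`.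
  good : ¬ Bad x
  good b = <-irrefl refl (≤-trans few (≤-trans (≤-reflexive (sym (trans (∑-tuples-const n (suc m) 1) (*-identityʳ _))))
    (≤-trans (∑-mono Ts (λ y → hit y 0 z≤n b)) x≤)))
  near : ∀ y → ι (¬? (f y ≟ᴬ f x)) ≤ ∑[ k ∈ upTo (2 + m) ] ι (bad? (hybrid k x y))
  near y = ι-≤ (¬? (f y ≟ᴬ f x)) λ ne → case hybrid-walk f bad? agree x y good (suc m) ≤-refl of λ where
    (inj₁ (j , le , b)) → hit y j le b
    (inj₂ (_ , e)) → ⊥-elim (ne (trans (cong f (sym (hybrid-full x y))) e))


-- Peeling

_≟ˢ_ : ∀ {n} (P Q : Subset n) → Dec (P ≡ Q)
_≟ˢ_ = ≡-dec Bool._≟_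

Rel : ℕ → Set
Rel n = Subset n → Subset n → Bool

-- The outcome of repeatedly discarding a row or column of R all of whose members meet one set of at most N vertices;
-- the covers record these sets.
record Core {n} (N : ℕ) (R : Rel n) : Set where
  field
    core : Rel n
    core⊆ : ∀ {P Q} → core P Q ≡ true → R P Q ≡ true
    rich-row : ∀ {P Q} → core P Q ≡ true → ∀ Y → ∣ Y ∣ ≤ N → ∃ λ Q' → core P Q' ≡ true × Disjoint Q' Y
    rich-col : ∀ {P Q} → core P Q ≡ true → ∀ Y → ∣ Y ∣ ≤ N → ∃ λ P' → core P' Q ≡ true × Disjoint P' Y
    rowCover colCover : Subset n → Subset n
    ∣rowCover∣ : ∀ P → ∣ rowCover P ∣ ≤ N
    ∣colCover∣ : ∀ Q → ∣ colCover Q ∣ ≤ N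
    covered : ∀ {P Q} → R P Q ≡ true → core P Q ≡ false → Meets Q (rowCover P) ⊎ Meets P (colCover Q)

  -- One function for rows and columns alike, so that arrows in both directions are counted with a
  -- single 𝒞; this doubles the bound N.
  cover : Subset n → Subset n
  cover P = rowCover P ∪ colCover P

  ∣cover∣ : ∀ P → ∣ cover P ∣ ≤ N + N
  ∣cover∣ P = ≤-trans (∣∪∣≤ (rowCover P) (colCover P)) (+-mono-≤ (∣rowCover∣ P) (∣colCover∣ P))

  meets-cover : ∀ {P Q} → R P Q ≡ true → core P Q ≡ false → Meets Q (cover P) ⊎ Meets P (cover Q)
  meets-cover {P} {Q} p q with covered p q
  ... | inj₁ (x , y , z) = inj₁ (x , y , ∈-∪ˡ z)
  ... | inj₂ (x , y , z) = inj₂ (x , y , ∈-∪ʳ (rowCover Q) z)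

size : ∀ {n} → Rel n → ℕ
size {n} R = ∑[ P ∈ allSubsets n ] ∑[ Q ∈ allSubsets n ] ι (R P Q Bool.≟ true)

module _ {A : Set} where
  opaque
    unfolding ∑
    ∑-strict : ∀ {xs : List A} {f g : A → ℕ} → (∀ x → f x ≤ g x) → ∀ {x} → x ∈ˡ xs → f x < g x → ∑ xs f < ∑ xs g
    ∑-strict {_ ∷ xs} h (here refl) lt = +-mono-<-≤ lt (∑-mono xs h)
    ∑-strict {y ∷ xs} h (there p) lt = +-mono-≤-< (h y) (∑-strict h p lt)

size-strict : ∀ {n} {R R' : Rel n} → (∀ {P Q} → R' P Q ≡ true → R P Q ≡ true) →
  ∀ {P Q} → R P Q ≡ true → R' P Q ≡ false → size R' < size R
size-strict {n} {R} {R'} sub {P} {Q} p q = ∑-strict (λ P → ∑-mono (allSubsets n) (le P)) (∈-allSubsets P)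
  (∑-strict (le P) (∈-allSubsets Q) (≤-trans
     (s≤s (≤-reflexive (ι-no (R' P Q Bool.≟ true) (λ e → case trans (sym q) e of λ ()))))
     (ι-≥1 (R P Q Bool.≟ true) p)))
  where
  le : ∀ P Q → ι (R' P Q Bool.≟ true) ≤ ι (R P Q Bool.≟ true)
  le P Q = ι-mono (R' P Q Bool.≟ true) (R P Q Bool.≟ true) sub

-- The row has to be nonempty so that dropping it decreases `size`; this terminates the peeling.
PoorRow : ∀ {n} → ℕ → Rel n → Subset n → Set
PoorRow N R P = (∃ λ Q → R P Q ≡ true) × (∃ λ Y → ∣ Y ∣ ≤ N × ¬ (∃ λ Q → R P Q ≡ true × Disjoint Q Y))

poorRow? : ∀ {n} N (R : Rel n) P → Dec (PoorRow N R P)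
poorRow? N R P = anySubset? (λ Q → R P Q Bool.≟ true) ×-dec anySubset? (λ Y → (∣ Y ∣ ≤? N) ×-dec
  ¬? (anySubset? (λ Q → (R P Q Bool.≟ true) ×-dec disjoint? Q Y)))

rich : ∀ {n N} {R : Rel n} {P} → ¬ PoorRow N R P → ∀ {Q} → R P Q ≡ true → ∀ Y → ∣ Y ∣ ≤ N → ∃ λ Q' → R P Q' ≡ true × Disjoint Q' Y
rich {R = R} {P} ¬poor {Q} p Y le with anySubset? (λ Q → (R P Q Bool.≟ true) ×-dec disjoint? Q Y)
... | yes r = r
... | no ¬r = ⊥-elim (¬poor ((Q , p) , Y , le , ¬r))

redirect : ∀ {n} → Subset n → Subset n → (Subset n → Subset n) → Subset n → Subset n
redirect P Y 𝒞 P' with P' ≟ˢ P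
... | yes _ = Y
... | no _ = 𝒞 P'

∣redirect∣ : ∀ {n N} (P Y : Subset n) {𝒞} → ∣ Y ∣ ≤ N → (∀ P → ∣ 𝒞 P ∣ ≤ N) → ∀ P' → ∣ redirect P Y 𝒞 P' ∣ ≤ N
∣redirect∣ P Y le h P' with P' ≟ˢ P
... | yes _ = le
... | no _ = h P'

dropRow : ∀ {n} → Subset n → Rel n → Rel n
dropRow P₀ R P Q = R P Q ∧ not ⌊ P ≟ˢ P₀ ⌋

dropRow-⊆ : ∀ {n} {P₀ : Subset n} {R P Q} → dropRow P₀ R P Q ≡ true → R P Q ≡ true
dropRow-⊆ {R = R} {P} {Q} e with R P Q
... | true = refl

dropRow-≡ : ∀ {n} (P₀ : Subset n) R Q → dropRow P₀ R P₀ Q ≡ false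
dropRow-≡ P₀ R Q with P₀ ≟ˢ P₀ | R P₀ Q
... | yes _ | true = refl
... | yes _ | false = refl
... | no ne | _ = ⊥-elim (ne refl)

dropRow-≢ : ∀ {n} {P₀ : Subset n} {R P Q} → P ≢ P₀ → R P Q ≡ true → dropRow P₀ R P Q ≡ true
dropRow-≢ {P₀ = P₀} {R} {P} {Q} ne e with P ≟ˢ P₀
... | yes e = ⊥-elim (ne e)
... | no _ rewrite e = refl

transpose : ∀ {n} → Rel n → Rel n
transpose R P Q = R Q P

transpose-core : ∀ {n N} {R : Rel n} → Core N (transpose R) → Core N R
transpose-core c = record
  { core = transpose core ; core⊆ = core⊆ ; rich-row = rich-col ; rich-col = rich-row
  ; rowCover = colCover ; colCover = rowCover ; ∣rowCover∣ = ∣colCover∣ ; ∣colCover∣ = ∣rowCover∣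
  ; covered = λ p q → [ inj₂ , inj₁ ]′ (covered p q) }
  where open Core c

size-transpose : ∀ {n} (R : Rel n) → size (transpose R) ≡ size R
size-transpose {n} R = ∑-swap (allSubsets n) (allSubsets n) (λ P Q → ι (R Q P Bool.≟ true))

-- The core stays the same; only the cover of the dropped row is overwritten by its hitting set Y.
-- The old value of that cover may be forgotten, since the row was empty in the smaller relation.
restore-row : ∀ {n N} {R : Rel n} {P} → PoorRow N R P → Core N (dropRow P R) → Core N R
restore-row {N = N} {R} {P₀} (_ , Y , le , none) c = record
  { core = core ; core⊆ = λ p → dropRow-⊆ {P₀ = P₀} {R = R} (core⊆ p) ; rich-row = rich-row ; rich-col = rich-col
  ; rowCover = redirect P₀ Y rowCover ; colCover = colCover
  ; ∣rowCover∣ = ∣redirect∣ P₀ Y le ∣rowCover∣ ; ∣colCover∣ = ∣colCover∣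
  ; covered = cov }
  where
  open Core c
  cov : ∀ {P Q} → R P Q ≡ true → core P Q ≡ false → Meets Q (redirect P₀ Y rowCover P) ⊎ Meets P (colCover Q)
  cov {P} {Q} p q with P ≟ˢ P₀
  ... | no ne = covered (dropRow-≢ {R = R} ne p) q
  ... | yes refl with meets? Q Y
  ...   | yes m = inj₁ m
  ...   | no ¬m = ⊥-elim (none (Q , p , ¬meets⇒disjoint ¬m))

-- `k` is fuel: every row or column that is dropped contains a pair, so `size` goes down each time.
peel : ∀ {n} N k (R : Rel n) → size R ≤ k → Core N R
peel {n} N k R le with anySubset? (poorRow? N R) | anySubset? (poorRow? N (transpose R))
peel {n} N k R le | no ¬row | no ¬col = record
  { core = R ; core⊆ = id
  ; rich-row = rich {R = R} (λ p → ¬row (_ , p)) ; rich-col = rich {R = transpose R} (λ p → ¬col (_ , p))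
  ; rowCover = λ _ → ⊥ ; colCover = λ _ → ⊥
  ; ∣rowCover∣ = λ _ → ∣⊥∣≤ n ; ∣colCover∣ = λ _ → ∣⊥∣≤ n
  ; covered = λ p q → case trans (sym p) q of λ () }
peel N zero R le | yes (P , poor@((Q , p) , _)) | _ =
  ⊥-elim (n≮0 (≤-trans (size-strict {R = R} (dropRow-⊆ {P₀ = P} {R = R}) p (dropRow-≡ P R Q)) le))
peel N (suc k) R le | yes (P , poor@((Q , p) , _)) | _ =
  restore-row poor (peel N k (dropRow P R) (≤-pred (≤-trans (size-strict {R = R} (dropRow-⊆ {P₀ = P} {R = R}) p (dropRow-≡ P R Q)) le)))
peel N zero R le | no _ | yes (P , poor@((Q , p) , _)) =
  ⊥-elim (n≮0 (≤-trans (size-strict {R = transpose R} (dropRow-⊆ {P₀ = P} {R = transpose R}) p (dropRow-≡ P (transpose R) Q))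
    (≤-trans (≤-reflexive (size-transpose R)) le)))
peel N (suc k) R le | no _ | yes (P , poor@((Q , p) , _)) =
  transpose-core (restore-row poor (transpose-core (peel N k (transpose (dropRow P (transpose R)))
    (≤-trans (≤-reflexive (size-transpose (dropRow P (transpose R))))
      (≤-pred (≤-trans (size-strict {R = transpose R} (dropRow-⊆ {P₀ = P} {R = transpose R}) p (dropRow-≡ P (transpose R) Q))
        (≤-trans (≤-reflexive (size-transpose R)) le)))))))

opaque
  coreOf : ∀ {n} N (R : Rel n) → Core N R
  coreOf N R = peel N (size R) R ≤-refl

-- Embedding trees

_≟ⱽ_ : ∀ {s t} (y z : Vtx s t) → Dec (y ≡ z)
_≟ⱽ_ = Sum.≡-dec Fin._≟_ Fin._≟_

adj-sym : ∀ {s t} {E : BipGraph s t} {y z} → Adj E y z → Adj E z y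
adj-sym {y = inj₁ _} {inj₂ _} e = e
adj-sym {y = inj₂ _} {inj₁ _} e = e

adj-irrefl : ∀ {s t} {E : BipGraph s t} {y z} → Adj E y z → y ≢ z
adj-irrefl {y = inj₁ _} {inj₂ _} e ()
adj-irrefl {y = inj₂ _} {inj₁ _} e ()

module _ {s t} (E : BipGraph s t) where

  walk-snoc : ∀ xs {y z} → WalkAdj E (xs ++ [ y ]) → Adj E y z → WalkAdj E ((xs ++ [ y ]) ++ [ z ])
  walk-snoc [] w e = e , tt
  walk-snoc (x ∷ []) (a , _) e = a , e , tt
  walk-snoc (x ∷ x' ∷ xs) (a , w) e = a , walk-snoc (x' ∷ xs) w e

  record Path (S : List (Vtx s t)) (y z : Vtx s t) : Set where
    field
      ms : List (Vtx s t)
      inside : All (_∈ˡ S) (y ∷ ms ++ [ z ])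
      simple : Unique (y ∷ ms ++ [ z ])
      walk : WalkAdj E (y ∷ ms ++ [ z ])

  -- Connectivity of S in the form that closes cycles: a simple path inside S together with one
  -- vertex outside S already has the format of `IsCycle`.
  Joined : List (Vtx s t) → Set
  Joined S = ∀ {y z} → y ∈ˡ S → z ∈ˡ S → y ≢ z → Path S y z

  unique-snoc : ∀ {xs : List (Vtx s t)} {z} → Unique xs → z ∉ˡ xs → Unique (xs ++ [ z ])
  unique-snoc {z = z} u z∉ = Unique.++⁺ u ([] ∷ []) λ { (p , here refl) → z∉ p }

  fresh : ∀ {S xs : List (Vtx s t)} {z} → z ∉ˡ S → All (_∈ˡ S) xs → z ∉ˡ xs
  fresh z∉ all p = z∉ (All.lookup all p)

  edge-path : ∀ {S y z} → y ∈ˡ S → z ∈ˡ S → Adj E y z → Path S y z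
  edge-path y∈ z∈ e = record
    { ms = [] ; inside = y∈ ∷ z∈ ∷ [] ; simple = (adj-irrefl {E = E} e ∷ []) ∷ [] ∷ [] ; walk = e , tt }

  path-weaken : ∀ {S y z w} → Path S y z → Path (w ∷ S) y z
  path-weaken p = record { ms = ms ; inside = All.map there inside ; simple = simple ; walk = walk }
    where open Path p

  path-cons : ∀ {S y z w} → z ∉ˡ S → Adj E y z → Path S y w → Path (z ∷ S) z w
  path-cons {y = y} z∉ e p = record
    { ms = y ∷ ms ; inside = here refl ∷ All.map there inside
    ; simple = All.tabulate (λ q eq → fresh z∉ inside (subst (_∈ˡ _) (sym eq) q)) ∷ simple
    ; walk = adj-sym {E = E} e , walk }
    where open Path p

  path-snoc : ∀ {S y z w} → z ∉ˡ S → Adj E y z → Path S w y → Path (z ∷ S) w z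
  path-snoc {y = y} {w = w} z∉ e p = record
    { ms = ms ++ [ y ] ; inside = All.++⁺ (All.map there inside) (here refl ∷ [])
    ; simple = unique-snoc simple (fresh z∉ inside)
    ; walk = walk-snoc (w ∷ ms) walk e }
    where open Path p

  joined-attach : ∀ {S y z} → Joined S → z ∉ˡ S → y ∈ˡ S → Adj E y z → Joined (z ∷ S)
  joined-attach J z∉ y∈ e (here refl) (here refl) ne = ⊥-elim (ne refl)
  joined-attach J z∉ y∈ e (there p) (there q) ne = path-weaken (J p q ne)
  joined-attach {y = y} J z∉ y∈ e {_} {w} (here refl) (there q) ne with y ≟ⱽ w
  ... | yes refl = edge-path (here refl) (there q) (adj-sym {E = E} e)
  ... | no ne' = path-cons z∉ e (J y∈ q ne')
  joined-attach {y = y} J z∉ y∈ e {w} (there q) (here refl) ne with w ≟ⱽ y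
  ... | yes refl = edge-path (there q) (here refl) e
  ... | no ne' = path-snoc z∉ e (J q y∈ ne')

  path-cycle : ∀ {S y y' z} → z ∉ˡ S → Adj E y z → Adj E y' z → Path S y y' → ∃ (IsCycle E)
  path-cycle {y = y} {y'} {z} z∉ e e' p = z ∷ y ∷ ms ++ [ y' ] ,
      s≤s (≤-trans (s≤s z≤n) (≤-reflexive (sym (trans (length-++ ms) (+-comm (length ms) 1))))) ,
      All.tabulate (λ q eq → fresh z∉ inside (subst (_∈ˡ _) (sym eq) q)) ∷ simple ,
      adj-sym {E = E} e , walk-snoc (y ∷ ms) walk e'
    where open Path p

  -- Two neighbours in S would be joined by a path in S, which z closes to a cycle.
  unique-neighbour : Acyclic E → ∀ {S z} → Joined S → z ∉ˡ S → ∀ {y y'} → y ∈ˡ S → y' ∈ˡ S → Adj E y z → Adj E y' z → y ≡ y'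
  unique-neighbour acyclic J z∉ {y} {y'} y∈ y'∈ e e' with y ≟ⱽ y'
  ... | yes eq = eq
  ... | no ne = let (zs , cycle) = path-cycle z∉ e e' (J y∈ y'∈ ne) in ⊥-elim (acyclic zs cycle)

vertices : ∀ s t → List (Vtx s t)
vertices s t = map inj₁ (allFin s) ++ map inj₂ (allFin t)

∈-vertices : ∀ {s t} (z : Vtx s t) → z ∈ˡ vertices s t
∈-vertices (inj₁ i) = ∈-++⁺ˡ (∈-map⁺ inj₁ (∈-allFin i))
∈-vertices {s} (inj₂ j) = ∈-++⁺ʳ (map inj₁ (allFin s)) (∈-map⁺ inj₂ (∈-allFin j))

length-vertices : ∀ s t → length (vertices s t) ≡ s + t
length-vertices s t = trans (length-++ (map inj₁ (allFin s))) (cong₂ _+_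
  (trans (length-map inj₁ (allFin s)) (length-allFin s)) (trans (length-map inj₂ (allFin t)) (length-allFin t)))

∣⋃∣≤ : ∀ {n} {A : Set} (φ : A → Subset n) {K} → (∀ z → ∣ φ z ∣ ≤ K) → ∀ zs → ∣ ⋃ (map φ zs) ∣ ≤ length zs * K
∣⋃∣≤ {n} φ h [] = ≤-reflexive (∣⊥∣≡0 n)
∣⋃∣≤ φ h (z ∷ zs) = ≤-trans (∣∪∣≤ (φ z) _) (+-mono-≤ (h z) (∣⋃∣≤ φ h zs))

∈-⋃ : ∀ {n} {A : Set} (φ : A → Subset n) {zs z x} → z ∈ˡ zs → x ∈ φ z → x ∈ ⋃ (map φ zs)
∈-⋃ φ (here refl) p = ∈-∪ˡ p
∈-⋃ φ (there {x = y} q) p = ∈-∪ʳ (φ y) (∈-⋃ φ q p)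

-- T minus the leaf x is embedded greedily along the tree, starting from u ↦ P₀. By acyclicity a new vertex has only one
-- neighbour among the earlier ones, so only one relation has to be arranged for it.
module Greedy {s t} (E : BipGraph s t) (acyclic : Acyclic E) (connected : Connected E)
  (x : Fin t) (u : Fin s) (ux : E u x ≡ true) (leaf : ∀ u' → E u' x ≡ true → u' ≡ u)
  {n} (R : Subset n → Subset n → Set) (GP GQ : Subset n → Set) (K N : ℕ)
  (grow-row : ∀ {P} → GP P → ∀ Y → ∣ Y ∣ ≤ N → ∃ λ Q → R P Q × GQ Q × ∣ Q ∣ ≤ K × Disjoint Q Y)
  (grow-col : ∀ {Q} → GQ Q → ∀ Y → ∣ Y ∣ ≤ N → ∃ λ P → R P Q × GP P × ∣ P ∣ ≤ K × Disjoint P Y)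
  (Y : Subset n) (room : ∣ Y ∣ + (s + t) * K ≤ N)
  (P₀ : Subset n) (GP₀ : GP P₀) (∣P₀∣ : ∣ P₀ ∣ ≤ K) (P₀-Y : Disjoint P₀ Y) where

  -- Vertices not yet visited carry the empty set, so that size and disjointness can be stated for
  -- all vertices. The leaf x belongs to S from the start and is therefore never given a set; the
  -- conditions on columns exempt it.
  record Partial : Set where
    field
      S : List (Vtx s t)
      φ : Vtx s t → Subset n
      x∈ : inj₂ x ∈ˡ S
      u∈ : inj₁ u ∈ˡ S
      joined : Joined E S
      φ-u : φ (inj₁ u) ≡ P₀
      ∣φ∣ : ∀ z → ∣ φ z ∣ ≤ K
      φ-Y : ∀ z → Disjoint (φ z) Y
      φ-disjoint : ∀ {y z} → y ≢ z → Disjoint (φ y) (φ z)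
      good-row : ∀ {i} → inj₁ i ∈ˡ S → GP (φ (inj₁ i))
      good-col : ∀ {j} → inj₂ j ∈ˡ S → j ≢ x → GQ (φ (inj₂ j))
      related : ∀ {i j} → inj₁ i ∈ˡ S → inj₂ j ∈ˡ S → j ≢ x → E i j ≡ true → R (φ (inj₁ i)) (φ (inj₂ j))

  set : (Vtx s t → Subset n) → Vtx s t → Subset n → Vtx s t → Subset n
  set φ z Q w with w ≟ⱽ z
  ... | yes _ = Q
  ... | no _ = φ w

  set-≡ : ∀ φ z Q → set φ z Q z ≡ Q
  set-≡ φ z Q with z ≟ⱽ z
  ... | yes _ = refl
  ... | no ne = ⊥-elim (ne refl)

  set-≢ : ∀ φ z Q {w} → w ≢ z → set φ z Q w ≡ φ w
  set-≢ φ z Q {w} ne with w ≟ⱽ z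
  ... | yes e = ⊥-elim (ne e)
  ... | no _ = refl

  initial : Partial
  initial = record
    { S = inj₂ x ∷ inj₁ u ∷ [] ; φ = φ₀ ; x∈ = here refl ; u∈ = there (here refl) ; joined = J ; φ-u = set-≡ _ (inj₁ u) P₀
    ; ∣φ∣ = size₀ ; φ-Y = Y₀ ; φ-disjoint = dis
    ; good-row = λ { (there (here refl)) → subst GP (sym (set-≡ _ (inj₁ u) P₀)) GP₀ }
    ; good-col = λ { (here refl) ne → ⊥-elim (ne refl) ; (there (here ())) ; (there (there ())) }
    ; related = λ { _ (here refl) ne → ⊥-elim (ne refl) ; _ (there (here ())) ; _ (there (there ())) } }
    where
    φ₀ = set (λ _ → ⊥) (inj₁ u) P₀
    J : Joined E (inj₂ x ∷ inj₁ u ∷ [])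
    J (here refl) (here refl) ne = ⊥-elim (ne refl)
    J (here refl) (there (here refl)) ne = edge-path E (here refl) (there (here refl)) ux
    J (there (here refl)) (here refl) ne = edge-path E (there (here refl)) (here refl) ux
    J (there (here refl)) (there (here refl)) ne = ⊥-elim (ne refl)
    size₀ : ∀ z → ∣ φ₀ z ∣ ≤ K
    size₀ z with z ≟ⱽ inj₁ u
    ... | yes _ = ∣P₀∣
    ... | no _ = ∣⊥∣≤ n
    Y₀ : ∀ z → Disjoint (φ₀ z) Y
    Y₀ z with z ≟ⱽ inj₁ u
    ... | yes _ = P₀-Y
    ... | no _ = λ p → ⊥-elim (∉⊥ p)
    dis : ∀ {y z} → y ≢ z → Disjoint (φ₀ y) (φ₀ z)
    dis {y} {z} ne with y ≟ⱽ inj₁ u | z ≟ⱽ inj₁ u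
    ... | no _ | _ = λ p → ⊥-elim (∉⊥ p)
    ... | yes _ | no _ = λ _ → ∉⊥
    ... | yes e | yes e' = ⊥-elim (ne (trans e (sym e')))

  module Extend (st : Partial) where
    open Partial st

    used : Subset n
    used = Y ∪ ⋃ (map φ (vertices s t))

    ∣used∣ : ∣ used ∣ ≤ N
    ∣used∣ = ≤-trans (∣∪∣≤ Y _) (≤-trans (+-monoʳ-≤ ∣ Y ∣ (≤-trans (∣⋃∣≤ φ ∣φ∣ (vertices s t))
      (≤-reflexive (cong (_* K) (length-vertices s t))))) room)

    attach : ∀ {y z} → z ∉ˡ S → y ∈ˡ S → Adj E y z → ∀ Q → ∣ Q ∣ ≤ K → Disjoint Q used →
      (∀ {i} → z ≡ inj₁ i → GP Q) → (∀ {j} → z ≡ inj₂ j → GQ Q) →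
      (∀ {i j} → z ≡ inj₁ i → y ≡ inj₂ j → R Q (φ (inj₂ j))) →
      (∀ {i j} → y ≡ inj₁ i → z ≡ inj₂ j → R (φ (inj₁ i)) Q) →
      Σ Partial λ st' → (∀ {w} → w ∈ˡ S → w ∈ˡ Partial.S st') × z ∈ˡ Partial.S st'
    attach {y} {z} z∉ y∈ e Q ∣Q∣ Q-used gp gq rp rq = record
      { S = z ∷ S ; φ = φ' ; x∈ = there x∈ ; u∈ = there u∈ ; joined = joined-attach E joined z∉ y∈ e
      ; φ-u = trans (old u∈) φ-u
      ; ∣φ∣ = size' ; φ-Y = Y' ; φ-disjoint = dis
      ; good-row = λ { (here refl) → subst GP (sym new) (gp refl) ; (there p) → subst GP (sym (old p)) (good-row p) }
      ; good-col = λ { (here refl) ne → subst GQ (sym new) (gq refl) ; (there p) ne → subst GQ (sym (old p)) (good-col p ne) }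
      ; related = rel } , there , here refl
      where
      φ' = set φ z Q
      new : φ' z ≡ Q
      new = set-≡ φ z Q
      old : ∀ {w} → w ∈ˡ S → φ' w ≡ φ w
      old {w} w∈ = set-≢ φ z Q {w} (λ eq → z∉ (subst (_∈ˡ S) eq w∈))
      size' : ∀ w → ∣ φ' w ∣ ≤ K
      size' w with w ≟ⱽ z
      ... | yes _ = ∣Q∣
      ... | no _ = ∣φ∣ w
      Y' : ∀ w → Disjoint (φ' w) Y
      Y' w with w ≟ⱽ z
      ... | yes _ = λ p q → Q-used p (∈-∪ˡ q)
      ... | no _ = φ-Y w
      Q-φ : ∀ w → Disjoint Q (φ w)
      Q-φ w p q = Q-used p (∈-∪ʳ Y (∈-⋃ φ (∈-vertices w) q))
      dis : ∀ {w w'} → w ≢ w' → Disjoint (φ' w) (φ' w')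
      dis {w} {w'} ne with w ≟ⱽ z | w' ≟ⱽ z
      ... | yes e | yes e' = ⊥-elim (ne (trans e (sym e')))
      ... | yes _ | no _ = Q-φ w'
      ... | no _ | yes _ = disjoint-sym (Q-φ w)
      ... | no _ | no _ = φ-disjoint ne
      -- This is the use of acyclicity: y is the only placed neighbour of z, so its relation to z is
      -- the only new one to check.
      only : ∀ {w} → w ∈ˡ S → Adj E w z → w ≡ y
      only w∈ e' = unique-neighbour E acyclic joined z∉ w∈ y∈ e' e
      rel : ∀ {i j} → inj₁ i ∈ˡ (z ∷ S) → inj₂ j ∈ˡ (z ∷ S) → j ≢ x → E i j ≡ true → R (φ' (inj₁ i)) (φ' (inj₂ j))
      rel (here refl) (here ()) ne ij
      rel {i} {j} (here refl) (there q) ne ij = subst (R _) (sym (old q)) (subst (λ P → R P _) (sym new)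
        (rp refl (sym (only q ij))))
      rel {i} {j} (there p) (here refl) ne ij = subst (R _) (sym new) (subst (λ P → R P _) (sym (old p))
        (rq (sym (only p ij)) refl))
      rel (there p) (there q) ne ij = subst (R _) (sym (old q)) (subst (λ P → R P _) (sym (old p)) (related p q ne ij))

    include : ∀ {y z} → y ∈ˡ S → Adj E y z → Σ Partial λ st' → (∀ {w} → w ∈ˡ S → w ∈ˡ Partial.S st') × z ∈ˡ Partial.S st'
    include {y} {z} y∈ e with DecMembership._∈?_ _≟ⱽ_ z S
    ... | yes z∈ = st , id , z∈
    include {inj₁ i} {inj₂ j} y∈ e | no z∉ with grow-row (good-row y∈) used ∣used∣
    ... | Q , rQ , gQ , ∣Q∣ , dQ = attach z∉ y∈ e Q ∣Q∣ dQ (λ ()) (λ _ → gQ) (λ ()) (λ { refl refl → rQ })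
    include {inj₂ j} {inj₁ i} y∈ e | no z∉ with j Fin.≟ x
    -- The only neighbour of x is u, which has been in S from the start.
    ... | yes refl = ⊥-elim (z∉ (subst (λ i → inj₁ i ∈ˡ S) (sym (leaf i e)) u∈))
    ... | no ne with grow-col (good-col y∈ ne) used ∣used∣
    ...   | P , rP , gP , ∣P∣ , dP = attach z∉ y∈ e P ∣P∣ dP (λ _ → gP) (λ ()) (λ { refl refl → rP }) (λ ())

  reach : ∀ {z} → Reach E (inj₁ u) z → (st : Partial) → Σ Partial λ st' → (∀ {w} → w ∈ˡ Partial.S st → w ∈ˡ Partial.S st') × z ∈ˡ Partial.S st'
  reach here st = st , id , Partial.u∈ st
  reach (step r e) st with reach r st
  ... | st₁ , sub₁ , y∈ with Extend.include st₁ y∈ e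
  ...   | st₂ , sub₂ , z∈ = st₂ , sub₂ ∘ sub₁ , z∈

  complete : ∀ zs → Σ Partial λ st → ∀ {z} → z ∈ˡ zs → z ∈ˡ Partial.S st
  complete [] = initial , λ ()
  complete (z ∷ zs) with complete zs
  ... | st , all with reach (connected (inj₁ u) z) st
  ...   | st' , sub , z∈ = st' , λ { (here refl) → z∈ ; (there p) → sub (all p) }

  embedding : Σ (Vtx s t → Subset n) λ φ → φ (inj₁ u) ≡ P₀ × (∀ z → Disjoint (φ z) Y) ×
    (∀ {y z} → y ≢ z → Disjoint (φ y) (φ z)) ×
    (∀ {i j} → j ≢ x → E i j ≡ true → R (φ (inj₁ i)) (φ (inj₂ j)))
  embedding with complete (vertices s t)
  ... | st , all = φ , φ-u , φ-Y , φ-disjoint , λ {i} {j} → related (all (∈-vertices (inj₁ i))) (all (∈-vertices (inj₂ j)))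
    where open Partial st

-- From disjoint sets to copies of the blowup

⋃-++ : ∀ {n} (ps qs : List (Subset n)) → ⋃ (ps ++ qs) ≡ ⋃ ps ∪ ⋃ qs
⋃-++ [] qs = sym (∪-identityˡ _)
⋃-++ (p ∷ ps) qs = trans (cong (p ∪_) (⋃-++ ps qs)) (sym (∪-assoc p (⋃ ps) (⋃ qs)))

⋃-entries : ∀ {n m} (v : Vec (Fin n) m) → ⋃ (map (λ k → ⁅ lookup v k ⁆) (allFin m)) ≡ img v
⋃-entries [] = refl
⋃-entries {m = suc m} (y ∷ v) = cong (⁅ y ⁆ ∪_) (trans (cong ⋃ (trans (map-tabulate {n = m} suc _) (sym (map-tabulate {n = m} id _)))) (⋃-entries v))

enumerate-as : ∀ {n k} (S : Subset n) → ∣ S ∣ ≡ k → ∃ λ (v : Vec (Fin n) k) → img v ≡ S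
enumerate-as S refl = enumerate S

-- Arbitrary enumerations of the sets serve as the embedding, since an edge only sees the union of
-- two of them.
blowup-copy : ∀ {n r s t} (E : BipGraph s t) {a b} (H : RGraph n r) (A : Fin s → Subset n) (B : Fin t → Subset n) →
  (∀ i → ∣ A i ∣ ≡ a) → (∀ j → ∣ B j ∣ ≡ b) →
  (∀ {i i'} → i ≢ i' → Disjoint (A i) (A i')) → (∀ {j j'} → j ≢ j' → Disjoint (B j) (B j')) → (∀ i j → Disjoint (A i) (B j)) →
  (∀ i j → E i j ≡ true → edge H (A i ∪ B j) ≡ true) → ContainsBlowup E a b H
blowup-copy {n} {s = s} {t} E {a} {b} H A B ∣A∣ ∣B∣ AA BB AB AB∈H = φ , injective , λ i j ij → trans (cong (edge H) (image i j)) (AB∈H i j ij)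
  where
  α : ∀ i → ∃ λ (v : Vec (Fin n) a) → img v ≡ A i
  α i = enumerate-as (A i) (∣A∣ i)
  β : ∀ j → ∃ λ (v : Vec (Fin n) b) → img v ≡ B j
  β j = enumerate-as (B j) (∣B∣ j)
  φ : BVtx s t a b → Fin n
  φ (inj₁ (i , k)) = lookup (proj₁ (α i)) k
  φ (inj₂ (j , k)) = lookup (proj₁ (β j)) k
  image : ∀ i j → imgEdge {a = a} {b = b} φ i j ≡ A i ∪ B j
  image i j = trans (⋃-++ (map (λ k → ⁅ φ (inj₁ (i , k)) ⁆) (allFin a)) _) (cong₂ _∪_
    (trans (⋃-entries (proj₁ (α i))) (proj₂ (α i))) (trans (⋃-entries (proj₁ (β j))) (proj₂ (β j))))
  ∈A : ∀ i k → φ (inj₁ (i , k)) ∈ A i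
  ∈A i k = subst (φ (inj₁ (i , k)) ∈_) (proj₂ (α i)) (∈-img⁺ (proj₁ (α i)) k)
  ∈B : ∀ j k → φ (inj₂ (j , k)) ∈ B j
  ∈B j k = subst (φ (inj₂ (j , k)) ∈_) (proj₂ (β j)) (∈-img⁺ (proj₁ (β j)) k)
  injective : Injective _≡_ _≡_ φ
  injective {inj₁ (i , k)} {inj₁ (i' , k')} e with i Fin.≟ i'
  ... | yes refl = cong (λ k → inj₁ (i , k)) (distinct⇒injective (proj₁ (α i)) (trans (cong ∣_∣ (proj₂ (α i))) (∣A∣ i)) e)
  ... | no ne = ⊥-elim (AA ne (∈A i k) (subst (_∈ A i') (sym e) (∈A i' k')))
  injective {inj₁ (i , k)} {inj₂ (j , k')} e = ⊥-elim (AB i j (∈A i k) (subst (_∈ B j) (sym e) (∈B j k')))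
  injective {inj₂ (j , k)} {inj₁ (i , k')} e = ⊥-elim (AB i j (∈A i k') (subst (_∈ B j) e (∈B j k)))
  injective {inj₂ (j , k)} {inj₂ (j' , k')} e with j Fin.≟ j'
  ... | yes refl = cong (λ k → inj₂ (j , k)) (distinct⇒injective (proj₁ (β j)) (trans (cong ∣_∣ (proj₂ (β j))) (∣B∣ j)) e)
  ... | no ne = ⊥-elim (BB ne (∈B j k) (subst (_∈ B j') (sym e) (∈B j' k')))

⌊⌋⁻ : {P : Set} (d : Dec P) → ⌊ d ⌋ ≡ true → P
⌊⌋⁻ (yes p) _ = p

⌊⌋⁺ : {P : Set} (d : Dec P) → P → ⌊ d ⌋ ≡ true
⌊⌋⁺ (yes _) _ = refl
⌊⌋⁺ (no ¬p) p = ⊥-elim (¬p p)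

-- Centres of edges

comprehension : ∀ {n} {P : Fin n → Set} → (∀ i → Dec (P i)) → Subset n
comprehension P? = Vec.tabulate (λ i → ⌊ P? i ⌋)

∈-comprehension⁺ : ∀ {n} {P : Fin n → Set} (P? : ∀ i → Dec (P i)) {i} → P i → i ∈ comprehension P?
∈-comprehension⁺ P? {i} p = lookup⇒[]= i _ (trans (lookup∘tabulate _ i) (⌊⌋⁺ (P? i) p))

∈-comprehension⁻ : ∀ {n} {P : Fin n → Set} (P? : ∀ i → Dec (P i)) {i} → i ∈ comprehension P? → P i
∈-comprehension⁻ P? {i} p = ⌊⌋⁻ (P? i) (trans (sym (lookup∘tabulate _ i)) ([]=⇒lookup p))

another : ∀ {n} (I : Subset n) → 2 ≤ ∣ I ∣ → ∀ d → ∃ λ d' → d' ∈ I × d' ≢ d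
another I 2≤ d with d ∈? I
... | no d∉ = let (d' , p) = nonempty-size I (≤-trans (s≤s z≤n) 2≤) in d' , p , λ e → d∉ (subst (_∈ I) e p)
... | yes d∈ = let (d' , p) = nonempty-size (I - d) (≤-pred (≤-trans 2≤ (≤-reflexive (sym (∣-∣ d∈))))) ; (p₁ , p₂) = ∈-─⁻ I ⁅ d ⁆ p
               in d' , p₁ , λ e → p₂ (subst (_∈ ⁅ d ⁆) (sym e) (x∈⁅x⁆ d))

-- If all arrows P → c with c ∈ 𝒞 P ∖ P agree on c unless they exclude each other, then
-- they have a common head: otherwise a suitable a-set P and its complement have no arrow at all.
module Centre {n} (𝒞 : Subset n → Subset n) (F : Subset n) (a b : ℕ) (3≤a : 3 ≤ a) (2≤b : 2 ≤ b) (∣F∣ : ∣ F ∣ ≡ a + b) where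

  Arrow : Subset n → Fin n → Set
  Arrow P c = P ⊆ F × c ∈ F × c ∉ P × c ∈ 𝒞 P

  arrow-dec : ∀ P c → Dec (Arrow P c)
  arrow-dec P c = (P ⊆? F) ×-dec (c ∈? F) ×-dec ¬? (c ∈? P) ×-dec (c ∈? 𝒞 P)

  heads : Subset n
  heads = comprehension (λ c → anySubset? (λ P → arrow-dec P c))

  module _ (arrows : ∀ {P} → P ⊆ F → ∣ P ∣ ≡ a → (∃ λ c → Arrow P c) ⊎ (∃ λ c → c ∈ P × Arrow (F ─ P) c))
           (exclusive : ∀ {P c P' c'} → Arrow P c → Arrow P' c' → c ≢ c' → c ∈ P') where

    head∈ : ∀ {P c} → Arrow P c → c ∈ heads
    head∈ α = ∈-comprehension⁺ _ (_ , α)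

    head⊆F : heads ⊆ F
    head⊆F p = let (_ , α) = ∈-comprehension⁻ (λ c → anySubset? (λ P → arrow-dec P c)) p in proj₁ (proj₂ α)

    head-exclusive : ∀ {c P' c'} → c ∈ heads → Arrow P' c' → c ≢ c' → c ∈ P'
    head-exclusive p β ne = let (_ , α) = ∈-comprehension⁻ (λ c → anySubset? (λ P → arrow-dec P c)) p in exclusive α β ne

    a≤∣F∣ : a ≤ ∣ F ∣
    a≤∣F∣ = ≤-trans (m≤m+n a b) (≤-reflexive (sym ∣F∣))

    -- An a-set P is chosen that admits no arrow in either direction. By exclusivity an arrow from P
    -- to d forces every other head into P, and an arrow from F ─ P forces every other head into F ─
    -- P. If there are at most a heads, P contains them all: an arrow from P would end inside P, and
    -- for an arrow from F ─ P one of c, c' differs from its head and lies in P all the same.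
    no-two-heads : ∀ {c c'} → c ∈ heads → c' ∈ heads → c ≢ c' → Data.Empty.⊥
    no-two-heads {c} {c'} c∈ c'∈ c≢c' with ∣ heads ∣ ≤? a
    ... | yes few with interpolate heads F a head⊆F few a≤∣F∣
    ...   | P , A⊆P , P⊆F , ∣P∣ with arrows P⊆F ∣P∣
    ...     | inj₁ (d , α@(_ , _ , d∉P , _)) = d∉P (A⊆P (head∈ α))
    ...     | inj₂ (d , d∈P , β) with c Fin.≟ d
    ...       | no ne = proj₂ (∈-─⁻ F P (head-exclusive c∈ β ne)) (A⊆P c∈)
    ...       | yes refl = proj₂ (∈-─⁻ F P (head-exclusive c'∈ β (c≢c' ∘ sym))) (A⊆P c'∈)
    -- With more than a ≥ 3 heads there are disjoint pairs I and J of heads, and P is taken to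
    -- contain I and to avoid J. Whatever the head of an arrow is, each pair has a vertex different
    -- from it, and that of J, or of I for an arrow from F ─ P, is on the wrong side. Here b ≥ 2
    -- leaves room for J outside P.
    no-two-heads {c} {c'} c∈ c'∈ c≢c' | no many = contra (arrows P⊆F ∣P∣)
      where
      4≤ : 4 ≤ ∣ heads ∣
      4≤ = ≤-trans (s≤s 3≤a) (≰⇒> many)
      first = interpolate ⊥ heads 2 ⊥⊆ (∣⊥∣≤ n) (≤-trans (s≤s (s≤s z≤n)) 4≤)
      I = proj₁ first
      I⊆ : I ⊆ heads
      I⊆ = proj₁ (proj₂ (proj₂ first))
      ∣I∣ : ∣ I ∣ ≡ 2
      ∣I∣ = proj₂ (proj₂ (proj₂ first))
      rest : 2 ≤ ∣ heads ─ I ∣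
      rest = +-cancelˡ-≤ 2 _ _ (≤-trans 4≤ (≤-reflexive (trans (sym (∣─∣ I⊆)) (cong (_+ ∣ heads ─ I ∣) ∣I∣))))
      second = interpolate ⊥ (heads ─ I) 2 ⊥⊆ (∣⊥∣≤ n) rest
      J = proj₁ second
      J⊆ : J ⊆ heads ─ I
      J⊆ = proj₁ (proj₂ (proj₂ second))
      ∣J∣ : ∣ J ∣ ≡ 2
      ∣J∣ = proj₂ (proj₂ (proj₂ second))
      J⊆heads : J ⊆ heads
      J⊆heads p = proj₁ (∈-─⁻ heads I (J⊆ p))
      J⊆F : J ⊆ F
      J⊆F p = head⊆F (J⊆heads p)
      big : a ≤ ∣ F ─ J ∣
      big = +-cancelˡ-≤ 2 _ _ (≤-trans (≤-trans (≤-reflexive (+-comm 2 a)) (+-monoʳ-≤ a 2≤b))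
        (≤-reflexive (trans (sym ∣F∣) (trans (sym (∣─∣ J⊆F)) (cong (_+ ∣ F ─ J ∣) ∣J∣)))))
      third = interpolate I (F ─ J) a (λ p → x∈p∧x∉q⇒x∈p─q (head⊆F (I⊆ p)) (λ q → proj₂ (∈-─⁻ heads I (J⊆ q)) p))
        (≤-trans (≤-reflexive ∣I∣) (≤-trans (n≤1+n 2) 3≤a)) big
      P = proj₁ third
      I⊆P : I ⊆ P
      I⊆P = proj₁ (proj₂ third)
      P⊆F : P ⊆ F
      P⊆F p = proj₁ (∈-─⁻ F J (proj₁ (proj₂ (proj₂ third)) p))
      P-J : ∀ {d} → d ∈ P → d ∉ J
      P-J p = proj₂ (∈-─⁻ F J (proj₁ (proj₂ (proj₂ third)) p))
      ∣P∣ : ∣ P ∣ ≡ a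
      ∣P∣ = proj₂ (proj₂ (proj₂ third))
      contra : (∃ λ c → Arrow P c) ⊎ (∃ λ c → c ∈ P × Arrow (F ─ P) c) → Data.Empty.⊥
      contra (inj₁ (d , α)) = let (d' , d'∈ , ne) = another J (≤-reflexive (sym ∣J∣)) d in
        P-J (head-exclusive (J⊆heads d'∈) α ne) d'∈
      contra (inj₂ (d , d∈ , β)) = let (d' , d'∈ , ne) = another I (≤-reflexive (sym ∣I∣)) d in
        proj₂ (∈-─⁻ F P (head-exclusive (I⊆ d'∈) β ne)) (I⊆P d'∈)

    head-exists : ∃ λ c → c ∈ heads
    head-exists with interpolate ⊥ F a ⊥⊆ (∣⊥∣≤ n) a≤∣F∣
    ... | P , _ , P⊆F , ∣P∣ with arrows P⊆F ∣P∣
    ...   | inj₁ (c , α) = c , head∈ α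
    ...   | inj₂ (c , _ , α) = c , head∈ α

    -- All arrows end in the only head c. If c is not in P, an arrow from F ─ P would have to end
    -- inside P, so there must be an arrow from P to c.
    centre : ∃ λ c → c ∈ F × (∀ P → P ⊆ F → ∣ P ∣ ≡ a → c ∉ P → c ∈ 𝒞 P)
    centre = c , head⊆F c∈ , λ P P⊆F ∣P∣ c∉P → case c ∈? 𝒞 P of λ where
        (yes p) → p
        (no ¬p) → ⊥-elim (case arrows P⊆F ∣P∣ of λ where
          (inj₁ (c' , α@(_ , _ , _ , c'∈C))) → no-two-heads c∈ (head∈ α) (λ e → ¬p (subst (_∈ 𝒞 P) (sym e) c'∈C))
          (inj₂ (c' , c'∈P , α)) → no-two-heads c∈ (head∈ α) (λ e → c∉P (subst (_∈ P) (sym e) c'∈P)))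
      where
      c = proj₁ head-exists
      c∈ : c ∈ heads
      c∈ = proj₂ head-exists

∑-≥1 : ∀ {A : Set} {xs : List A} (f : A → ℕ) {x} → x ∈ˡ xs → 1 ≤ f x → 1 ≤ ∑ xs f
∑-≥1 f x∈ le = ≤-trans le (∑-∈ f x∈)

∉-removeAt : ∀ {m} (S : Subset (suc m)) c {j} → punchIn c j ∉ S → j ∉ removeAt S c
∉-removeAt S c {j} ∉S p = ∉S (lookup⇒[]= _ S (trans (sym (trans (sym (insertAt-punchIn (removeAt S c) c (lookup S c) j))
  (cong (λ S' → lookup S' (punchIn c j)) (insertAt-removeAt S c)))) ([]=⇒lookup p)))

opaque
  -- The factors count the choices of S₁, S₂, c₁ and c₂; M * M bounds those of the two heads.
  exceptional-bound : ℕ → ℕ → ℕ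
  exceptional-bound k M = 2 ^ (2 + k) * (2 ^ (2 + k) * ((2 + k) * ((1 + k) * (M * M))))

-- An arrow is a position c with v c ∈ 𝒞 (v restricted to S), c ∉ S, and costs one degree of freedom. An exceptional tuple
-- has two arrows that cost two: the second one does not involve the first position.
module _ {n k M : ℕ} (𝒞 : Subset n → Subset n) (∣𝒞∣ : ∀ P → ∣ 𝒞 P ∣ ≤ M) where

  -- The condition c₁ ∉ S₂ makes the second arrow survive the deletion of position c₁. The index c₂
  -- numbers the positions that remain, hence `punchIn`.
  Avoiding : Subset (2 + k) → Subset (2 + k) → Fin (2 + k) → Fin (1 + k) → Set
  Avoiding S₁ S₂ c₁ c₂ = c₁ ∉ S₁ × c₁ ∉ S₂ × punchIn c₁ c₂ ∉ S₂

  avoiding? : ∀ S₁ S₂ c₁ c₂ → Dec (Avoiding S₁ S₂ c₁ c₂)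
  avoiding? S₁ S₂ c₁ c₂ = ¬? (c₁ ∈? S₁) ×-dec ¬? (c₁ ∈? S₂) ×-dec ¬? (punchIn c₁ c₂ ∈? S₂)

  ExceptionalAt : Vec (Fin n) (2 + k) → Subset (2 + k) → Subset (2 + k) → Fin (2 + k) → Fin (1 + k) → Set
  ExceptionalAt v S₁ S₂ c₁ c₂ = Avoiding S₁ S₂ c₁ c₂ × lookup v c₁ ∈ 𝒞 (imgOn S₁ v) × lookup v (punchIn c₁ c₂) ∈ 𝒞 (imgOn S₂ v)

  exceptionalAt? : ∀ v S₁ S₂ c₁ c₂ → Dec (ExceptionalAt v S₁ S₂ c₁ c₂)
  exceptionalAt? v S₁ S₂ c₁ c₂ = avoiding? S₁ S₂ c₁ c₂ ×-dec (lookup v c₁ ∈? 𝒞 (imgOn S₁ v)) ×-dec (lookup v (punchIn c₁ c₂) ∈? 𝒞 (imgOn S₂ v))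

  Exceptional : Vec (Fin n) (2 + k) → Set
  Exceptional v = ∃ λ S₁ → ∃ λ S₂ → ∃ λ c₁ → ∃ λ c₂ → ExceptionalAt v S₁ S₂ c₁ c₂

  exceptional? : ∀ v → Dec (Exceptional v)
  exceptional? v = anySubset? λ S₁ → anySubset? λ S₂ → Fin.any? λ c₁ → Fin.any? λ c₂ → exceptionalAt? v S₁ S₂ c₁ c₂

  count-exceptionalAt : ∀ S₁ S₂ c₁ c₂ → (∑[ v ∈ tuples n (2 + k) ] ι (exceptionalAt? v S₁ S₂ c₁ c₂)) ≤ M * (M * n ^ k)
  count-exceptionalAt S₁ S₂ c₁ c₂ = case avoiding? S₁ S₂ c₁ c₂ of λ where
      (no ¬av) → ≤-trans (≤-reflexive (∑-zero (λ v → ι-no (exceptionalAt? v S₁ S₂ c₁ c₂) (λ p → ¬av (proj₁ p))))) z≤n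
      (yes (c₁∉S₁ , c₁∉S₂ , c₂∉S₂)) → ≤-trans
        (∑-mono (tuples n (2 + k)) (λ v → ι-× (exceptionalAt? v S₁ S₂ c₁ c₂) (lookup v c₁ ∈? 𝒞 (imgOn S₁ v)) (lookup v (punchIn c₁ c₂) ∈? 𝒞 (imgOn S₂ v)) proj₂))
        (≤-trans (count-determined 𝒞 ∣𝒞∣ S₁ c₁ c₁∉S₁ _ (λ D → ι (lookup D c₂ ∈? 𝒞 (imgOn (removeAt S₂ c₁) D))) (transfer c₁∉S₂))
          (*-monoʳ-≤ M (count-determined₁ 𝒞 ∣𝒞∣ (removeAt S₂ c₁) c₂ (∉-removeAt S₂ c₁ c₂∉S₂))))
    where
    transfer : c₁ ∉ S₂ → ∀ D y → ι (lookup (insertAt D c₁ y) (punchIn c₁ c₂) ∈? 𝒞 (imgOn S₂ (insertAt D c₁ y))) ≤ ι (lookup D c₂ ∈? 𝒞 (imgOn (removeAt S₂ c₁) D))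
    transfer c₁∉S₂ D y = ι-mono (lookup (insertAt D c₁ y) (punchIn c₁ c₂) ∈? 𝒞 (imgOn S₂ (insertAt D c₁ y))) (lookup D c₂ ∈? 𝒞 (imgOn (removeAt S₂ c₁) D))
      (λ p → subst (_∈ 𝒞 (imgOn (removeAt S₂ c₁) D)) (insertAt-punchIn D c₁ y c₂)
        (subst (λ P → lookup (insertAt D c₁ y) (punchIn c₁ c₂) ∈ 𝒞 P) (imgOn-insertAt S₂ c₁ D y c₁∉S₂) p))

  opaque
    unfolding exceptional-bound
    count-exceptional : (∑[ v ∈ tuples n (2 + k) ] ι (exceptional? v)) ≤ exceptional-bound k M * n ^ k
    count-exceptional = begin
      (∑[ v ∈ Ts ] ι (exceptional? v))
        ≤⟨ ∑-mono Ts (λ v → ι-≤ (exceptional? v) (λ (S₁ , S₂ , c₁ , c₂ , p) →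
             ∑-≥1 _ (∈-allSubsets S₁) (∑-≥1 _ (∈-allSubsets S₂) (∑-≥1 _ (∈-allFin c₁) (∑-≥1 _ (∈-allFin c₂)
               (ι-≥1 (exceptionalAt? v S₁ S₂ c₁ c₂) p)))))) ⟩
      (∑[ v ∈ Ts ] ∑[ S₁ ∈ Ss ] ∑[ S₂ ∈ Ss ] ∑[ c₁ ∈ allFin (2 + k) ] ∑[ c₂ ∈ allFin (1 + k) ] ι (exceptionalAt? v S₁ S₂ c₁ c₂))
        ≡⟨ ∑-swap Ts Ss _ ⟩
      (∑[ S₁ ∈ Ss ] ∑[ v ∈ Ts ] ∑[ S₂ ∈ Ss ] ∑[ c₁ ∈ allFin (2 + k) ] ∑[ c₂ ∈ allFin (1 + k) ] ι (exceptionalAt? v S₁ S₂ c₁ c₂))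
        ≤⟨ ∑-≤const Ss (λ S₁ → ≤-trans (≤-reflexive (∑-swap Ts Ss _))
             (∑-≤const Ss (λ S₂ → ≤-trans (≤-reflexive (∑-swap Ts (allFin (2 + k)) _))
             (∑-≤const (allFin (2 + k)) (λ c₁ → ≤-trans (≤-reflexive (∑-swap Ts (allFin (1 + k)) _))
             (∑-≤const (allFin (1 + k)) (λ c₂ → count-exceptionalAt S₁ S₂ c₁ c₂))))))) ⟩
      length Ss * (length Ss * (length (allFin (2 + k)) * (length (allFin (1 + k)) * (M * (M * n ^ k)))))
        ≡⟨ cong₂ (λ p q → p * (p * q)) (length-allSubsets (2 + k)) (cong₂ (λ p q → p * (q * (M * (M * n ^ k)))) (length-allFin (2 + k)) (length-allFin (1 + k))) ⟩
      2 ^ (2 + k) * (2 ^ (2 + k) * ((2 + k) * ((1 + k) * (M * (M * n ^ k)))))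
        ≡⟨ regroup (2 ^ (2 + k)) (2 + k) (1 + k) M (n ^ k) ⟩
      exceptional-bound k M * n ^ k ∎
      where
      open ≤-Reasoning
      open +-*-Solver using (solve; _:*_; _:=_)
      Ts : List (Vec (Fin n) (2 + k))
      Ts = tuples n (2 + k)
      Ss : List (Subset (2 + k))
      Ss = allSubsets (2 + k)
      regroup : ∀ p q q' m ν → p * (p * (q * (q' * (m * (m * ν))))) ≡ p * (p * (q * (q' * (m * m)))) * ν
      regroup = solve 5 (λ p q q' m ν → p :* (p :* (q :* (q' :* (m :* (m :* ν))))) := p :* (p :* (q :* (q' :* (m :* m)))) :* ν) refl

  -- If c were outside P', the two arrows would form an exceptional configuration at the positions
  -- of P and P'. This supplies the hypothesis `exclusive` of `Centre`.
  exclusive-arrows : ∀ v → ¬ Exceptional v → ∀ {P c P' c'} →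
    P ⊆ img v × c ∈ img v × c ∉ P × c ∈ 𝒞 P → P' ⊆ img v × c' ∈ img v × c' ∉ P' × c' ∈ 𝒞 P' → c ≢ c' → c ∈ P'
  exclusive-arrows v ¬ex {P} {c} {P'} {c'} (P⊆ , c∈ , c∉P , c∈C) (P'⊆ , c'∈ , c'∉P' , c'∈C) ne with c ∈? P'
  ... | yes p = p
  ... | no c∉P' with ∈-img⁻ v c∈ | ∈-img⁻ v c'∈
  ...   | i , refl | i' , refl = ⊥-elim (¬ex (pullback P v , pullback P' v , i , punchOut i≢i' ,
          (c∉P ∘ ∈-pullback⁻ P v , c∉P' ∘ ∈-pullback⁻ P' v , (λ p → c'∉P' (∈-pullback⁻ P' v (subst (_∈ pullback P' v) (Fin.punchIn-punchOut i≢i') p)))) ,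
          subst (λ Q → lookup v i ∈ 𝒞 Q) (sym (imgOn-pullback P v P⊆)) c∈C ,
          subst (λ j → lookup v j ∈ 𝒞 (imgOn (pullback P' v) v)) (sym (Fin.punchIn-punchOut i≢i'))
            (subst (λ Q → lookup v i' ∈ 𝒞 Q) (sym (imgOn-pullback P' v P'⊆)) c'∈C)))
    where
    i≢i' : i ≢ i'
    i≢i' e = ne (cong (lookup v) e)

distinct-insertAt⁻ : ∀ {n m} (D : Vec (Fin n) m) i y → Distinct (insertAt D i y) → y ∉ img D × Distinct D
distinct-insertAt⁻ D i y d = distinct-∷⁻ y D (trans (cong ∣_∣ (sym (img-insertAt D i y))) d)

distinct-removeAt : ∀ {n m} (D : Vec (Fin n) (suc m)) i → Distinct D → lookup D i ∉ img (removeAt D i) × Distinct (removeAt D i)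
distinct-removeAt D i d = distinct-insertAt⁻ (removeAt D i) i (lookup D i) (subst Distinct (sym (insertAt-removeAt D i)) d)

img-removeAt : ∀ {n m} (D : Vec (Fin n) (suc m)) i → img D ≡ ⁅ lookup D i ⁆ ∪ img (removeAt D i)
img-removeAt D i = trans (cong img (sym (insertAt-removeAt D i))) (img-insertAt (removeAt D i) i (lookup D i))

distinct-++⁻ : ∀ {n k m} (v : Vec (Fin n) k) (w : Vec (Fin n) m) → Distinct (v Vec.++ w) → Distinct v
distinct-++⁻ {n} [] w d = ∣⊥∣≡0 n
distinct-++⁻ (x ∷ v) w d = let (x∉ , d') = distinct-∷⁻ x (v Vec.++ w) d in
  distinct-∷⁺ x v (λ p → x∉ (subst (x ∈_) (sym (img-++ v w)) (∈-∪ˡ p))) (distinct-++⁻ v w d')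

-- The shape in which Loomis-Whitney handles a-sets avoiding a centre `lookup v i`: the deletions of
-- one entry from the first a + 1 of the remaining entries.
subtuple : ∀ {n} a k (v : Vec (Fin n) (suc (suc a + k))) → Distinct v → ∀ i j → let w = removeAt (Vec.take (suc a) (removeAt v i)) j in
  Distinct w × img w ⊆ img v × lookup v i ∉ img w
subtuple a k v dv i j = proj₂ (distinct-removeAt D₁ j dD₁) , (λ p → D₁⊆ (del⊆ p)) , (λ p → proj₁ dD (subst (lookup v i ∈_) (sym imgD) (∈-∪ˡ (del⊆ p))))
  where
  D = removeAt v i
  D₁ = Vec.take (suc a) D
  D₂ = Vec.drop (suc a) D
  dD : lookup v i ∉ img D × Distinct D
  dD = distinct-removeAt v i dv
  imgD : img D ≡ img D₁ ∪ img D₂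
  imgD = trans (cong img (sym (take++drop≡id (suc a) D))) (img-++ D₁ D₂)
  dD₁ : Distinct D₁
  dD₁ = distinct-++⁻ D₁ D₂ (subst Distinct (sym (take++drop≡id (suc a) D)) (proj₂ dD))
  del⊆ : img (removeAt D₁ j) ⊆ img D₁
  del⊆ {y} p = subst (y ∈_) (sym (img-removeAt D₁ j)) (∈-∪ʳ ⁅ lookup D₁ j ⁆ p)
  D₁⊆ : img D₁ ⊆ img v
  D₁⊆ {y} p = subst (y ∈_) (sym (img-removeAt v i)) (∈-∪ʳ ⁅ lookup v i ⁆ (subst (y ∈_) (sym imgD) (∈-∪ˡ p)))

-- Arithmetic of the error terms

halves : ∀ M {x z y} → 2 * M * x ≤ y → 2 * M * z ≤ y → M * (x + z) ≤ y
halves M {x} {z} {y} p q = *-cancelˡ-≤ 2 (begin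
  2 * (M * (x + z))       ≡⟨ solve 3 (λ M x z → con 2 :* (M :* (x :+ z)) := con 2 :* M :* x :+ con 2 :* M :* z) refl M x z ⟩
  2 * M * x + 2 * M * z   ≤⟨ +-mono-≤ p q ⟩
  y + y                   ≡⟨ solve 1 (λ y → y :+ y := con 2 :* y) refl y ⟩
  2 * y ∎)
  where
  open ≤-Reasoning
  open +-*-Solver using (solve; _:*_; _:+_; _:=_; con)

lower-order : ∀ M {x K n k} → x ≤ K * n ^ k → M * K ≤ n → M * x ≤ n ^ suc k
lower-order M {x} {K} {n} {k} p q = ≤-trans (*-monoʳ-≤ M p) (≤-trans (≤-reflexive (sym (*-assoc M K (n ^ k)))) (*-monoˡ-≤ (n ^ k) q))

take-++ : ∀ {A : Set} {k m} (v : Vec A k) (w : Vec A m) → Vec.take k (v Vec.++ w) ≡ v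
take-++ [] w = refl
take-++ (x ∷ v) w = cong (x ∷_) (take-++ v w)

∑-take : ∀ n k m (f : Vec (Fin n) k → ℕ) → (∑[ D ∈ tuples n (k + m) ] f (Vec.take k D)) ≡ n ^ m * (∑[ v ∈ tuples n k ] f v)
∑-take n k m f = trans (∑-++ᵛ k m _) (trans (∑-cong (tuples n k) (λ v →
  trans (∑-cong (tuples n m) (λ w → cong f (take-++ v w))) (∑-tuples-const n m (f v)))) (∑-*ˡ (tuples n k) (n ^ m) f))

-- Here p stands for n ^ (r - 1), T for the ordered edges, F for the sum of all |f(D)|, w for |W|, ε
-- for the edges disjoint from W and γ for a lower order term. Density pushes F up to almost t' * p,
-- and only the `Hi` tuples with more than t' values could make up for the `Lo` tuples with fewer;
-- so `Lo` is an error term as well. `Hi` and `Sc` are carried along.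
deficit : ∀ r .{{_ : NonZero r}} {t' p T γ ε F Lo w Hi Sc} → r * (t' * p) ≤ T + r * (t' * γ) → T ≤ ε + r * F →
  F + Lo ≤ t' * p + w * Hi → Hi + (Lo + Sc) ≤ ε + (t' * γ + (w * Hi + (Hi + Sc)))
deficit r@(suc r') {t'} {p} {T} {γ} {ε} {F} {Lo} {w} {Hi} {Sc} dense total bal = begin
  Hi + (Lo + Sc)                          ≡⟨ solve 3 (λ h l s → h :+ (l :+ s) := l :+ (h :+ s)) refl Hi Lo Sc ⟩
  Lo + (Hi + Sc)                          ≤⟨ +-monoˡ-≤ (Hi + Sc) (+-cancelˡ-≤ F _ _ low) ⟩
  ε + (t' * γ + w * Hi) + (Hi + Sc)       ≡⟨ solve 4 (λ e g h s → e :+ (g :+ h) :+ s := e :+ (g :+ (h :+ s))) refl ε (t' * γ) (w * Hi) (Hi + Sc) ⟩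
  ε + (t' * γ + (w * Hi + (Hi + Sc))) ∎
  where
  open ≤-Reasoning
  open +-*-Solver using (solve; _:*_; _:+_; _:=_; con)
  mass : t' * p ≤ ε + F + t' * γ
  mass = *-cancelˡ-≤ r (begin
    r * (t' * p)                       ≤⟨ dense ⟩
    T + r * (t' * γ)                   ≤⟨ +-monoˡ-≤ _ total ⟩
    ε + r * F + r * (t' * γ)           ≤⟨ +-monoˡ-≤ _ (+-monoˡ-≤ _ (m≤n*m ε r)) ⟩
    r * ε + r * F + r * (t' * γ)       ≡⟨ solve 4 (λ r e f g → r :* e :+ r :* f :+ r :* g := r :* (e :+ f :+ g)) refl r ε F (t' * γ) ⟩
    r * (ε + F + t' * γ) ∎)
  low : F + Lo ≤ F + (ε + (t' * γ + w * Hi))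
  low = begin
    F + Lo                        ≤⟨ bal ⟩
    t' * p + w * Hi               ≤⟨ +-monoˡ-≤ _ mass ⟩
    ε + F + t' * γ + w * Hi       ≡⟨ solve 4 (λ e f g h → e :+ f :+ g :+ h := f :+ (e :+ (g :+ h))) refl ε F (t' * γ) (w * Hi) ⟩
    F + (ε + (t' * γ + w * Hi)) ∎

strictly-small : ∀ M x {p} → 0 < p → (2 + M) * x ≤ p → x < p
strictly-small M x {p} 0<p le = ≰⇒> λ p≤x → <-irrefl refl (begin-strict
  p              <⟨ m<m+n p 0<p ⟩
  p + p          ≤⟨ +-mono-≤ p≤x (≤-trans p≤x (m≤m+n x (M * x))) ⟩
  (2 + M) * x    ≤⟨ le ⟩
  p ∎)
  where open ≤-Reasoning

true≢false : ∀ {c : Bool} → c ≡ true → c ≢ false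
true≢false refl ()

-- Sharpens `count-arrow`: what remains after the deletion of the head is not arbitrary but
-- satisfies B, and the number of such tuples replaces n ^ m.
count-arrow-within : ∀ {n m N} (𝒞 : Subset n → Subset n) → (∀ P → ∣ 𝒞 P ∣ ≤ N) → ∀ (S : Subset (suc m))
  {A : Vec (Fin n) (suc m) → Set} (A? : ∀ v → Dec (A v)) {B : Vec (Fin n) m → Set} (B? : ∀ D → Dec (B D)) →
  (∀ v → A v → ∃ (ArrowAt 𝒞 S v)) → (∀ v → A v → ∀ c → B (removeAt v c)) →
  (∑[ v ∈ tuples n (suc m) ] ι (A? v)) ≤ suc m * (N * (∑[ D ∈ tuples n m ] ι (B? D)))
count-arrow-within {n} {m} {N} 𝒞 ∣𝒞∣ S {A} A? B? arrow within = begin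
  (∑[ v ∈ tuples n (suc m) ] ι (A? v))
    ≤⟨ ∑-mono (tuples n (suc m)) (λ v → ι-≤ (A? v) (λ p → one v p (arrow v p))) ⟩
  (∑[ v ∈ tuples n (suc m) ] ∑[ c ∈ allFin (suc m) ] (ι (arrowAt? 𝒞 S v c) * ι (B? (removeAt v c))))
    ≡⟨ ∑-swap (tuples n (suc m)) (allFin (suc m)) _ ⟩
  (∑[ c ∈ allFin (suc m) ] ∑[ v ∈ tuples n (suc m) ] (ι (arrowAt? 𝒞 S v c) * ι (B? (removeAt v c))))
    ≤⟨ ∑-mono (allFin (suc m)) (λ c → count-determined 𝒞 ∣𝒞∣ (opposite S c) c (∉-opposite S c) (λ v → ι (B? (removeAt v c))) (λ D → ι (B? D))
         (λ D y → ≤-reflexive (cong (λ D → ι (B? D)) (removeAt-insertAt D c y)))) ⟩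
  (∑[ c ∈ allFin (suc m) ] (N * (∑[ D ∈ tuples n m ] ι (B? D))))
    ≡⟨ ∑-allFin-const (suc m) _ ⟩
  suc m * (N * (∑[ D ∈ tuples n m ] ι (B? D))) ∎
  where
  open ≤-Reasoning
  one : ∀ v → A v → ∃ (ArrowAt 𝒞 S v) → 1 ≤ ∑[ c ∈ allFin (suc m) ] (ι (arrowAt? 𝒞 S v c) * ι (B? (removeAt v c)))
  one v p (c , α) = ∑-≥1 (λ c → ι (arrowAt? 𝒞 S v c) * ι (B? (removeAt v c))) (∈-allFin c)
    (≤-reflexive (sym (cong₂ _*_ (ι-yes (arrowAt? 𝒞 S v c) α) (ι-yes (B? (removeAt v c)) (within v p c)))))

-- The graphs Ψ

bool-ext : ∀ {c d : Bool} → (c ≡ true → d ≡ true) → (d ≡ true → c ≡ true) → c ≡ d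
bool-ext {false} {false} f g = refl
bool-ext {false} {true} f g = g refl
bool-ext {true} {false} f g = sym (f refl)
bool-ext {true} {true} f g = refl

count-disjoint : ∀ {n} (L : Subset n) r →
  (∑[ S ∈ allSubsets n ] (ι (∣ S ∣ ≟ r) * ι (disjoint? S L))) ≡ ∣ ∁ L ∣ C r
count-disjoint [] zero = trans (∑-allSubsets-zero _) (cong₂ _*_ (ι-yes (0 ≟ 0) refl) (ι-yes (disjoint? [] []) (λ ())))
count-disjoint [] (suc r) = trans (∑-allSubsets-zero _) (cong (_* ι (disjoint? [] [])) (ι-no (0 ≟ suc r) (λ ())))
count-disjoint {suc n} (true ∷ L) r = trans (∑-allSubsets-suc n _) (trans (cong₂ _+_
    (trans (∑-cong (allSubsets n) (λ S → cong (ι (∣ S ∣ ≟ r) *_) (ι-cong (disjoint? (false ∷ S) (true ∷ L)) (disjoint? S L)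
       (λ d p q → d (Vec.there p) (Vec.there q)) (λ { d (Vec.there p) (Vec.there q) → d p q })))) (count-disjoint L r))
    (trans (∑-cong (allSubsets n) (λ S → trans (cong (ι (∣ true ∷ S ∣ ≟ r) *_) (ι-no (disjoint? (true ∷ S) (true ∷ L)) (λ d → d Vec.here Vec.here)))
       (*-zeroʳ (ι (∣ true ∷ S ∣ ≟ r))))) (∑-zero {xs = allSubsets n} (λ _ → refl)))) (+-identityʳ _))
count-disjoint {suc n} (false ∷ L) r = trans (∑-allSubsets-suc n _) (trans (cong₂ _+_ (part-false r) refl) (part-true r))
  where
  part-false : ∀ r → (∑[ S ∈ allSubsets n ] (ι (∣ S ∣ ≟ r) * ι (disjoint? (false ∷ S) (false ∷ L)))) ≡ ∣ ∁ L ∣ C r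
  part-false r = trans (∑-cong (allSubsets n) (λ S → cong (ι (∣ S ∣ ≟ r) *_) (ι-cong (disjoint? (false ∷ S) (false ∷ L)) (disjoint? S L)
       (λ d p q → d (Vec.there p) (Vec.there q)) (λ { d (Vec.there p) (Vec.there q) → d p q })))) (count-disjoint L r)
  part-true : ∀ r → ∣ ∁ L ∣ C r + (∑[ S ∈ allSubsets n ] (ι (∣ true ∷ S ∣ ≟ r) * ι (disjoint? (true ∷ S) (false ∷ L)))) ≡ suc ∣ ∁ L ∣ C r
  part-true zero = cong (1 +_) (∑-zero (λ S → cong (_* ι (disjoint? (true ∷ S) (false ∷ L))) (ι-no (∣ true ∷ S ∣ ≟ 0) (λ ()))))
  part-true (suc r) = trans (cong (∣ ∁ L ∣ C suc r +_)
      (trans (∑-cong (allSubsets n) (λ S → cong₂ _*_ (ι-cong (suc ∣ S ∣ ≟ suc r) (∣ S ∣ ≟ r) suc-injective (cong suc))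
         (ι-cong (disjoint? (true ∷ S) (false ∷ L)) (disjoint? S L)
         (λ d p q → d (Vec.there p) (Vec.there q)) (λ { d (Vec.there p) (Vec.there q) → d p q })))) (count-disjoint L r)))
    (trans (+-comm (∣ ∁ L ∣ C suc r) _) (nCk+nC[k+1]≡[n+1]C[k+1] ∣ ∁ L ∣ r))

covering? : ∀ {n} r (L S : Subset n) → Dec (∣ S ∣ ≡ r × Meets S L)
covering? r L S = (∣ S ∣ ≟ r) ×-dec meets? S L

ι-×-≡ : {P Q : Set} (d : Dec P) (e : Dec Q) → ι (d ×-dec e) ≡ ι d * ι e
ι-×-≡ d e = ≤-antisym (ι-× (d ×-dec e) d e id) (back d e)
  where
  back : {P Q : Set} (d : Dec P) (e : Dec Q) → ι d * ι e ≤ ι (d ×-dec e)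
  back (no ¬p) e = ≤-trans (≤-reflexive (cong (_* ι e) (ι-no (no ¬p) ¬p))) z≤n
  back (yes p) e = ≤-trans (≤-trans (*-monoˡ-≤ (ι e) (ι≤1 (yes p))) (≤-reflexive (*-identityˡ (ι e)))) (ι-mono e (yes p ×-dec e) (λ q → p , q))

ι-≟true : ∀ c → (if c then 1 else 0) ≡ ι (c Bool.≟ true)
ι-≟true true = sym (ι-yes (true Bool.≟ true) refl)
ι-≟true false = sym (ι-no (false Bool.≟ true) (λ ()))

numEdges-∑ : ∀ {n r} (H : RGraph n r) → numEdges H ≡ ∑[ S ∈ allSubsets n ] ι (edge H S Bool.≟ true)
numEdges-∑ {n} H = trans (sym (∑-sum (allSubsets n) _)) (∑-cong (allSubsets n) (λ S → ι-≟true (edge H S)))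

tuples-numEdges : ∀ {n r} (H : RGraph n r) → (∑[ v ∈ tuples n r ] ι (edge H (img v) Bool.≟ true)) ≡ r ! * numEdges H
tuples-numEdges {n} {r} H = trans (∑-cong (tuples n r) (λ v → absorb (distinct? v) (edge H (img v) Bool.≟ true) (uniform H (img v))))
  (trans (∑-distinct-tuples r (λ S → ι (edge H S Bool.≟ true)))
    (cong (r ! *_) (trans (∑-cong (allSubsets n) (λ S → sym (absorb (∣ S ∣ ≟ r) (edge H S Bool.≟ true) (uniform H S)))) (sym (numEdges-∑ H)))))
  where
  absorb : {P Q : Set} (d : Dec P) (e : Dec Q) → (Q → P) → ι e ≡ ι d * ι e
  absorb d e f = trans (ι-cong e (d ×-dec e) (λ q → f q , q) proj₂) (ι-×-≡ d e)

count-all : ∀ n r → (∑[ S ∈ allSubsets n ] ι (∣ S ∣ ≟ r)) ≡ n C r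
count-all n r = trans (∑-cong (allSubsets n) (λ S → sym (trans (cong (ι (∣ S ∣ ≟ r) *_) (ι-yes (disjoint? S ⊥) (λ _ → ∉⊥))) (*-identityʳ _))))
  (trans (count-disjoint ⊥ r) (cong (_C r) (trans (∣∁p∣≡n∸∣p∣ {n} ⊥) (cong (n ∸_) (∣⊥∣≡0 n)))))

count-covering : ∀ {n} r (L : Subset n) → (∑[ S ∈ allSubsets n ] ι (covering? r L S)) + (n ∸ ∣ L ∣) C r ≡ n C r
count-covering {n} r L = begin
  (∑[ S ∈ allSubsets n ] ι (covering? r L S)) + (n ∸ ∣ L ∣) C r
    ≡⟨ cong ((∑[ S ∈ allSubsets n ] ι (covering? r L S)) +_) (sym (trans (count-disjoint L r) (cong (_C r) (∣∁p∣≡n∸∣p∣ L)))) ⟩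
  (∑[ S ∈ allSubsets n ] ι (covering? r L S)) + (∑[ S ∈ allSubsets n ] (ι (∣ S ∣ ≟ r) * ι (disjoint? S L)))
    ≡⟨ sym (∑-+ (allSubsets n) _ _) ⟩
  (∑[ S ∈ allSubsets n ] (ι (covering? r L S) + ι (∣ S ∣ ≟ r) * ι (disjoint? S L)))
    ≡⟨ ∑-cong (allSubsets n) pointwise ⟩
  (∑[ S ∈ allSubsets n ] ι (∣ S ∣ ≟ r))
    ≡⟨ count-all n r ⟩
  n C r ∎
  where
  open ≡-Reasoning
  complementary : ∀ S → Dec (Meets S L) → ι (meets? S L) + ι (disjoint? S L) ≡ 1
  complementary S (yes m@(_ , p , q)) = cong₂ _+_ (ι-yes (meets? S L) m) (ι-no (disjoint? S L) (λ d → d p q))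
  complementary S (no ¬m) = cong₂ _+_ (ι-no (meets? S L) ¬m) (ι-yes (disjoint? S L) (¬meets⇒disjoint ¬m))
  pointwise : ∀ S → ι (covering? r L S) + ι (∣ S ∣ ≟ r) * ι (disjoint? S L) ≡ ι (∣ S ∣ ≟ r)
  pointwise S = trans (cong (_+ ι (∣ S ∣ ≟ r) * ι (disjoint? S L)) (ι-×-≡ (∣ S ∣ ≟ r) (meets? S L)))
    (trans (sym (*-distribˡ-+ (ι (∣ S ∣ ≟ r)) (ι (meets? S L)) (ι (disjoint? S L))))
      (trans (cong (ι (∣ S ∣ ≟ r) *_) (complementary S (meets? S L))) (*-identityʳ _)))

C-mono : ∀ n k → n C k ≤ suc n C k
C-mono n zero = ≤-refl
C-mono n (suc k) = ≤-trans (m≤n+m (n C suc k) (n C k)) (≤-reflexive (nCk+nC[k+1]≡[n+1]C[k+1] n k))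

C-mono-+ : ∀ j n k → n C k ≤ (j + n) C k
C-mono-+ zero n k = ≤-refl
C-mono-+ (suc j) n k = ≤-trans (C-mono-+ j n k) (C-mono (j + n) k)

-- Each of the j Pascal steps from n to j + n contributes at least n C k. In `dense` this yields t'
-- * C(n - t', r - 1) edges.
C-increase : ∀ j n k → j * (n C k) + n C suc k ≤ (j + n) C suc k
C-increase zero n k = ≤-refl
C-increase (suc j) n k = begin
  n C k + j * (n C k) + n C suc k      ≡⟨ +-assoc (n C k) _ _ ⟩
  n C k + (j * (n C k) + n C suc k)    ≤⟨ +-mono-≤ (C-mono-+ j n k) (C-increase j n k) ⟩
  (j + n) C k + (j + n) C suc k        ≡⟨ nCk+nC[k+1]≡[n+1]C[k+1] (j + n) k ⟩
  suc (j + n) C suc k ∎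
  where open ≤-Reasoning

module _ {n : ℕ} where

  initial : ℕ → Subset n
  initial c = comprehension (λ i → toℕ i <? c)

  ∈-initial⁺ : ∀ c {i} → toℕ i < c → i ∈ initial c
  ∈-initial⁺ c = ∈-comprehension⁺ (λ i → toℕ i <? c)

  ∈-initial⁻ : ∀ c {i} → i ∈ initial c → toℕ i < c
  ∈-initial⁻ c = ∈-comprehension⁻ (λ i → toℕ i <? c)

count-below : ∀ n c → c ≤ n → (∑[ i ∈ allFin n ] ι (toℕ i <? c)) ≡ c
count-below n zero le = ∑-zero (λ i → ι-no (toℕ i <? 0) (λ ()))
count-below (suc n) (suc c) (s≤s le) = trans (∑-allFin-suc n _) (cong₂ _+_ (ι-yes (0 <? suc c) (s≤s z≤n))
  (trans (∑-cong (allFin n) (λ i → ι-cong (suc (toℕ i) <? suc c) (toℕ i <? c) ≤-pred s≤s)) (count-below n c le)))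

∣initial∣ : ∀ {n} c → c ≤ n → ∣ initial {n} c ∣ ≡ c
∣initial∣ {n} c le = trans (sym (∑-∈-size (initial c)))
  (trans (∑-cong (allFin n) (λ i → ι-cong (i ∈? initial c) (toℕ i <? c) (∈-initial⁻ c) (∈-initial⁺ c))) (count-below n c le))

any-true⁻ : ∀ {A : Set} (p : A → Bool) xs → Bool.any p xs ≡ true → ∃ λ x → p x ≡ true
any-true⁻ p xs e = let (x , q) = Any.satisfied (Any.any⁻ p xs (Equivalence.from T-≡ e)) in x , Equivalence.to T-≡ q

any-true⁺ : ∀ {A : Set} (p : A → Bool) {xs x} → x ∈ˡ xs → p x ≡ true → Bool.any p xs ≡ true
any-true⁺ p x∈ e = Equivalence.to T-≡ (Any.any⁺ p (Any.map (λ { refl → Equivalence.from T-≡ e }) x∈))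

∧-true⁻ : ∀ {c d} → c ∧ d ≡ true → c ≡ true × d ≡ true
∧-true⁻ {true} {true} _ = refl , refl

Ψ-edge⁻ : ∀ {c n r} S → edge (Ψ c n r) S ≡ true → ∣ S ∣ ≡ r × Meets S (initial c)
Ψ-edge⁻ {c} {n} {r} S e with ∧-true⁻ {∣ S ∣ ≡ᵇ r} e
... | _ , e₂ with any-true⁻ (λ i → (toℕ i <ᵇ c) ∧ lookup S i) (allFin n) e₂
...   | i , q with ∧-true⁻ {toℕ i <ᵇ c} q
...     | q₁ , q₂ = uniform (Ψ c n r) S e , i , lookup⇒[]= i S q₂ , ∈-initial⁺ c (<ᵇ⇒< (toℕ i) c (Equivalence.from T-≡ q₁))

Ψ-edge⁺ : ∀ {c n r} S → ∣ S ∣ ≡ r → Meets S (initial c) → edge (Ψ c n r) S ≡ true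
Ψ-edge⁺ {c} {n} {r} S e (i , i∈S , i∈) = cong₂ _∧_ (Equivalence.to T-≡ (≡⇒≡ᵇ ∣ S ∣ r e))
  (any-true⁺ (λ i → (toℕ i <ᵇ c) ∧ lookup S i) (∈-allFin i)
    (cong₂ _∧_ (Equivalence.to T-≡ (<⇒<ᵇ (∈-initial⁻ c i∈))) ([]=⇒lookup i∈S)))

toℕ-punchIn-last : ∀ {n} (i : Fin n) → toℕ (punchIn (fromℕ n) i) ≡ toℕ i
toℕ-punchIn-last zero = refl
toℕ-punchIn-last (suc i) = cong suc (toℕ-punchIn-last i)

-- The first vertex stays first if it is in L and is moved to the very end otherwise, where
-- inserting it does not shift the others.
sorting : ∀ {n} (L : Subset n) → Σ (Permutation′ n) λ π → ∀ i → (i ∈ L → toℕ (π ⟨$⟩ʳ i) < ∣ L ∣) × (toℕ (π ⟨$⟩ʳ i) < ∣ L ∣ → i ∈ L)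
sorting [] = Perm.id , λ ()
sorting (true ∷ L) with sorting L
... | π , h = Perm.lift₀ π , λ where
  zero → (λ _ → s≤s z≤n) , (λ _ → Vec.here)
  (suc i) → (λ { (Vec.there p) → s≤s (proj₁ (h i) p) }) , (λ { (s≤s q) → Vec.there (proj₂ (h i) q) })
sorting {suc n} (false ∷ L) with sorting L
... | π , h = Perm.insert zero (fromℕ n) π , λ where
  zero → (λ ()) , (λ q → ⊥-elim (<⇒≱ q (≤-trans (∣p∣≤n L) (≤-reflexive (sym (Fin.toℕ-fromℕ n))))))
  (suc i) → (λ { (Vec.there p) → subst (_< ∣ L ∣) (sym (toℕ-punchIn-last (π ⟨$⟩ʳ i))) (proj₁ (h i) p) }) ,
            (λ q → Vec.there (proj₂ (h i) (subst (_< ∣ L ∣) (toℕ-punchIn-last (π ⟨$⟩ʳ i)) q)))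

module _ {n : ℕ} (π : Permutation′ n) where

  ∈-mapSubset⁺ : ∀ S {y} → π ⟨$⟩ˡ y ∈ S → y ∈ mapSubset π S
  ∈-mapSubset⁺ S {y} p = lookup⇒[]= y _ (trans (lookup∘tabulate _ y) ([]=⇒lookup p))

  ∈-mapSubset⁻ : ∀ S {y} → y ∈ mapSubset π S → π ⟨$⟩ˡ y ∈ S
  ∈-mapSubset⁻ S {y} p = lookup⇒[]= _ S (trans (sym (lookup∘tabulate _ y)) ([]=⇒lookup p))

  img-map⊆ : ∀ {m} (v : Vec (Fin n) m) {y} → y ∈ img (Vec.map (π ⟨$⟩ʳ_) v) → π ⟨$⟩ˡ y ∈ img v
  img-map⊆ v {y} p with ∈-img⁻ (Vec.map (π ⟨$⟩ʳ_) v) p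
  ... | i , refl = subst (_∈ img v) (sym (trans (cong (π ⟨$⟩ˡ_) (lookup-map i (π ⟨$⟩ʳ_) v)) (Perm.inverseˡ π))) (∈-img⁺ v i)

  distinct-map : ∀ {m} (v : Vec (Fin n) m) → Distinct v → Distinct (Vec.map (π ⟨$⟩ʳ_) v)
  distinct-map [] d = d
  distinct-map (y ∷ v) d with distinct-∷⁻ y v d
  ... | y∉ , d' = distinct-∷⁺ (π ⟨$⟩ʳ y) (Vec.map (π ⟨$⟩ʳ_) v) (λ p → y∉ (subst (_∈ img v) (Perm.inverseˡ π) (img-map⊆ v p))) (distinct-map v d')

  ∣mapSubset∣ : ∀ S → ∣ mapSubset π S ∣ ≡ ∣ S ∣
  ∣mapSubset∣ S with enumerate S
  ... | v , e = trans (cong ∣_∣ (sym image)) (distinct-map v (cong ∣_∣ e))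
    where
    image : img (Vec.map (π ⟨$⟩ʳ_) v) ≡ mapSubset π S
    image = ⊆-antisym (λ p → ∈-mapSubset⁺ S (subst (_ ∈_) e (img-map⊆ v p)))
      (λ {y} p → case ∈-img⁻ v (subst (π ⟨$⟩ˡ y ∈_) (sym e) (∈-mapSubset⁻ S p)) of λ (i , q) →
        subst (_∈ img (Vec.map (π ⟨$⟩ʳ_) v)) (trans (lookup-map i (π ⟨$⟩ʳ_) v) (trans (cong (π ⟨$⟩ʳ_) q) (Perm.inverseʳ π))) (∈-img⁺ (Vec.map (π ⟨$⟩ʳ_) v) i))

-- `Ψ` up to isomorphism, with an arbitrary set L in place of an initial segment.
Star : ∀ {n r} → RGraph n r → Subset n → Set
Star {r = r} H L = ∀ S → (edge H S ≡ true → ∣ S ∣ ≡ r × Meets S L) × (∣ S ∣ ≡ r → Meets S L → edge H S ≡ true)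

star-numEdges : ∀ {n r} {H : RGraph n r} {L} → Star H L → numEdges H + (n ∸ ∣ L ∣) C r ≡ n C r
star-numEdges {n} {r} {H} {L} star = trans (cong (_+ (n ∸ ∣ L ∣) C r) (trans (numEdges-∑ H)
  (∑-cong (allSubsets n) (λ S → ι-cong (edge H S Bool.≟ true) (covering? r L S) (proj₁ (star S)) (λ (e , m) → proj₂ (star S) e m)))))
  (count-covering r L)

star-iso : ∀ {n r} {H : RGraph n r} {L} → Star H L → H ≅ Ψ ∣ L ∣ n r
star-iso {n} {r} {H} {L} star with sorting L
... | π , sorted = π , λ S → bool-ext (forward S) (backward S)
  where
  forward : ∀ S → edge H S ≡ true → edge (Ψ ∣ L ∣ n r) (mapSubset π S) ≡ true
  forward S e with proj₁ (star S) e
  ... | ∣S∣ , i , i∈S , i∈L = Ψ-edge⁺ (mapSubset π S) (trans (∣mapSubset∣ π S) ∣S∣)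
    (π ⟨$⟩ʳ i , ∈-mapSubset⁺ π S (subst (_∈ S) (sym (Perm.inverseˡ π)) i∈S) , ∈-initial⁺ ∣ L ∣ (proj₁ (sorted i) i∈L))
  backward : ∀ S → edge (Ψ ∣ L ∣ n r) (mapSubset π S) ≡ true → edge H S ≡ true
  backward S e with Ψ-edge⁻ (mapSubset π S) e
  ... | ∣S∣ , y , y∈S , y∈ = proj₂ (star S) (trans (sym (∣mapSubset∣ π S)) ∣S∣)
    (π ⟨$⟩ˡ y , ∈-mapSubset⁻ π S y∈S , proj₂ (sorted (π ⟨$⟩ˡ y)) (subst (λ z → toℕ z < ∣ L ∣) (sym (Perm.inverseʳ π)) (∈-initial⁻ ∣ L ∣ y∈)))

module _ {s t a b : ℕ} where

  any-vertex? : {P : BVtx s t a b → Set} → (∀ w → Dec (P w)) → Dec (∃ P)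
  any-vertex? P? = map′
    (λ { (inj₁ (i , k , p)) → inj₁ (i , k) , p ; (inj₂ (j , k , p)) → inj₂ (j , k) , p })
    (λ { (inj₁ (i , k) , p) → inj₁ (i , k , p) ; (inj₂ (j , k) , p) → inj₂ (j , k , p) })
    (Fin.any? (λ i → Fin.any? (λ k → P? (inj₁ (i , k)))) ⊎-dec Fin.any? (λ j → Fin.any? (λ k → P? (inj₂ (j , k)))))

  -- The values below c are added one by one; injectivity allows at most one vertex for each, which
  -- bounds the length.
  preimage : ∀ {n} (φ : BVtx s t a b → Fin n) → Injective _≡_ _≡_ φ → ∀ c →
    ∃ λ ws → Unique ws × length ws ≤ c × All (λ w → toℕ (φ w) < c) ws × (∀ w → toℕ (φ w) < c → w ∈ˡ ws)
  preimage φ inj zero = [] , [] , z≤n , [] , λ w ()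
  preimage φ inj (suc c) with preimage φ inj c | any-vertex? (λ w → toℕ (φ w) ≟ c)
  ... | ws , unique , ∣ws∣ , below , all | no none =
    ws , unique , ≤-trans ∣ws∣ (n≤1+n c) , All.map (λ q → ≤-trans q (n≤1+n c)) below ,
    λ w q → all w (≤∧≢⇒< (≤-pred q) (λ e → none (w , e)))
  ... | ws , unique , ∣ws∣ , below , all | yes (w₀ , e₀) =
    w₀ ∷ ws , All.map (λ q eq → <-irrefl (trans (cong (toℕ ∘ φ) (sym eq)) e₀) q) below ∷ unique , s≤s ∣ws∣ ,
    ≤-reflexive (cong suc e₀) ∷ All.map (λ q → ≤-trans q (n≤1+n c)) below ,
    λ w q → case toℕ (φ w) ≟ c of λ where
      (yes e) → here (inj (Fin.toℕ-injective (trans e (sym e₀))))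
      (no ne) → there (all w (≤∧≢⇒< (≤-pred q) ne))

∈-⋃⁻ : ∀ {n} (ps : List (Subset n)) {y} → y ∈ ⋃ ps → ∃ λ p → p ∈ˡ ps × y ∈ p
∈-⋃⁻ [] y∈ = ⊥-elim (∉⊥ y∈)
∈-⋃⁻ (p ∷ ps) y∈ with x∈p∪q⁻ p (⋃ ps) y∈
... | inj₁ q = p , here refl , q
... | inj₂ q with ∈-⋃⁻ ps q
...   | p' , p'∈ , q' = p' , there p'∈ , q'

∈-imgEdge⁻ : ∀ {s t a b n} (φ : BVtx s t a b → Fin n) i j {y} → y ∈ imgEdge φ i j → ∃ λ w → InBEdge i j w × φ w ≡ y
∈-imgEdge⁻ {a = a} {b} φ i j y∈ with ∈-⋃⁻ (map (λ k → ⁅ φ (inj₁ (i , k)) ⁆) (allFin a) ++ map (λ k → ⁅ φ (inj₂ (j , k)) ⁆) (allFin b)) y∈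
... | p , p∈ , q with ∈-++⁻ (map (λ k → ⁅ φ (inj₁ (i , k)) ⁆) (allFin a)) p∈
...   | inj₁ m with ∈-map⁻ (λ k → ⁅ φ (inj₁ (i , k)) ⁆) m
...     | k , _ , refl = inj₁ (i , k) , refl , sym (x∈⁅y⁆⇒x≡y _ q)
∈-imgEdge⁻ {a = a} {b} φ i j y∈ | p , p∈ , q | inj₂ m with ∈-map⁻ (λ k → ⁅ φ (inj₂ (j , k)) ⁆) m
...     | k , _ , refl = inj₂ (j , k) , refl , sym (x∈⁅y⁆⇒x≡y _ q)

-- The preimage of [c] under a copy of the blowup would be a transversal.
Ψ-free : ∀ {s t} (E : BipGraph s t) {a b} n r c → (∀ (ws : List (BVtx s t a b)) → Unique ws → Transversal E ws → c < length ws) → Free E a b (Ψ c n r)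
Ψ-free E n r c τ (φ , inj , edges) with preimage φ inj c
... | ws , unique , ∣ws∣ , _ , all = <⇒≱ (τ ws unique transversal) ∣ws∣
  where
  transversal : Transversal E ws
  transversal i j e with Ψ-edge⁻ (imgEdge φ i j) (edges i j e)
  ... | _ , y , y∈ , y<c with ∈-imgEdge⁻ φ i j y∈
  ...   | w , w∈ , refl = w , all w (∈-initial⁻ c y<c) , w∈

-- The leaf x lies in V and u is its neighbour; b = 2 + b', t = 1 + t', and r = a + b in the form that
-- makes an r-tuple a centre followed by a + 1 and b' further entries.
module Tree (a b' s t' : ℕ) (E : BipGraph s (suc t')) (acyclic : Acyclic E) (connected : Connected E)
  (x : Fin (suc t')) (u : Fin s) (ux : E u x ≡ true) (leaf : ∀ i → E i x ≡ true → i ≡ u)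
  (N : ℕ) (large : (suc (suc a + b') + suc t') + (s + suc t') * suc (suc a + b') ≤ N)
  (3≤a : 3 ≤ a) (1≤t' : 1 ≤ t') where

  r b t : ℕ
  r = suc (suc a + b')
  b = 2 + b'
  t = suc t'

  a+b≡r : a + b ≡ r
  a+b≡r = trans (+-suc a (suc b')) (cong suc (+-suc a b'))

  a≤r : a ≤ r
  a≤r = ≤-trans (m≤m+n a b) (≤-reflexive a+b≡r)

  b≤r : b ≤ r
  b≤r = ≤-trans (m≤n+m b a) (≤-reflexive a+b≡r)

  neighbour : ∀ {z} → Reach E (inj₁ u) z → z ≢ inj₁ u → ∃ λ y → Adj E y z
  neighbour here ne = ⊥-elim (ne refl)
  neighbour (step _ e) ne = _ , e

  neighbour-row : ∀ i → i ≢ u → ∃ λ j → j ≢ x × E i j ≡ true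
  neighbour-row i ne with neighbour (connected (inj₁ u) (inj₁ i)) (λ { refl → ne refl })
  ... | inj₂ j , e = j , (λ { refl → ne (leaf i e) }) , e

  neighbour-col : ∀ j → ∃ λ i → E i j ≡ true
  neighbour-col j with neighbour (connected (inj₁ u) (inj₂ j)) (λ ())
  ... | inj₁ i , e = i , e

  -- The two greedy embeddings

  module _ {n : ℕ} (H : RGraph n r) where

    -- Common form of both embeddings. The leaf x receives the given Q₀, every other V_j a
    -- prescribed part δ j and a greedily chosen rest; Q₀ and all δ j belong to the forbidden set Y.
    -- By `large`, N leaves room for Y and for a set of at most r vertices at each vertex of T.
    greedy-copy : (R : Subset n → Subset n → Set) (GP GQ : Subset n → Set) →
      (∀ {P} → GP P → ∀ Y → ∣ Y ∣ ≤ N → ∃ λ Q → R P Q × GQ Q × Disjoint Q Y) →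
      (∀ {Q} → GQ Q → ∀ Y → ∣ Y ∣ ≤ N → ∃ λ P → R P Q × GP P × Disjoint P Y) →
      (δ : Fin t → Subset n) (Y : Subset n) → ∣ Y ∣ ≤ r + t → (∀ {j} → j ≢ x → δ j ⊆ Y) →
      (∀ {j j'} → j ≢ x → j' ≢ x → j ≢ j' → Disjoint (δ j) (δ j')) →
      (∀ {P Q} → R P Q → ∣ P ∣ ≡ a × ∣ Q ∣ ≤ r × (∀ {j} → j ≢ x → ∣ δ j ∪ Q ∣ ≡ b × edge H (P ∪ (δ j ∪ Q)) ≡ true)) →
      ∀ P₀ Q₀ → GP P₀ → ∣ P₀ ∣ ≡ a → ∣ Q₀ ∣ ≡ b → Disjoint P₀ Y → Q₀ ⊆ Y → (∀ {j} → j ≢ x → Disjoint Q₀ (δ j)) →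
      edge H (P₀ ∪ Q₀) ≡ true → ContainsBlowup E a b H
    greedy-copy R GP GQ grow-row grow-col δ Y ∣Y∣ δ⊆Y δδ R⇒ P₀ Q₀ GP₀ ∣P₀∣ ∣Q₀∣ P₀-Y Q₀⊆Y Qδ e₀ =
      blowup-copy E H A B ∣A∣ ∣B∣ (λ ne → φφ (λ { refl → ne refl })) BB AB AB∈H
      where
      sized-row : ∀ {P} → GP P → ∀ Y → ∣ Y ∣ ≤ N → ∃ λ Q → R P Q × GQ Q × ∣ Q ∣ ≤ r × Disjoint Q Y
      sized-row g Y le = let (Q , ρ , g' , d) = grow-row g Y le in Q , ρ , g' , proj₁ (proj₂ (R⇒ ρ)) , d
      sized-col : ∀ {Q} → GQ Q → ∀ Y → ∣ Y ∣ ≤ N → ∃ λ P → R P Q × GP P × ∣ P ∣ ≤ r × Disjoint P Y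
      sized-col g Y le = let (P , ρ , g' , d) = grow-col g Y le in P , ρ , g' , ≤-trans (≤-reflexive (proj₁ (R⇒ ρ))) a≤r , d
      open Greedy E acyclic connected x u ux leaf R GP GQ r N sized-row sized-col
        Y (≤-trans (+-monoˡ-≤ _ ∣Y∣) large) P₀ GP₀ (≤-trans (≤-reflexive ∣P₀∣) a≤r) P₀-Y
      φ = proj₁ embedding
      φ-u : φ (inj₁ u) ≡ P₀
      φ-u = proj₁ (proj₂ embedding)
      φ-Y : ∀ z → Disjoint (φ z) Y
      φ-Y = proj₁ (proj₂ (proj₂ embedding))
      φφ : ∀ {y z} → y ≢ z → Disjoint (φ y) (φ z)
      φφ = proj₁ (proj₂ (proj₂ (proj₂ embedding)))
      φR : ∀ {i j} → j ≢ x → E i j ≡ true → R (φ (inj₁ i)) (φ (inj₂ j))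
      φR = proj₂ (proj₂ (proj₂ (proj₂ embedding)))
      A : Fin s → Subset n
      A i = φ (inj₁ i)
      B : Fin t → Subset n
      B j with j Fin.≟ x
      ... | yes _ = Q₀
      ... | no _ = δ j ∪ φ (inj₂ j)
      -- Apart from u and x, every vertex of T lies on an edge other than u x, and the relation R
      -- for that edge contains the size of its set.
      ∣A∣ : ∀ i → ∣ A i ∣ ≡ a
      ∣A∣ i with i Fin.≟ u
      ... | yes refl = trans (cong ∣_∣ φ-u) ∣P₀∣
      ... | no ne = let (j , j≢x , e) = neighbour-row i ne in proj₁ (R⇒ (φR j≢x e))
      ∣B∣ : ∀ j → ∣ B j ∣ ≡ b
      ∣B∣ j with j Fin.≟ x
      ... | yes _ = ∣Q₀∣
      ... | no ne = let (i , e) = neighbour-col j in proj₁ (proj₂ (proj₂ (R⇒ (φR ne e))) ne)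
      Q-φ : ∀ z → Disjoint Q₀ (φ z)
      Q-φ z p q = φ-Y z q (Q₀⊆Y p)
      δ-φ : ∀ {j} → j ≢ x → ∀ z → Disjoint (δ j) (φ z)
      δ-φ ne z p q = φ-Y z q (δ⊆Y ne p)
      BB : ∀ {j j'} → j ≢ j' → Disjoint (B j) (B j')
      BB {j} {j'} ne with j Fin.≟ x | j' Fin.≟ x
      ... | yes e | yes e' = ⊥-elim (ne (trans e (sym e')))
      ... | yes e | no e' = disjoint-∪ʳ (δ j') _ (Qδ e') (Q-φ (inj₂ j'))
      ... | no e | yes e' = disjoint-sym (disjoint-∪ʳ (δ j) _ (Qδ e) (Q-φ (inj₂ j)))
      ... | no e | no e' = disjoint-∪ʳ (δ j') _
        (disjoint-sym (disjoint-∪ʳ (δ j) _ (δδ e' e (ne ∘ sym)) (δ-φ e' (inj₂ j))))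
        (disjoint-sym (disjoint-∪ʳ (δ j) _ (disjoint-sym (δ-φ e (inj₂ j'))) (φφ (λ { refl → ne refl }))))
      AB : ∀ i j → Disjoint (A i) (B j)
      AB i j with j Fin.≟ x
      ... | yes _ = disjoint-sym (Q-φ (inj₁ i))
      ... | no ne = disjoint-∪ʳ (δ j) _ (disjoint-sym (δ-φ ne (inj₁ i))) (φφ (λ ()))
      AB∈H : ∀ i j → E i j ≡ true → edge H (A i ∪ B j) ≡ true
      AB∈H i j e with j Fin.≟ x
      ... | yes refl = trans (cong (λ P → edge H (P ∪ Q₀)) (trans (cong A (leaf i e)) φ-u)) e₀
      ... | no ne = proj₂ (proj₂ (proj₂ (R⇒ (φR ne e))) ne)

    Split : Subset n → Subset n → Set
    Split P Q = ∣ P ∣ ≡ a × ∣ Q ∣ ≡ b × Disjoint P Q × edge H (P ∪ Q) ≡ true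

    split? : ∀ P Q → Dec (Split P Q)
    split? P Q = (∣ P ∣ ≟ a) ×-dec (∣ Q ∣ ≟ b) ×-dec disjoint? P Q ×-dec (edge H (P ∪ Q) Bool.≟ true)

    splits : Rel n
    splits P Q = ⌊ split? P Q ⌋

    splitCore : Core N splits
    splitCore = coreOf N splits

    -- A surviving pair would start an embedding with empty parts δ, in which rich rows and columns
    -- allow every further step.
    splitCore-empty : Free E a b H → ∀ {P Q} → Core.core splitCore P Q ≡ false
    splitCore-empty free {P₀} {Q₀} = ¬-not λ c₀ → let (∣P₀∣ , ∣Q₀∣ , d , e) = ⌊⌋⁻ (split? P₀ Q₀) (core⊆ c₀) in
      free (greedy-copy Split (λ P → ∃ λ Q → core P Q ≡ true) (λ Q → ∃ λ P → core P Q ≡ true)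
        (λ {P} (_ , c) Y le → let (Q , c' , d) = rich-row c Y le in Q , ⌊⌋⁻ (split? P Q) (core⊆ c') , (P , c') , d)
        (λ {Q} (_ , c) Y le → let (P , c' , d) = rich-col c Y le in P , ⌊⌋⁻ (split? P Q) (core⊆ c') , (Q , c') , d)
        (λ _ → ⊥) Q₀ (≤-trans (≤-reflexive ∣Q₀∣) (≤-trans b≤r (m≤m+n r t))) (λ _ → ⊥⊆) (λ _ _ _ p → ⊥-elim (∉⊥ p))
        (λ {P} {Q} (∣P∣ , ∣Q∣ , _ , e) → ∣P∣ , ≤-trans (≤-reflexive ∣Q∣) b≤r , λ _ →
          trans (cong ∣_∣ (∪-identityˡ Q)) ∣Q∣ , trans (cong (λ Q → edge H (P ∪ Q)) (∪-identityˡ Q)) e)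
        P₀ Q₀ (Q₀ , c₀) ∣P₀∣ ∣Q₀∣ d id (λ _ _ → ∉⊥) e)
      where open Core splitCore

    -- Z plays the role of a part V_j that still lacks one vertex, and any vertex of X may complete
    -- it.
    Linked : Subset n → Subset n → Subset n → Set
    Linked X P Z = ∣ P ∣ ≡ a × ∣ Z ∣ ≡ suc b' × Disjoint P Z × Disjoint P X × Disjoint Z X ×
      (∀ l → l ∈ X → edge H (⁅ l ⁆ ∪ (P ∪ Z)) ≡ true)

    linked? : ∀ X P Z → Dec (Linked X P Z)
    linked? X P Z = (∣ P ∣ ≟ a) ×-dec (∣ Z ∣ ≟ suc b') ×-dec disjoint? P Z ×-dec disjoint? P X ×-dec disjoint? Z X ×-dec
      Fin.all? (λ l → (l ∈? X) →-dec (edge H (⁅ l ⁆ ∪ (P ∪ Z)) Bool.≟ true))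

    links : Subset n → Rel n
    links X P Z = ⌊ linked? X P Z ⌋

    linkCore : ∀ X → Core N (links X)
    linkCore X = coreOf N (links X)

    InCore : Subset n → Subset n → Subset n → Set
    InCore X P Z = Core.core (linkCore X) P Z ≡ true

    inCore⇒linked : ∀ X {P Z} → InCore X P Z → Linked X P Z
    inCore⇒linked X {P} {Z} c = ⌊⌋⁻ (linked? X P Z) (Core.core⊆ (linkCore X) c)

    CoreColumn : Subset n → Subset n → Set
    CoreColumn X Z = ∃ λ P → InCore X P Z

    coreColumn? : ∀ X Z → Dec (CoreColumn X Z)
    coreColumn? X Z = anySubset? (λ P → Core.core (linkCore X) P Z Bool.≟ true)

    -- P need not occur in a core pair itself: it is enough that the embedding can step from it into
    -- the core. This matters in the last part, where P comes from an edge disjoint from L.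
    Attached : Subset n → Subset n → Set
    Attached X P = ∀ Y → ∣ Y ∣ ≤ N → ∃ λ Z → Linked X P Z × CoreColumn X Z × Disjoint Z Y

    Confined : Subset n → Subset n → Set
    Confined X P = ∃ λ Y → ∣ Y ∣ ≤ N × ¬ (∃ λ Z → Linked X P Z × CoreColumn X Z × Disjoint Z Y)

    confined? : ∀ X P → Dec (Confined X P)
    confined? X P = anySubset? (λ Y → (∣ Y ∣ ≤? N) ×-dec ¬? (available? Y))
      where
      available? : ∀ Y → Dec (∃ λ Z → Linked X P Z × CoreColumn X Z × Disjoint Z Y)
      available? Y = anySubset? (λ Z → linked? X P Z ×-dec coreColumn? X Z ×-dec disjoint? Z Y)

    ¬confined⇒attached : ∀ X P → ¬ Confined X P → Attached X P
    ¬confined⇒attached X P ¬c Y le = decidable-stable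
      (anySubset? (λ Z → linked? X P Z ×-dec coreColumn? X Z ×-dec disjoint? Z Y)) (λ none → ¬c (Y , le , none))

    inCore⇒attached : ∀ X {P Z} → InCore X P Z → Attached X P
    inCore⇒attached X {P} c Y le = let (Z , c' , d) = Core.rich-row (linkCore X) c Y le in Z , inCore⇒linked X c' , (P , c') , d

    -- The leaf x is sent to Q₀, and every other V_j receives one vertex of X.
    attached-free : Free E a b H → ∀ {X X'} → X ⊆ X' → ∣ X ∣ ≡ t' → ∀ P₀ Q₀ → Attached X' P₀ →
      ∣ Q₀ ∣ ≡ b → Disjoint P₀ Q₀ → Disjoint Q₀ X → edge H (P₀ ∪ Q₀) ≡ false
    attached-free free {X} {X'} X⊆ ∣X∣ P₀ Q₀ att ∣Q₀∣ PQ QX = ¬-not λ e →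
      free (greedy-copy (Linked X') (Attached X') (CoreColumn X') att'
        (λ (_ , c) Y le → let (P , c' , d) = Core.rich-col (linkCore X') c Y le in P , inCore⇒linked X' c' , inCore⇒attached X' c' , d)
        δ (Q₀ ∪ X) (≤-trans (∣∪∣≤ Q₀ X) (+-mono-≤ (≤-trans (≤-reflexive ∣Q₀∣) b≤r) (≤-trans (≤-reflexive ∣X∣) (n≤1+n t'))))
        (λ ne p → ∈-∪ʳ Q₀ (δ⊆X ne p)) δδ linked⇒ P₀ Q₀ att ∣P₀∣ ∣Q₀∣ (disjoint-∪ʳ Q₀ X PQ (λ p q → P₀X' p (X⊆ q)))
        ∈-∪ˡ (λ ne p q → QX p (δ⊆X ne q)) e)
      where
      att' : ∀ {P} → Attached X' P → ∀ Y → ∣ Y ∣ ≤ N → ∃ λ Z → Linked X' P Z × CoreColumn X' Z × Disjoint Z Y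
      att' α = α
      P₀-linked : ∃ λ Z → Linked X' P₀ Z × CoreColumn X' Z × Disjoint Z ⊥
      P₀-linked = att ⊥ (∣⊥∣≤ n)
      ∣P₀∣ : ∣ P₀ ∣ ≡ a
      ∣P₀∣ = proj₁ (proj₁ (proj₂ P₀-linked))
      P₀X' : Disjoint P₀ X'
      P₀X' = proj₁ (proj₂ (proj₂ (proj₂ (proj₁ (proj₂ P₀-linked)))))
      e = enumerate-as X ∣X∣
      δ : Fin t → Subset n
      δ j with x Fin.≟ j
      ... | yes _ = ⊥
      ... | no ne = ⁅ lookup (proj₁ e) (punchOut ne) ⁆
      δ-at : ∀ {j} → j ≢ x → Σ (x ≢ j) λ ne → δ j ≡ ⁅ lookup (proj₁ e) (punchOut ne) ⁆
      δ-at {j} j≢x with x Fin.≟ j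
      ... | yes eq = ⊥-elim (j≢x (sym eq))
      ... | no ne = ne , refl
      entry∈X : ∀ k → lookup (proj₁ e) k ∈ X
      entry∈X k = subst (lookup (proj₁ e) k ∈_) (proj₂ e) (∈-img⁺ (proj₁ e) k)
      δ⊆X : ∀ {j} → j ≢ x → δ j ⊆ X
      δ⊆X {j} j≢x {y} p with δ-at j≢x
      ... | ne , eq = subst (_∈ X) (sym (x∈⁅y⁆⇒x≡y _ (subst (y ∈_) eq p))) (entry∈X (punchOut ne))
      δδ : ∀ {j j'} → j ≢ x → j' ≢ x → j ≢ j' → Disjoint (δ j) (δ j')
      δδ {j} {j'} j≢x j'≢x j≢j' {y} p q with δ-at j≢x | δ-at j'≢x
      ... | ne , eq | ne' , eq' = j≢j' (Fin.punchOut-injective ne ne' (distinct⇒injective (proj₁ e) (trans (cong ∣_∣ (proj₂ e)) ∣X∣)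
              (trans (sym (x∈⁅y⁆⇒x≡y _ (subst (y ∈_) eq p))) (x∈⁅y⁆⇒x≡y _ (subst (y ∈_) eq' q)))))
      linked⇒ : ∀ {P Z} → Linked X' P Z → ∣ P ∣ ≡ a × ∣ Z ∣ ≤ r × (∀ {j} → j ≢ x → ∣ δ j ∪ Z ∣ ≡ b × edge H (P ∪ (δ j ∪ Z)) ≡ true)
      linked⇒ {P} {Z} (∣P∣ , ∣Z∣ , _ , _ , ZX , edges) = ∣P∣ , ≤-trans (≤-reflexive ∣Z∣) (≤-trans (n≤1+n _) b≤r) , at
        where
        at : ∀ {j} → j ≢ x → ∣ δ j ∪ Z ∣ ≡ b × edge H (P ∪ (δ j ∪ Z)) ≡ true
        at {j} j≢x with δ-at j≢x
        ... | ne , eq = trans (cong (λ D → ∣ D ∪ Z ∣) eq) (trans (∣⁅⁆∪∣ l Z (λ q → ZX q l∈X')) (cong suc ∣Z∣)) ,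
                        trans (cong (edge H) (trans (cong (λ D → P ∪ (D ∪ Z)) eq) rearrange)) (edges l l∈X')
          where
          l = lookup (proj₁ e) (punchOut ne)
          l∈X' : l ∈ X'
          l∈X' = X⊆ (entry∈X (punchOut ne))
          rearrange : P ∪ (⁅ l ⁆ ∪ Z) ≡ ⁅ l ⁆ ∪ (P ∪ Z)
          rearrange = trans (sym (∪-assoc P ⁅ l ⁆ Z)) (trans (cong (_∪ Z) (∪-comm P ⁅ l ⁆)) (∪-assoc ⁅ l ⁆ P Z))

  -- Concentration of the edges on a bounded set

  N₂ ρ : ℕ
  N₂ = N + N
  ρ = suc a + b'

  0<N₂ : 0 < N₂
  0<N₂ = ≤-trans (s≤s z≤n) (≤-trans large (m≤m+n N N))

  module _ {n : ℕ} (H : RGraph n r) where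

    Edge : ∀ {m} → Vec (Fin n) m → Set
    Edge v = edge H (img v) ≡ true

    edge? : ∀ {m} (v : Vec (Fin n) m) → Dec (Edge v)
    edge? v = edge H (img v) Bool.≟ true

    edge⇒distinct : ∀ (v : Vec (Fin n) r) → Edge v → Distinct v
    edge⇒distinct v e = uniform H (img v) e

    edge-split : ∀ {F P} → edge H F ≡ true → P ⊆ F → ∣ P ∣ ≡ a → Split H P (F ─ P)
    edge-split {F} {P} e P⊆F ∣P∣ = ∣P∣ ,
      +-cancelˡ-≡ a _ _ (trans (trans (cong (_+ ∣ F ─ P ∣) (sym ∣P∣)) (∣─∣ P⊆F)) (trans (uniform H F e) (sym a+b≡r))) ,
      disjoint-─ P F , trans (cong (edge H) (∪-─ P⊆F)) e

    edge-centre : ∀ {M} (𝒞 : Subset n → Subset n) (∣𝒞∣ : ∀ P → ∣ 𝒞 P ∣ ≤ M) →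
      (∀ P Q → Split H P Q → Meets Q (𝒞 P) ⊎ Meets P (𝒞 Q)) →
      ∀ (v : Vec (Fin n) r) → Edge v → ¬ Exceptional {k = a + b'} 𝒞 ∣𝒞∣ v →
      ∃ λ c → c ∈ img v × (∀ P → P ⊆ img v → ∣ P ∣ ≡ a → c ∉ P → c ∈ 𝒞 P)
    edge-centre 𝒞 ∣𝒞∣ meets v e ¬ex = Centre.centre 𝒞 (img v) a b 3≤a (s≤s (s≤s z≤n)) (trans (uniform H (img v) e) (sym a+b≡r))
      (λ {P} → arrows {P}) (λ {P} {c} {P'} {c'} → exclusive-arrows 𝒞 ∣𝒞∣ v ¬ex {P} {c} {P'} {c'})
      where
      Arrow : Subset n → Fin n → Set
      Arrow P c = P ⊆ img v × c ∈ img v × c ∉ P × c ∈ 𝒞 P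
      arrows : ∀ {P} → P ⊆ img v → ∣ P ∣ ≡ a → (∃ λ c → Arrow P c) ⊎ (∃ λ c → c ∈ P × Arrow (img v ─ P) c)
      arrows {P} P⊆F ∣P∣ with meets P (img v ─ P) (edge-split e P⊆F ∣P∣)
      ... | inj₁ (c , c∈Q , c∈C) = inj₁ (c , P⊆F , p─q⊆p (img v) P c∈Q , proj₂ (∈-─⁻ (img v) P c∈Q) , c∈C)
      ... | inj₂ (c , c∈P , c∈C) = inj₂ (c , c∈P , p─q⊆p (img v) P , P⊆F c∈P , disjoint-─ P (img v) c∈P , c∈C)

    arrowC : Subset n → Subset n
    arrowC = Core.cover (splitCore H)

    ∣arrowC∣ : ∀ P → ∣ arrowC P ∣ ≤ N₂
    ∣arrowC∣ = Core.∣cover∣ (splitCore H)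

    split-meets : Free E a b H → ∀ P Q → Split H P Q → Meets Q (arrowC P) ⊎ Meets P (arrowC Q)
    split-meets free P Q sp = Core.meets-cover (splitCore H) (⌊⌋⁺ (split? H P Q) sp) (splitCore-empty H free)

    module Centres (𝒞 : Subset n → Subset n) (∣𝒞∣ : ∀ P → ∣ 𝒞 P ∣ ≤ N₂) where

      tails : Fin n → ℕ
      tails c = ∑[ w ∈ tuples n a ] ι (c ∈? 𝒞 (img w))

      ∑-tails : (∑[ c ∈ allFin n ] tails c) ≤ n ^ a * N₂
      ∑-tails = ≤-trans (≤-reflexive (∑-swap (allFin n) (tuples n a) _))
        (∑-tuples-≤ n a (λ w → ≤-trans (≤-reflexive (∑-∈-size (𝒞 (img w)))) (∣𝒞∣ (img w))))

      module Popular (G : ℕ) where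

        -- The bounded set of centres. By `∑-tails` at most G * N₂ vertices have more than n ^ a / G
        -- tails, and all others satisfy the sparseness hypothesis of Loomis-Whitney.
        popular : Subset n
        popular = comprehension (λ c → ¬? (G * tails c ≤? n ^ a))

        ∣popular∣ : 0 < n → ∣ popular ∣ ≤ G * N₂
        ∣popular∣ 0<n = *-cancelʳ-≤ _ _ (n ^ a) {{m^n≢0 n a {{>-nonZero 0<n}}}} (begin
          ∣ popular ∣ * n ^ a                                ≡⟨ cong (_* n ^ a) (∑-∈-size popular) ⟨
          (∑[ c ∈ allFin n ] ι (c ∈? popular)) * n ^ a       ≡⟨ ∑-*ʳ (allFin n) (n ^ a) _ ⟨
          (∑[ c ∈ allFin n ] (ι (c ∈? popular) * n ^ a))     ≤⟨ ∑-mono (allFin n) heavy ⟩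
          (∑[ c ∈ allFin n ] (G * tails c))                  ≡⟨ ∑-*ˡ (allFin n) G tails ⟩
          G * (∑[ c ∈ allFin n ] tails c)                    ≤⟨ *-monoʳ-≤ G ∑-tails ⟩
          G * (n ^ a * N₂)                                   ≡⟨ trans (cong (G *_) (*-comm (n ^ a) N₂)) (sym (*-assoc G N₂ (n ^ a))) ⟩
          G * N₂ * n ^ a ∎)
          where
          open ≤-Reasoning
          heavy : ∀ c → ι (c ∈? popular) * n ^ a ≤ G * tails c
          heavy c = case c ∈? popular of λ where
            (yes p) → ≤-trans (*-monoˡ-≤ (n ^ a) (ι≤1 (c ∈? popular))) (≤-trans (≤-reflexive (*-identityˡ (n ^ a))) (<⇒≤ (≰⇒> (∈-comprehension⁻ _ p))))
            (no ¬p) → ≤-trans (*-monoˡ-≤ (n ^ a) (≤-reflexive (ι-no (c ∈? popular) ¬p))) z≤n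

        -- D has a + 1 entries in order that its deletions are a-tuples. An edge with centre y
        -- contains such a D, as b ≥ 2 leaves at least a + 1 entries besides y.
        Around : Fin n → Vec (Fin n) (suc a) → Set
        Around y D = y ∉ popular × Deletions (λ w → y ∈ 𝒞 (img w)) D

        around? : ∀ y D → Dec (Around y D)
        around? y D = ¬? (y ∈? popular) ×-dec deletions? (λ w → y ∈? 𝒞 (img w)) D

        Centred : Vec (Fin n) r → Fin r → Set
        Centred v i = Around (lookup v i) (Vec.take (suc a) (removeAt v i))

        centred? : ∀ v i → Dec (Centred v i)
        centred? v i = around? (lookup v i) (Vec.take (suc a) (removeAt v i))

        centred : ∀ (v : Vec (Fin n) r) → Edge v → Disjoint (img v) popular → ∀ {c} → c ∈ img v →
          (∀ P → P ⊆ img v → ∣ P ∣ ≡ a → c ∉ P → c ∈ 𝒞 P) → ∃ (Centred v)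
        centred v e dis c∈ central with ∈-img⁻ v c∈
        ... | i , refl = i , dis c∈ , λ j → let sub = subtuple a b' v (edge⇒distinct v e) i j in
            central (img (removeAt (Vec.take (suc a) (removeAt v i)) j)) (proj₁ (proj₂ sub)) (proj₁ sub) (proj₂ (proj₂ sub))

        count-around : ∀ M₁ → (∀ {𝒮 : Vec (Fin n) a → Set} (𝒮? : ∀ v → Dec (𝒮 v)) →
          G * (∑[ v ∈ tuples n a ] ι (𝒮? v)) ≤ n ^ a → M₁ * (∑[ w ∈ tuples n (suc a) ] ι (deletions? 𝒮? w)) ≤ n * (∑[ v ∈ tuples n a ] ι (𝒮? v))) →
          ∀ y → M₁ * (∑[ D ∈ tuples n (suc a) ] ι (around? y D)) ≤ n * tails y
        count-around M₁ lw y = case y ∈? popular of λ where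
          (yes p) → ≤-trans (≤-reflexive (trans (cong (M₁ *_) (∑-zero (λ D → ι-no (around? y D) (λ q → proj₁ q p)))) (*-zeroʳ M₁))) z≤n
          (no ¬p) → ≤-trans (*-monoʳ-≤ M₁ (∑-mono (tuples n (suc a)) (λ D → ι-mono (around? y D) (deletions? (λ w → y ∈? 𝒞 (img w)) D) proj₂)))
            (lw (λ w → y ∈? 𝒞 (img w)) (decidable-stable (G * tails y ≤? n ^ a) (λ q → ¬p (∈-comprehension⁺ _ q))))

        -- Summation over y replaces n * tails y by n ^ suc a * N₂, and the b' entries outside D are
        -- free; the gain M₁ is kept throughout.
        count-centred : ∀ M₁ → (∀ y → M₁ * (∑[ D ∈ tuples n (suc a) ] ι (around? y D)) ≤ n * tails y) →
          ∀ i → M₁ * (∑[ v ∈ tuples n r ] ι (centred? v i)) ≤ N₂ * n ^ ρ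
        count-centred M₁ few i = begin
          M₁ * (∑[ v ∈ tuples n r ] ι (centred? v i))
            ≡⟨ cong (M₁ *_) (∑-insertAt ρ i _) ⟩
          M₁ * (∑[ D ∈ tuples n ρ ] ∑[ y ∈ allFin n ] ι (centred? (insertAt D i y) i))
            ≤⟨ *-monoʳ-≤ M₁ (∑-mono (tuples n ρ) (λ D → ∑-mono (allFin n) (λ y → ι-mono (centred? (insertAt D i y) i) (around? y (Vec.take (suc a) D))
                 (λ p → subst (λ D' → Around y (Vec.take (suc a) D')) (removeAt-insertAt D i y)
                   (subst (λ y' → Around y' (Vec.take (suc a) (removeAt (insertAt D i y) i))) (insertAt-lookup D i y) p))))) ⟩
          M₁ * (∑[ D ∈ tuples n ρ ] ∑[ y ∈ allFin n ] ι (around? y (Vec.take (suc a) D)))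
            ≡⟨ cong (M₁ *_) (∑-swap (tuples n ρ) (allFin n) _) ⟩
          M₁ * (∑[ y ∈ allFin n ] ∑[ D ∈ tuples n ρ ] ι (around? y (Vec.take (suc a) D)))
            ≡⟨ cong (M₁ *_) (∑-cong (allFin n) (λ y → ∑-take n (suc a) b' (λ D → ι (around? y D)))) ⟩
          M₁ * (∑[ y ∈ allFin n ] (n ^ b' * (∑[ D ∈ tuples n (suc a) ] ι (around? y D))))
            ≡⟨ ∑-*ˡ (allFin n) M₁ _ ⟨
          (∑[ y ∈ allFin n ] (M₁ * (n ^ b' * (∑[ D ∈ tuples n (suc a) ] ι (around? y D)))))
            ≤⟨ ∑-mono (allFin n) (λ y → ≤-trans (≤-reflexive (x∙yz≈y∙xz M₁ (n ^ b') _)) (*-monoʳ-≤ (n ^ b') (few y))) ⟩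
          (∑[ y ∈ allFin n ] (n ^ b' * (n * tails y)))
            ≡⟨ trans (∑-*ˡ (allFin n) (n ^ b') _) (cong (n ^ b' *_) (∑-*ˡ (allFin n) n tails)) ⟩
          n ^ b' * (n * (∑[ y ∈ allFin n ] tails y))
            ≤⟨ *-monoʳ-≤ (n ^ b') (*-monoʳ-≤ n ∑-tails) ⟩
          n ^ b' * (n * (n ^ a * N₂))
            ≡⟨ solve 4 (λ p n q k → p :* (n :* (q :* k)) := k :* (n :* q :* p)) refl (n ^ b') n (n ^ a) N₂ ⟩
          N₂ * (n ^ suc a * n ^ b')
            ≡⟨ cong (N₂ *_) (^-distribˡ-+-* n (suc a) b') ⟨
          N₂ * n ^ ρ ∎
          where
          open ≤-Reasoning
          open +-*-Solver using (solve; _:*_; _:=_)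

  concentration′ : ∀ M → ∃ λ K → ∃ λ n₀ → ∀ n → n₀ ≤ n → (H : RGraph n r) (𝒞 : Subset n → Subset n) → (∀ P → ∣ 𝒞 P ∣ ≤ N₂) →
    (∀ P Q → Split H P Q → Meets Q (𝒞 P) ⊎ Meets P (𝒞 Q)) → ∃ λ W → ∣ W ∣ ≤ K ×
    M * (∑[ v ∈ tuples n r ] ι (edge? H v ×-dec disjoint? (img v) W)) ≤ n ^ ρ
  -- The 2 divides the budget between exceptional and centred tuples, r pays for the position of the
  -- centre and N₂ for the sum of the tails.
  concentration′ M with loomis-whitney a (2 * M * (r * N₂))
  ... | G , lw = G * N₂ , suc (2 * M * exceptional-bound (a + b') N₂) , λ n n₀≤n H 𝒞 ∣𝒞∣ meets →
      Centres.Popular.popular H 𝒞 ∣𝒞∣ G , Centres.Popular.∣popular∣ H 𝒞 ∣𝒞∣ G (≤-trans (s≤s z≤n) n₀≤n) , bound n n₀≤n H 𝒞 ∣𝒞∣ meets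
    where
    M₁ = 2 * M * (r * N₂)
    bound : ∀ n → suc (2 * M * exceptional-bound (a + b') N₂) ≤ n → (H : RGraph n r) (𝒞 : Subset n → Subset n) (∣𝒞∣ : ∀ P → ∣ 𝒞 P ∣ ≤ N₂) →
      (∀ P Q → Split H P Q → Meets Q (𝒞 P) ⊎ Meets P (𝒞 Q)) →
      M * (∑[ v ∈ tuples n r ] ι (edge? H v ×-dec disjoint? (img v) (Centres.Popular.popular H 𝒞 ∣𝒞∣ G))) ≤ n ^ ρ
    bound n n₀≤n H 𝒞 ∣𝒞∣ meets = begin
      M * (∑[ v ∈ Ts ] ι (edge? H v ×-dec disjoint? (img v) popular))
        ≤⟨ *-monoʳ-≤ M (∑-mono Ts classify) ⟩
      M * (∑[ v ∈ Ts ] (ι (exc? v) + (∑[ i ∈ allFin r ] ι (centred? v i))))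
        ≡⟨ cong (M *_) (∑-+ Ts _ _) ⟩
      M * ((∑[ v ∈ Ts ] ι (exc? v)) + (∑[ v ∈ Ts ] ∑[ i ∈ allFin r ] ι (centred? v i)))
        ≤⟨ halves M {∑[ v ∈ Ts ] ι (exc? v)} {∑[ v ∈ Ts ] ∑[ i ∈ allFin r ] ι (centred? v i)} {n ^ ρ} rare-exceptional rare-centred ⟩
      n ^ ρ ∎
      where
      open ≤-Reasoning
      open Centres.Popular H 𝒞 ∣𝒞∣ G
      Ts = tuples n r
      exc? = exceptional? 𝒞 ∣𝒞∣
      find-centre : ∀ v → Edge H v → Disjoint (img v) popular → ¬ Exceptional 𝒞 ∣𝒞∣ v → ∃ (Centred v)
      find-centre v e dis ¬ex = centred v e dis (proj₁ (proj₂ centre)) (proj₂ (proj₂ centre))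
        where
        centre : ∃ λ c → c ∈ img v × (∀ P → P ⊆ img v → ∣ P ∣ ≡ a → c ∉ P → c ∈ 𝒞 P)
        centre = edge-centre H 𝒞 ∣𝒞∣ meets v e ¬ex
      cases : ∀ v → Edge H v → Disjoint (img v) popular → Dec (Exceptional 𝒞 ∣𝒞∣ v) →
        1 ≤ ι (exc? v) + (∑[ i ∈ allFin r ] ι (centred? v i))
      cases v e dis (yes ex) = ≤-trans (ι-≥1 (exc? v) ex) (m≤m+n _ _)
      cases v e dis (no ¬ex) = ≤-trans (∑-≥1 (λ i → ι (centred? v i)) (∈-allFin (proj₁ c)) (ι-≥1 (centred? v (proj₁ c)) (proj₂ c))) (m≤n+m _ (ι (exc? v)))
        where
        c : ∃ (Centred v)
        c = find-centre v e dis ¬ex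
      classify : ∀ v → ι (edge? H v ×-dec disjoint? (img v) popular) ≤ ι (exc? v) + (∑[ i ∈ allFin r ] ι (centred? v i))
      classify v = ι-≤ (edge? H v ×-dec disjoint? (img v) popular) (λ p → cases v (proj₁ p) (proj₂ p) (exc? v))
      rare-exceptional : 2 * M * (∑[ v ∈ Ts ] ι (exc? v)) ≤ n ^ ρ
      rare-exceptional = lower-order (2 * M) {K = exceptional-bound (a + b') N₂} {n = n} {k = a + b'}
        (count-exceptional 𝒞 ∣𝒞∣) (≤-trans (n≤1+n _) n₀≤n)
      centred-bound : r * N₂ * (2 * M * (∑[ v ∈ Ts ] ∑[ i ∈ allFin r ] ι (centred? v i))) ≤ r * N₂ * n ^ ρ
      centred-bound = begin
        r * N₂ * (2 * M * (∑[ v ∈ Ts ] ∑[ i ∈ allFin r ] ι (centred? v i)))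
          ≡⟨ trans (sym (*-assoc (r * N₂) (2 * M) _)) (cong₂ _*_ (*-comm (r * N₂) (2 * M)) (∑-swap Ts (allFin r) _)) ⟩
        M₁ * (∑[ i ∈ allFin r ] ∑[ v ∈ Ts ] ι (centred? v i))
          ≡⟨ ∑-*ˡ (allFin r) M₁ _ ⟨
        (∑[ i ∈ allFin r ] (M₁ * (∑[ v ∈ Ts ] ι (centred? v i))))
          ≤⟨ ∑-mono (allFin r) (count-centred M₁ (count-around M₁ (lw n))) ⟩
        (∑[ i ∈ allFin r ] (N₂ * n ^ ρ))
          ≡⟨ trans (∑-allFin-const r _) (sym (*-assoc r N₂ _)) ⟩
        r * N₂ * n ^ ρ ∎
      rare-centred : 2 * M * (∑[ v ∈ Ts ] ∑[ i ∈ allFin r ] ι (centred? v i)) ≤ n ^ ρ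
      rare-centred = *-cancelˡ-≤ (r * N₂) {{m*n≢0 r N₂ {{_}} {{>-nonZero 0<N₂}}}} centred-bound

  concentration : ∀ M → ∃ λ K → ∃ λ n₀ → ∀ n → n₀ ≤ n → (H : RGraph n r) → Free E a b H → ∃ λ W → ∣ W ∣ ≤ K ×
    M * (∑[ v ∈ tuples n r ] ι (edge? H v ×-dec disjoint? (img v) W)) ≤ n ^ ρ
  concentration M = let (K , n₀ , f) = concentration′ M in
    K , n₀ , λ n n₀≤n H free → f n n₀≤n H (arrowC H) (∣arrowC∣ H) (split-meets H free)

  -- Stability

  a≤ρ : a ≤ ρ
  a≤ρ = ≤-trans (n≤1+n a) (m≤m+n (suc a) b')

  t'≤N : t' ≤ N
  t'≤N = ≤-trans (≤-trans (n≤1+n t') (m≤n+m t r)) (≤-trans (m≤m+n (r + t) _) large)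

  opaque
    positions : ∃ λ (S : Subset ρ) → ∣ S ∣ ≡ a
    positions = let (S , _ , _ , e) = interpolate ⊥ ⊤ a ⊥⊆ (∣⊥∣≤ ρ) (≤-trans a≤ρ (≤-reflexive (sym (∣⊤∣≡n ρ)))) in S , e

  ∣∁-positions∣ : ∀ (S : Subset ρ) → ∣ S ∣ ≡ a → ∣ ∁ S ∣ ≡ suc b'
  ∣∁-positions∣ S e = trans (∣∁p∣≡n∸∣p∣ S) (trans (cong (ρ ∸_) e) (trans (cong (_∸ a) (sym (+-suc a b'))) (m+n∸m≡n a (suc b'))))

  module _ {n : ℕ} (H : RGraph n r) where

    LinkedTuple : Subset n → Vec (Fin n) ρ → Set
    LinkedTuple X D = ∀ l → l ∈ X → Edge H (l ∷ D)

    linkedTuple? : ∀ X D → Dec (LinkedTuple X D)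
    linkedTuple? X D = Fin.all? (λ l → (l ∈? X) →-dec edge? H (l ∷ D))

    linkedTuple⇒linked : ∀ {X} → Nonempty X → ∀ {D} → LinkedTuple X D → ∀ S → ∣ S ∣ ≡ a → Linked H X (imgOn S D) (imgOn (∁ S) D)
    linkedTuple⇒linked {X} (l₀ , l₀∈) {D} linked S ∣S∣ =
        trans (∣imgOn∣ S D dD) ∣S∣ , trans (∣imgOn∣ (∁ S) D dD) (∣∁-positions∣ S ∣S∣) , imgOn-disjoint-∁ S D dD ,
        (λ p q → avoid q (imgOn⊆img S D p)) , (λ p q → avoid q (imgOn⊆img (∁ S) D p)) ,
        λ l l∈ → trans (cong (λ P → edge H (⁅ l ⁆ ∪ P)) (imgOn-∪-∁ S D)) (linked l l∈)
      where
      dD : Distinct D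
      dD = proj₂ (distinct-∷⁻ l₀ D (edge⇒distinct H (l₀ ∷ D) (linked l₀ l₀∈)))
      avoid : ∀ {y} → y ∈ X → y ∉ img D
      avoid {y} y∈ = proj₁ (distinct-∷⁻ y D (edge⇒distinct H (y ∷ D) (linked y y∈)))

    linkCover : Subset n → Subset n → Subset n
    linkCover X = Core.cover (linkCore H X)

    ∣linkCover∣ : ∀ X P → ∣ linkCover X P ∣ ≤ N₂
    ∣linkCover∣ X = Core.∣cover∣ (linkCore H X)

    meets⇒arrow : ∀ {m} (𝒞 : Subset n → Subset n) (S : Subset m) (D : Vec (Fin n) m) →
      Meets (imgOn (∁ S) D) (𝒞 (imgOn S D)) ⊎ Meets (imgOn S D) (𝒞 (imgOn (∁ S) D)) → ∃ (ArrowAt 𝒞 S D)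
    meets⇒arrow 𝒞 S D (inj₁ (y , y∈ , y∈C)) with ∈-imgOn⁻ (∁ S) D y∈
    ... | c , c∈ , refl = c , subst (λ S' → lookup D c ∈ 𝒞 (imgOn S' D)) (sym (opposite-∉ S (x∈∁p⇒x∉p c∈))) y∈C
    meets⇒arrow 𝒞 S D (inj₂ (y , y∈ , y∈C)) with ∈-imgOn⁻ S D y∈
    ... | c , c∈ , refl = c , subst (λ S' → lookup D c ∈ 𝒞 (imgOn S' D)) (sym (opposite-∈ S c∈)) y∈C

    -- A linked pair removed by the peeling is covered, and a cover that meets the other side is an
    -- arrow. So for a fixed X these tuples are fewer by a factor of order n.
    outside-core⇒arrow : ∀ {X} → Nonempty X → ∀ {D} → LinkedTuple X D → ∀ S → ∣ S ∣ ≡ a →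
      ¬ InCore H X (imgOn S D) (imgOn (∁ S) D) → ∃ (ArrowAt (linkCover X) S D)
    outside-core⇒arrow {X} ne {D} linked S ∣S∣ ¬core = meets⇒arrow (linkCover X) S D
      (Core.meets-cover (linkCore H X) {P = imgOn S D} {Q = imgOn (∁ S) D}
        (⌊⌋⁺ (linked? H X (imgOn S D) (imgOn (∁ S) D)) (linkedTuple⇒linked ne linked S ∣S∣)) (¬-not ¬core))

    -- A linked pair (P , Z) and a vertex w ∈ X ∖ Y give the pendant edge P ∪ ({w} ∪ Z) away from Y.
    pendant-absurd : Free E a b H → ∀ {Y Y' X P Z w} → Y ⊆ Y' → ∣ Y ∣ ≡ t' → Attached H Y' P → Linked H X P Z → w ∈ X → w ∉ Y →
      Disjoint Z Y → Data.Empty.⊥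
    pendant-absurd free {Y} {Y'} {X} {P} {Z} {w} Y⊆ ∣Y∣ att (_ , ∣Z∣ , PZ , PX , ZX , edges) w∈ w∉Y ZY =
      case trans (sym (trans (cong (edge H) rearrange) (edges w w∈)))
        (attached-free H free Y⊆ ∣Y∣ P (⁅ w ⁆ ∪ Z) att
          (trans (∣⁅⁆∪∣ w Z (λ p → ZX p w∈)) (cong suc ∣Z∣))
          (disjoint-∪ʳ ⁅ w ⁆ Z (disjoint-sym (disjoint-⁅⁆ (λ p → PX p w∈))) PZ)
          (disjoint-sym (disjoint-∪ʳ ⁅ w ⁆ Z (disjoint-sym (disjoint-⁅⁆ w∉Y)) (disjoint-sym ZY)))) of λ ()
      where
      rearrange : P ∪ (⁅ w ⁆ ∪ Z) ≡ ⁅ w ⁆ ∪ (P ∪ Z)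
      rearrange = trans (sym (∪-assoc P ⁅ w ⁆ Z)) (trans (cong (_∪ Z) (∪-comm P ⁅ w ⁆)) (∪-assoc ⁅ w ⁆ P Z))

    -- X has one vertex more than the parts V_j other than that of the leaf can use; the surplus
    -- vertex w makes the pendant edge.
    core-empty : Free E a b H → ∀ {X} → ∣ X ∣ ≡ t → ∀ {P Z} → ¬ InCore H X P Z
    core-empty free {X} ∣X∣ {P} {Z} c = pendant-absurd free {X - w} {X} {X} {P} {Z} {w} (p─q⊆p X ⁅ w ⁆) (suc-injective (trans (∣-∣ w∈) ∣X∣))
        (inCore⇒attached H X c) linked w∈ (λ p → proj₂ (∈-─⁻ X ⁅ w ⁆ p) (x∈⁅x⁆ w))
        (λ p q → proj₁ (proj₂ (proj₂ (proj₂ (proj₂ linked)))) p (p─q⊆p X ⁅ w ⁆ q))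
      where
      some : Nonempty X
      some = nonempty-size X (≤-trans (s≤s z≤n) (≤-reflexive (sym ∣X∣)))
      w = proj₁ some
      w∈ : w ∈ X
      w∈ = proj₂ some
      linked : Linked H X P Z
      linked = inCore⇒linked H X c

    -- A vertex w of X' outside X would give a pendant edge at P, whose Z is found in the row of P
    -- for X' and away from X, while the rest of T is embedded with X.
    core-unique : Free E a b H → ∀ {X X'} → ∣ X ∣ ≡ t' → ∣ X' ∣ ≡ t' → ∀ {P Z Z'} → InCore H X P Z → InCore H X' P Z' → X ≡ X'
    core-unique free {X} {X'} ∣X∣ ∣X'∣ {P} {Z} {Z'} c c' = go (nonempty? (X' ─ X))
      where
      go : Dec (Nonempty (X' ─ X)) → X ≡ X'
      go (no empty) = sym (⊆-antisym X'⊆X (⊆-size⇒⊇ X'⊆X (≤-reflexive (trans ∣X∣ (sym ∣X'∣)))))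
        where
        X'⊆X : X' ⊆ X
        X'⊆X {w} w∈ with w ∈? X
        ... | yes p = p
        ... | no w∉ = ⊥-elim (empty (w , x∈p∧x∉q⇒x∈p─q w∈ w∉))
      go (yes (w , w∈)) = ⊥-elim (pendant-absurd free {X} {X} {X'} {P} {proj₁ away} {w} id ∣X∣ (inCore⇒attached H X c)
          (inCore⇒linked H X' (proj₁ (proj₂ away))) (proj₁ (∈-─⁻ X' X w∈)) (proj₂ (∈-─⁻ X' X w∈)) (proj₂ (proj₂ away)))
        where
        away : ∃ λ Z → InCore H X' P Z × Disjoint Z X
        away = Core.rich-row (linkCore H X') c' X (≤-trans (≤-reflexive ∣X∣) t'≤N)

    inCore? : ∀ X P Z → Dec (InCore H X P Z)
    inCore? X P Z = Core.core (linkCore H X) P Z Bool.≟ true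

    module Types (W : Subset n) where

      type : Vec (Fin n) ρ → Subset n
      type D = comprehension (λ w → (w ∈? W) ×-dec edge? H (w ∷ D))

      ∈-type⁻ : ∀ D {w} → w ∈ type D → w ∈ W × Edge H (w ∷ D)
      ∈-type⁻ D = ∈-comprehension⁻ (λ w → (w ∈? W) ×-dec edge? H (w ∷ D))

      ∈-type⁺ : ∀ D {w} → w ∈ W × Edge H (w ∷ D) → w ∈ type D
      ∈-type⁺ D = ∈-comprehension⁺ (λ w → (w ∈? W) ×-dec edge? H (w ∷ D))

      -- A tuple that is not bad is in the core for every splitting S, not just for one: S will
      -- later be chosen according to the entry that changes.
      High Low Scattered Bad : Vec (Fin n) ρ → Set
      High D = t ≤ ∣ type D ∣
      Low D = ∣ type D ∣ < t'
      Scattered D = ∣ type D ∣ ≡ t' × ∃ λ S → ∣ S ∣ ≡ a × ¬ InCore H (type D) (imgOn S D) (imgOn (∁ S) D)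
      Bad D = High D ⊎ Low D ⊎ Scattered D

      high? : ∀ D → Dec (High D)
      high? D = t ≤? ∣ type D ∣

      low? : ∀ D → Dec (Low D)
      low? D = ∣ type D ∣ <? t'

      scattered? : ∀ D → Dec (Scattered D)
      scattered? D = (∣ type D ∣ ≟ t') ×-dec anySubset? (λ S → (∣ S ∣ ≟ a) ×-dec ¬? (inCore? (type D) (imgOn S D) (imgOn (∁ S) D)))

      bad? : ∀ D → Dec (Bad D)
      bad? D = high? D ⊎-dec (low? D ⊎-dec scattered? D)

      ¬bad⇒size : ∀ D → ¬ Bad D → ∣ type D ∣ ≡ t'
      ¬bad⇒size D good = ≤-antisym (≤-pred (≰⇒> (good ∘ inj₁))) (≮⇒≥ (good ∘ inj₂ ∘ inj₁))

      ¬bad⇒core : ∀ D → ¬ Bad D → ∀ S → ∣ S ∣ ≡ a → InCore H (type D) (imgOn S D) (imgOn (∁ S) D)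
      ¬bad⇒core D good S ∣S∣ = decidable-stable (inCore? (type D) (imgOn S D) (imgOn (∁ S) D))
        (λ ¬c → good (inj₂ (inj₂ (¬bad⇒size D good , S , ∣S∣ , ¬c))))

      -- A union bound over the subsets of W: arrows are counted for a fixed X, whereas `type D`
      -- varies with D. It requires |W| to be bounded.
      over-types : ∀ (g : Subset n → Vec (Fin n) ρ → ℕ) {κ} → (∀ X → (∑[ D ∈ tuples n ρ ] g X D) ≤ κ) →
        (∑[ D ∈ tuples n ρ ] ∑[ X ∈ allSubsets n ] (ι (X ⊆? W) * g X D)) ≤ 2 ^ ∣ W ∣ * κ
      over-types g {κ} bound = begin
        (∑[ D ∈ tuples n ρ ] ∑[ X ∈ allSubsets n ] (ι (X ⊆? W) * g X D))
          ≡⟨ ∑-swap (tuples n ρ) (allSubsets n) _ ⟩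
        (∑[ X ∈ allSubsets n ] ∑[ D ∈ tuples n ρ ] (ι (X ⊆? W) * g X D))
          ≤⟨ ∑-mono (allSubsets n) (λ X → ≤-trans (≤-reflexive (∑-*ˡ (tuples n ρ) (ι (X ⊆? W)) (g X))) (*-monoʳ-≤ (ι (X ⊆? W)) (bound X))) ⟩
        (∑[ X ∈ allSubsets n ] (ι (X ⊆? W) * κ))
          ≡⟨ trans (∑-*ʳ (allSubsets n) κ _) (cong (_* κ) (∑-subsets-of W)) ⟩
        2 ^ ∣ W ∣ * κ ∎
        where open ≤-Reasoning

      κ₁ : ℕ
      κ₁ = ρ * (N₂ * n ^ (a + b'))

      over-types-≥1 : ∀ (g : Subset n → ℕ) {X} → X ⊆ W → 1 ≤ g X → 1 ≤ ∑[ X ∈ allSubsets n ] (ι (X ⊆? W) * g X)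
      over-types-≥1 g {X} X⊆W le = ∑-≥1 (λ X → ι (X ⊆? W) * g X) (∈-allSubsets X)
        (*-mono-≤ (ι-≥1 (X ⊆? W) X⊆W) le)

      -- The core of a t-set is empty, so a single splitting, at the fixed positions S₀, already
      -- produces an arrow.
      count-high : Free E a b H → (∑[ D ∈ tuples n ρ ] ι (high? D)) ≤ 2 ^ ∣ W ∣ * κ₁
      count-high free = ≤-trans (∑-mono (tuples n ρ) (λ D → ι-≤ (high? D) (witness D)))
        (over-types (λ X D → ι (arrow? (linkCover X) S₀ D)) (λ X → count-arrow (linkCover X) (∣linkCover∣ X) S₀))
        where
        S₀ = proj₁ positions
        witness : ∀ D → High D → 1 ≤ ∑[ X ∈ allSubsets n ] (ι (X ⊆? W) * ι (arrow? (linkCover X) S₀ D))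
        witness D high with interpolate ⊥ (type D) t ⊥⊆ (∣⊥∣≤ n) high
        ... | X , _ , X⊆ , ∣X∣ = over-types-≥1 (λ X → ι (arrow? (linkCover X) S₀ D)) (λ p → proj₁ (∈-type⁻ D (X⊆ p)))
              (≤-reflexive (sym (ι-yes (arrow? (linkCover X) S₀ D)
                (outside-core⇒arrow (nonempty-size X (≤-trans (s≤s z≤n) (≤-reflexive (sym ∣X∣)))) (λ l l∈ → proj₂ (∈-type⁻ D (X⊆ l∈)))
                  S₀ (proj₂ positions) (core-empty free ∣X∣)))))

      count-scattered : (∑[ D ∈ tuples n ρ ] ι (scattered? D)) ≤ 2 ^ ∣ W ∣ * (2 ^ ρ * κ₁)
      count-scattered = ≤-trans (∑-mono (tuples n ρ) (λ D → ι-≤ (scattered? D) (witness D)))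
        (over-types (λ X D → ∑[ S ∈ allSubsets ρ ] ι (arrow? (linkCover X) S D)) (λ X →
          ≤-trans (≤-reflexive (∑-swap (tuples n ρ) (allSubsets ρ) _))
            (≤-trans (∑-≤const (allSubsets ρ) (λ S → count-arrow (linkCover X) (∣linkCover∣ X) S))
              (≤-reflexive (cong (_* κ₁) (length-allSubsets ρ))))))
        where
        witness : ∀ D → Scattered D → 1 ≤ ∑[ X ∈ allSubsets n ] (ι (X ⊆? W) * (∑[ S ∈ allSubsets ρ ] ι (arrow? (linkCover X) S D)))
        witness D (size , S , ∣S∣ , ¬core) = over-types-≥1 (λ X → ∑[ S ∈ allSubsets ρ ] ι (arrow? (linkCover X) S D)) (λ p → proj₁ (∈-type⁻ D p))
          (∑-≥1 (λ S → ι (arrow? (linkCover (type D)) S D)) (∈-allSubsets S) (≤-reflexive (sym (ι-yes (arrow? (linkCover (type D)) S D)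
            (outside-core⇒arrow (nonempty-size (type D) (≤-trans 1≤t' (≤-reflexive (sym size)))) (λ l l∈ → proj₂ (∈-type⁻ D l∈)) S ∣S∣ ¬core)))))

      -- Deleting an entry w ∈ W from an edge leaves a D with w ∈ type D. Edges with several
      -- vertices in W are counted repeatedly, hence only an inequality.
      count-edges : (∑[ v ∈ tuples n r ] ι (edge? H v)) ≤
        (∑[ v ∈ tuples n r ] ι (edge? H v ×-dec disjoint? (img v) W)) + r * (∑[ D ∈ tuples n ρ ] ∣ type D ∣)
      count-edges = begin
        (∑[ v ∈ tuples n r ] ι (edge? H v))
          ≤⟨ ∑-mono (tuples n r) classify ⟩
        (∑[ v ∈ tuples n r ] (ι (edge? H v ×-dec disjoint? (img v) W) + (∑[ i ∈ allFin r ] ι (through? v i))))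
          ≡⟨ ∑-+ (tuples n r) _ _ ⟩
        (∑[ v ∈ tuples n r ] ι (edge? H v ×-dec disjoint? (img v) W)) + (∑[ v ∈ tuples n r ] ∑[ i ∈ allFin r ] ι (through? v i))
          ≡⟨ cong ((∑[ v ∈ tuples n r ] ι (edge? H v ×-dec disjoint? (img v) W)) +_)
               (trans (∑-swap (tuples n r) (allFin r) _) (trans (∑-cong (allFin r) at) (∑-allFin-const r _))) ⟩
        (∑[ v ∈ tuples n r ] ι (edge? H v ×-dec disjoint? (img v) W)) + r * (∑[ D ∈ tuples n ρ ] ∣ type D ∣) ∎
        where
        open ≤-Reasoning
        through? : ∀ (v : Vec (Fin n) r) i → Dec (lookup v i ∈ W × Edge H v)
        through? v i = (lookup v i ∈? W) ×-dec edge? H v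
        cases : ∀ (v : Vec (Fin n) r) → Edge H v → Dec (Meets (img v) W) → 1 ≤ ι (edge? H v ×-dec disjoint? (img v) W) + (∑[ i ∈ allFin r ] ι (through? v i))
        cases v e (no ¬m) = ≤-trans (ι-≥1 (edge? H v ×-dec disjoint? (img v) W) (e , ¬meets⇒disjoint ¬m)) (m≤m+n _ _)
        cases v e (yes (y , y∈ , y∈W)) with ∈-img⁻ v y∈
        ... | i , refl = ≤-trans (∑-≥1 (λ i → ι (through? v i)) (∈-allFin i) (ι-≥1 (through? v i) (y∈W , e))) (m≤n+m _ _)
        classify : ∀ v → ι (edge? H v) ≤ ι (edge? H v ×-dec disjoint? (img v) W) + (∑[ i ∈ allFin r ] ι (through? v i))
        classify v = ι-≤ (edge? H v) (λ e → cases v e (meets? (img v) W))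
        at : ∀ i → (∑[ v ∈ tuples n r ] ι (through? v i)) ≡ (∑[ D ∈ tuples n ρ ] ∣ type D ∣)
        at i = trans (∑-insertAt ρ i _) (∑-cong (tuples n ρ) (λ D → trans (∑-cong (allFin n) (λ y →
          ι-cong (through? (insertAt D i y) i) (y ∈? type D)
            (λ (p , q) → ∈-type⁺ D (subst (_∈ W) (insertAt-lookup D i y) p , trans (cong (edge H) (sym (img-insertAt D i y))) q))
            (λ p → subst (_∈ W) (sym (insertAt-lookup D i y)) (proj₁ (∈-type⁻ D p)) , trans (cong (edge H) (img-insertAt D i y)) (proj₂ (∈-type⁻ D p)))))
          (∑-∈-size (type D))))

      -- A low D falls short of t' by at least one, and a high D exceeds it by at most |W|.
      balance : (∑[ D ∈ tuples n ρ ] ∣ type D ∣) + (∑[ D ∈ tuples n ρ ] ι (low? D)) ≤ t' * n ^ ρ + ∣ W ∣ * (∑[ D ∈ tuples n ρ ] ι (high? D))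
      balance = begin
        (∑[ D ∈ tuples n ρ ] ∣ type D ∣) + (∑[ D ∈ tuples n ρ ] ι (low? D))
          ≡⟨ ∑-+ (tuples n ρ) _ _ ⟨
        (∑[ D ∈ tuples n ρ ] (∣ type D ∣ + ι (low? D)))
          ≤⟨ ∑-mono (tuples n ρ) (λ D → pointwise D (low? D) (high? D)) ⟩
        (∑[ D ∈ tuples n ρ ] (t' + ∣ W ∣ * ι (high? D)))
          ≡⟨ trans (∑-+ (tuples n ρ) _ _) (cong₂ _+_ (trans (∑-tuples-const n ρ t') (*-comm (n ^ ρ) t')) (∑-*ˡ (tuples n ρ) ∣ W ∣ _)) ⟩
        t' * n ^ ρ + ∣ W ∣ * (∑[ D ∈ tuples n ρ ] ι (high? D)) ∎
        where
        open ≤-Reasoning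
        pointwise : ∀ D → Dec (Low D) → Dec (High D) → ∣ type D ∣ + ι (low? D) ≤ t' + ∣ W ∣ * ι (high? D)
        pointwise D (yes low) _ = ≤-trans (≤-trans (+-monoʳ-≤ _ (ι≤1 (low? D))) (≤-trans (≤-reflexive (+-comm _ 1)) low)) (m≤m+n t' _)
        pointwise D (no ¬low) (no ¬high) = ≤-trans (≤-reflexive (trans (cong (∣ type D ∣ +_) (ι-no (low? D) ¬low)) (+-identityʳ _)))
          (≤-trans (≤-pred (≰⇒> ¬high)) (m≤m+n t' _))
        pointwise D (no ¬low) (yes high) = ≤-trans (≤-reflexive (trans (cong (∣ type D ∣ +_) (ι-no (low? D) ¬low)) (+-identityʳ _)))
          (≤-trans (p⊆q⇒∣p∣≤∣q∣ (λ p → proj₁ (∈-type⁻ D p))) (≤-trans (≤-reflexive (sym (trans (cong (∣ W ∣ *_) (ι-yes (high? D) high)) (*-identityʳ _)))) (m≤n+m _ t')))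

  module _ {n : ℕ} (H : RGraph n r) where

    -- γ absorbs the lower order terms.
    Dense : Set
    Dense = ∃ λ γ → n * γ ≤ ρ * (ρ + t') * n ^ ρ × r * (t' * n ^ ρ) ≤ (∑[ v ∈ tuples n r ] ι (edge? H v)) + r * (t' * γ)

  -- The coefficient of n ^ (r - 2) in t' * γ + (|W| * Hi + (Hi + Sc)), with K bounding |W|.
  bad-bound : ℕ → ℕ
  bad-bound K = t' * (ρ * (ρ + t')) + (K * (2 ^ K * (ρ * N₂)) + (2 ^ K * (ρ * N₂) + 2 ^ K * (2 ^ ρ * (ρ * N₂))))

  few-bad : ∀ M → ∃ λ n₀ → ∀ n → n₀ ≤ n → (H : RGraph n r) → Free E a b H → Dense H →
    ∃ λ W → M * (∑[ D ∈ tuples n ρ ] ι (Types.bad? H W D)) ≤ n ^ ρ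
  few-bad M = from-concentration (concentration (2 * M))
    where
    bound : ∀ K n → suc (2 * M * bad-bound K) ≤ n → (H : RGraph n r) → Free E a b H → Dense H →
      (∃ λ W → ∣ W ∣ ≤ K × 2 * M * (∑[ v ∈ tuples n r ] ι (edge? H v ×-dec disjoint? (img v) W)) ≤ n ^ ρ) →
      ∃ λ W → M * (∑[ D ∈ tuples n ρ ] ι (Types.bad? H W D)) ≤ n ^ ρ
    bound K n n₀≤n H free (γ , γ≤ , dense) (W , ∣W∣ , rare) = W , (begin
      M * (∑[ D ∈ Ts ] ι (bad? D))
        ≤⟨ *-monoʳ-≤ M (≤-trans (∑-mono Ts split) (≤-reflexive (trans (∑-+ Ts _ _) (cong (Hi +_) (∑-+ Ts _ _))))) ⟩
      M * (Hi + (Lo + Sc))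
        ≤⟨ *-monoʳ-≤ M bad≤ ⟩
      M * (ε + rest)
        ≤⟨ halves M {ε} {rest} {n ^ ρ} rare (lower-order (2 * M) {K = bad-bound K} {n = n} {k = k} rest≤ (≤-trans (n≤1+n _) n₀≤n)) ⟩
      n ^ ρ ∎)
      where
      open ≤-Reasoning
      open Types H W
      Ts = tuples n ρ
      k = a + b'
      ε = ∑[ v ∈ tuples n r ] ι (edge? H v ×-dec disjoint? (img v) W)
      Hi = ∑[ D ∈ Ts ] ι (high? D)
      Lo = ∑[ D ∈ Ts ] ι (low? D)
      Sc = ∑[ D ∈ Ts ] ι (scattered? D)
      rest = t' * γ + (∣ W ∣ * Hi + (Hi + Sc))
      split : ∀ D → ι (bad? D) ≤ ι (high? D) + (ι (low? D) + ι (scattered? D))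
      split D = ι-≤ (bad? D) λ where
        (inj₁ h) → ≤-trans (ι-≥1 (high? D) h) (m≤m+n _ _)
        (inj₂ (inj₁ l)) → ≤-trans (≤-trans (ι-≥1 (low? D) l) (m≤m+n _ (ι (scattered? D)))) (m≤n+m _ (ι (high? D)))
        (inj₂ (inj₂ s)) → ≤-trans (≤-trans (ι-≥1 (scattered? D) s) (m≤n+m _ (ι (low? D)))) (m≤n+m _ (ι (high? D)))
      bad≤ : Hi + (Lo + Sc) ≤ ε + rest
      bad≤ = deficit r {t'} {n ^ ρ} {∑[ v ∈ tuples n r ] ι (edge? H v)} {γ} {ε} {∑[ D ∈ Ts ] ∣ type D ∣} {Lo} {∣ W ∣} {Hi} {Sc} dense count-edges balance
      γ-bound : γ ≤ ρ * (ρ + t') * n ^ k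
      γ-bound = *-cancelˡ-≤ n {{>-nonZero (≤-trans (s≤s z≤n) n₀≤n)}} (≤-trans γ≤ (≤-reflexive (x∙yz≈y∙xz (ρ * (ρ + t')) n (n ^ k))))
      2^≤ : 2 ^ ∣ W ∣ ≤ 2 ^ K
      2^≤ = ^-monoʳ-≤ 2 ∣W∣
      Hi≤ : Hi ≤ 2 ^ K * κ₁
      Hi≤ = ≤-trans (count-high free) (*-monoˡ-≤ κ₁ 2^≤)
      Sc≤ : Sc ≤ 2 ^ K * (2 ^ ρ * κ₁)
      Sc≤ = ≤-trans count-scattered (*-monoˡ-≤ (2 ^ ρ * κ₁) 2^≤)
      regroup : ∀ t κ ν K A q N B → t * (κ * ν) + (K * (A * (q * (N * ν))) + (A * (q * (N * ν)) + A * (B * (q * (N * ν)))))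
        ≡ (t * κ + (K * (A * (q * N)) + (A * (q * N) + A * (B * (q * N))))) * ν
      regroup = solve 8 (λ t κ ν K A q N B → t :* (κ :* ν) :+ (K :* (A :* (q :* (N :* ν))) :+ (A :* (q :* (N :* ν)) :+ A :* (B :* (q :* (N :* ν)))))
        := (t :* κ :+ (K :* (A :* (q :* N)) :+ (A :* (q :* N) :+ A :* (B :* (q :* N))))) :* ν) refl
        where open +-*-Solver using (solve; _:*_; _:+_; _:=_)
      rest≤ : rest ≤ bad-bound K * n ^ k
      rest≤ = ≤-trans (+-mono-≤ (*-monoʳ-≤ t' γ-bound) (+-mono-≤ (*-mono-≤ ∣W∣ Hi≤) (+-mono-≤ Hi≤ Sc≤)))
        (≤-reflexive (regroup t' (ρ * (ρ + t')) (n ^ k) K (2 ^ K) ρ N₂ (2 ^ ρ)))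
    from-concentration :
      (∃ λ K → ∃ λ n₁ → ∀ n → n₁ ≤ n → (H : RGraph n r) → Free E a b H → ∃ λ W → ∣ W ∣ ≤ K ×
        2 * M * (∑[ v ∈ tuples n r ] ι (edge? H v ×-dec disjoint? (img v) W)) ≤ n ^ ρ) →
      ∃ λ n₀ → ∀ n → n₀ ≤ n → (H : RGraph n r) → Free E a b H → Dense H →
      ∃ λ W → M * (∑[ D ∈ tuples n ρ ] ι (Types.bad? H W D)) ≤ n ^ ρ
    from-concentration (K , n₁ , conc) = n₁ + suc (2 * M * bad-bound K) , λ n n₀≤n H free dense →
      bound K n (≤-trans (m≤n+m _ n₁) n₀≤n) H free dense (conc n (≤-trans (m≤m+n n₁ _) n₀≤n) H free)

  stability : ∀ M → ∃ λ n₀ → ∀ n → n₀ ≤ n → (H : RGraph n r) → Free E a b H → Dense H →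
    ∃ λ L → ∣ L ∣ ≡ t' × M * (∑[ D ∈ tuples n ρ ] ι (¬? (linkedTuple? H L D))) ≤ n ^ ρ
  -- `suc ρ` is the number of hybrids between two tuples in `almost-constant`, and the 2 makes the
  -- inequality strict, as required there.
  stability M = from-few-bad (few-bad ((2 + M) * suc ρ))
    where
    bound : ∀ n → 0 < n → (H : RGraph n r) → Free E a b H → ∀ W → (2 + M) * suc ρ * (∑[ D ∈ tuples n ρ ] ι (Types.bad? H W D)) ≤ n ^ ρ →
      ∃ λ L → ∣ L ∣ ≡ t' × M * (∑[ D ∈ tuples n ρ ] ι (¬? (linkedTuple? H L D))) ≤ n ^ ρ
    bound n 0<n H free W rare = type x₀ , ¬bad⇒size x₀ good , final
      where
      open Types H W
      β = ∑[ D ∈ tuples n ρ ] ι (bad? D)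
      rare′ : (2 + M) * (suc ρ * β) ≤ n ^ ρ
      rare′ = ≤-trans (≤-reflexive (sym (*-assoc (2 + M) (suc ρ) β))) rare
      few′ : suc ρ * β < n ^ ρ
      few′ = strictly-small M (suc ρ * β) (m^n>0 n {{>-nonZero 0<n}} ρ) rare′
      agree : ∀ D i p q → ¬ Bad (insertAt D i p) → ¬ Bad (insertAt D i q) → type (insertAt D i p) ≡ type (insertAt D i q)
      agree D i p q gp gq = core-unique H free (¬bad⇒size Dp gp) (¬bad⇒size Dq gq) (¬bad⇒core Dp gp S ∣S∣)
          (subst (λ P → InCore H (type Dq) P (imgOn (∁ S) Dq)) (trans (imgOn-insertAt S i D q i∉S) (sym (imgOn-insertAt S i D p i∉S))) (¬bad⇒core Dq gq S ∣S∣))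
        where
        Dp = insertAt D i p
        Dq = insertAt D i q
        -- S avoids the entry i that changes, so both tuples have the same a-set at S, and
        -- `core-unique` compares their types.
        pick = interpolate ⊥ (∁ ⁅ i ⁆) a ⊥⊆ (∣⊥∣≤ ρ)
          (≤-trans (m≤m+n a b') (≤-reflexive (sym (trans (∣∁p∣≡n∸∣p∣ ⁅ i ⁆) (cong (ρ ∸_) (∣⁅x⁆∣≡1 i))))))
        S = proj₁ pick
        ∣S∣ : ∣ S ∣ ≡ a
        ∣S∣ = proj₂ (proj₂ (proj₂ pick))
        i∉S : i ∉ S
        i∉S i∈ = x∈∁p⇒x∉p (proj₁ (proj₂ (proj₂ pick)) i∈) (x∈⁅x⁆ i)
      constant : ∃ λ x₀ → ¬ Bad x₀ × (∑[ y ∈ tuples n ρ ] ι (¬? (type y ≟ˢ type x₀))) ≤ suc ρ * β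
      constant = almost-constant _≟ˢ_ type bad? agree few′
      x₀ = proj₁ constant
      good : ¬ Bad x₀
      good = proj₁ (proj₂ constant)
      near : (∑[ y ∈ tuples n ρ ] ι (¬? (type y ≟ˢ type x₀))) ≤ suc ρ * β
      near = proj₂ (proj₂ constant)
      unlinked : ∀ D → ι (¬? (linkedTuple? H (type x₀) D)) ≤ ι (¬? (type D ≟ˢ type x₀))
      unlinked D = ι-mono (¬? (linkedTuple? H (type x₀) D)) (¬? (type D ≟ˢ type x₀))
        (λ ¬linked eq → ¬linked (λ l l∈ → proj₂ (∈-type⁻ D (subst (l ∈_) (sym eq) l∈))))
      final : M * (∑[ D ∈ tuples n ρ ] ι (¬? (linkedTuple? H (type x₀) D))) ≤ n ^ ρ
      final = begin
        M * (∑[ D ∈ tuples n ρ ] ι (¬? (linkedTuple? H (type x₀) D)))   ≤⟨ *-monoʳ-≤ M (≤-trans (∑-mono (tuples n ρ) unlinked) near) ⟩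
        M * (suc ρ * β)                                                 ≤⟨ *-monoˡ-≤ (suc ρ * β) (m≤n+m M 2) ⟩
        (2 + M) * (suc ρ * β)                                           ≤⟨ rare′ ⟩
        n ^ ρ ∎
        where open ≤-Reasoning
    from-few-bad :
      (∃ λ n₁ → ∀ n → n₁ ≤ n → (H : RGraph n r) → Free E a b H → Dense H →
        ∃ λ W → (2 + M) * suc ρ * (∑[ D ∈ tuples n ρ ] ι (Types.bad? H W D)) ≤ n ^ ρ) →
      ∃ λ n₀ → ∀ n → n₀ ≤ n → (H : RGraph n r) → Free E a b H → Dense H →
      ∃ λ L → ∣ L ∣ ≡ t' × M * (∑[ D ∈ tuples n ρ ] ι (¬? (linkedTuple? H L D))) ≤ n ^ ρ
    from-few-bad (n₁ , few) = suc n₁ , λ n n₀≤n H free dense →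
      bound n (≤-trans (s≤s z≤n) n₀≤n) H free (proj₁ (few n (≤-trans (n≤1+n n₁) n₀≤n) H free dense)) (proj₂ (few n (≤-trans (n≤1+n n₁) n₀≤n) H free dense))

  -- The exact bound

  b₁ : ℕ
  b₁ = suc b'

  n^ρ : ∀ n → n ^ ρ ≡ n ^ a * n ^ b₁
  n^ρ n = trans (cong (n *_) (^-distribˡ-+-* n a b')) (x∙yz≈y∙xz n (n ^ a) (n ^ b'))

  module _ {n : ℕ} where

    -- An entry of Z comes first because ρ computes to suc (a + b'); with w in front, a transport
    -- along a + suc b' ≡ suc (a + b') would be needed.
    join : Vec (Fin n) a → Vec (Fin n) b₁ → Vec (Fin n) ρ
    join w (z ∷ Z) = z ∷ (w Vec.++ Z)

    img-join : ∀ w Z → img (join w Z) ≡ img w ∪ img Z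
    img-join w (z ∷ Z) = trans (cong (⁅ z ⁆ ∪_) (img-++ w Z)) (trans (sym (∪-assoc ⁅ z ⁆ (img w) (img Z)))
      (trans (cong (_∪ img Z) (∪-comm ⁅ z ⁆ (img w))) (∪-assoc (img w) ⁅ z ⁆ (img Z))))

    ∑-join : ∀ (g : Vec (Fin n) ρ → ℕ) → (∑[ w ∈ tuples n a ] ∑[ Z ∈ tuples n b₁ ] g (join w Z)) ≡ ∑ (tuples n ρ) g
    ∑-join g = begin
      (∑[ w ∈ tuples n a ] ∑[ Z ∈ tuples n b₁ ] g (join w Z))
        ≡⟨ ∑-cong (tuples n a) (λ w → ∑-∷ b' (λ Z → g (join w Z))) ⟩
      (∑[ w ∈ tuples n a ] ∑[ z ∈ allFin n ] ∑[ Z ∈ tuples n b' ] g (z ∷ (w Vec.++ Z)))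
        ≡⟨ ∑-swap (tuples n a) (allFin n) _ ⟩
      (∑[ z ∈ allFin n ] ∑[ w ∈ tuples n a ] ∑[ Z ∈ tuples n b' ] g (z ∷ (w Vec.++ Z)))
        ≡⟨ ∑-cong (allFin n) (λ z → sym (∑-++ᵛ a b' (λ v → g (z ∷ v)))) ⟩
      (∑[ z ∈ allFin n ] ∑[ v ∈ tuples n (a + b') ] g (z ∷ v))
        ≡⟨ sym (∑-∷ (a + b') g) ⟩
      ∑ (tuples n ρ) g ∎
      where open ≡-Reasoning

  front : Subset ρ
  front = false ∷ (⊤ {a} Vec.++ ⊥ {b'})

  ∣front∣ : ∣ front ∣ ≡ a
  ∣front∣ = ∣⊤++⊥∣ a b'

  imgOn-∁front : ∀ {n} (w : Vec (Fin n) a) Z → imgOn (∁ front) (join w Z) ≡ img Z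
  imgOn-∁front w (z ∷ Z) = cong (⁅ z ⁆ ∪_) (imgOn-++ʳ w Z)

  -- The constant of `count-¬generic` for b - 1 entries that avoid L, the a entries of w and a
  -- blocking set of at most N vertices.
  κ₂ : ℕ
  κ₂ = b₁ * (b₁ + (t' + (a + N)))

  module Exact {n : ℕ} (H : RGraph n r) (L : Subset n) (∣L∣ : ∣ L ∣ ≡ t') where

    Stray Missing : Vec (Fin n) r → Set
    Stray v = Edge H v × Disjoint (img v) L
    Missing v = Distinct v × Meets (img v) L × ¬ Edge H v

    stray? : ∀ v → Dec (Stray v)
    stray? v = edge? H v ×-dec disjoint? (img v) L

    missing? : ∀ v → Dec (Missing v)
    missing? v = distinct? v ×-dec meets? (img v) L ×-dec ¬? (edge? H v)

    -- Every a-subtuple of a stray edge is of this kind: generic because the edge is disjoint from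
    -- L, confined by `stray-confined`.
    Loose : Vec (Fin n) a → Set
    Loose w = Generic L w × Confined H L (img w)

    loose? : ∀ w → Dec (Loose w)
    loose? w = generic? L w ×-dec confined? H L (img w)

    #unlinked #stray #missing #loose #noncolumn : ℕ
    #unlinked = ∑[ D ∈ tuples n ρ ] ι (¬? (linkedTuple? H L D))
    #stray = ∑[ v ∈ tuples n r ] ι (stray? v)
    #missing = ∑[ v ∈ tuples n r ] ι (missing? v)
    #loose = ∑[ w ∈ tuples n a ] ι (loose? w)
    #noncolumn = ∑[ Z ∈ tuples n b₁ ] ι (¬? (coreColumn? H L (img Z)))

    L-nonempty : Nonempty L
    L-nonempty = nonempty-size L (≤-trans 1≤t' (≤-reflexive (sym ∣L∣)))

    -- Deleting an entry in L from a missing tuple leaves an unlinked one; the entry has r positions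
    -- and t' values.
    count-missing : #missing ≤ r * (t' * #unlinked)
    count-missing = begin
      (∑[ v ∈ tuples n r ] ι (missing? v))
        ≤⟨ ∑-mono (tuples n r) (λ v → ι-≤ (missing? v) (position v)) ⟩
      (∑[ v ∈ tuples n r ] ∑[ i ∈ allFin r ] ι (at? v i))
        ≡⟨ ∑-swap (tuples n r) (allFin r) _ ⟩
      (∑[ i ∈ allFin r ] ∑[ v ∈ tuples n r ] ι (at? v i))
        ≤⟨ ∑-mono (allFin r) (λ i → ≤-trans (≤-reflexive (∑-insertAt ρ i _)) (∑-mono (tuples n ρ) (inner i))) ⟩
      (∑[ i ∈ allFin r ] ∑[ D ∈ tuples n ρ ] (t' * ι (¬? (linkedTuple? H L D))))
        ≡⟨ trans (∑-allFin-const r _) (cong (r *_) (∑-*ˡ (tuples n ρ) t' _)) ⟩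
      r * (t' * #unlinked) ∎
      where
      open ≤-Reasoning
      at? : ∀ (v : Vec (Fin n) r) i → Dec (lookup v i ∈ L × ¬ Edge H v)
      at? v i = (lookup v i ∈? L) ×-dec ¬? (edge? H v)
      position : ∀ v → Missing v → 1 ≤ ∑[ i ∈ allFin r ] ι (at? v i)
      position v (_ , (y , y∈ , y∈L) , ¬e) with ∈-img⁻ v y∈
      ... | i , refl = ∑-≥1 (λ i → ι (at? v i)) (∈-allFin i) (ι-≥1 (at? v i) (y∈L , ¬e))
      inner : ∀ i D → (∑[ y ∈ allFin n ] ι (at? (insertAt D i y) i)) ≤ t' * ι (¬? (linkedTuple? H L D))
      inner i D = ≤-trans (∑-mono (allFin n) (λ y → ι-× (at? (insertAt D i y) i) (y ∈? L) (¬? (linkedTuple? H L D))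
          (λ (p , ¬e) → subst (_∈ L) (insertAt-lookup D i y) p ,
            (λ linked → ¬e (trans (cong (edge H) (img-insertAt D i y)) (linked y (subst (_∈ L) (insertAt-lookup D i y) p)))))))
        (∑-∈-≤ L (ι (¬? (linkedTuple? H L D))) (≤-reflexive ∣L∣))

    -- If Z is in no core pair, each of the n ^ a tuples `join w Z` is unlinked or has an arrow.
    count-noncolumn : n ^ a * #noncolumn ≤ #unlinked + ρ * (N₂ * n ^ (a + b'))
    count-noncolumn = begin
      n ^ a * #noncolumn
        ≡⟨ sym (∑-tuples-const n a #noncolumn) ⟩
      (∑[ w ∈ tuples n a ] ∑[ Z ∈ tuples n b₁ ] ι (¬? (coreColumn? H L (img Z))))
        ≤⟨ ∑-mono (tuples n a) (λ w → ∑-mono (tuples n b₁) (λ Z →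
             ι-⊎ (¬? (coreColumn? H L (img Z))) (¬? (linkedTuple? H L (join w Z))) (arrow? (linkCover H L) front (join w Z)) (λ ¬c → cases w Z ¬c (linkedTuple? H L (join w Z))))) ⟩
      (∑[ w ∈ tuples n a ] ∑[ Z ∈ tuples n b₁ ] (ι (¬? (linkedTuple? H L (join w Z))) + ι (arrow? (linkCover H L) front (join w Z))))
        ≡⟨ ∑-join (λ D → ι (¬? (linkedTuple? H L D)) + ι (arrow? (linkCover H L) front D)) ⟩
      (∑[ D ∈ tuples n ρ ] (ι (¬? (linkedTuple? H L D)) + ι (arrow? (linkCover H L) front D)))
        ≡⟨ ∑-+ (tuples n ρ) _ _ ⟩
      #unlinked + (∑[ D ∈ tuples n ρ ] ι (arrow? (linkCover H L) front D))
        ≤⟨ +-monoʳ-≤ #unlinked (count-arrow (linkCover H L) (∣linkCover∣ H L) front) ⟩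
      #unlinked + ρ * (N₂ * n ^ (a + b')) ∎
      where
      open ≤-Reasoning
      cases : ∀ w Z → ¬ CoreColumn H L (img Z) → Dec (LinkedTuple H L (join w Z)) → ¬ LinkedTuple H L (join w Z) ⊎ ∃ (ArrowAt (linkCover H L) front (join w Z))
      cases w Z ¬c (no ¬l) = inj₁ ¬l
      cases w Z ¬c (yes linked) = inj₂ (outside-core⇒arrow H L-nonempty {join w Z} linked front ∣front∣
        (λ c → ¬c (imgOn front (join w Z) , subst (InCore H L (imgOn front (join w Z))) (imgOn-∁front w Z) c)))

    -- If every l ∈ L gave an edge, Z would be a linked core column disjoint from Y, which
    -- confinement excludes.
    missing-above : ∀ w → Loose w → ∃ λ Y → ∣ Y ∣ ≤ N × (∀ Z → Generic (L ∪ (img w ∪ Y)) Z → CoreColumn H L (img Z) → ∃ λ l → l ∈ L × Missing (l ∷ join w Z))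
    missing-above w ((dw , wL) , Y , ∣Y∣ , none) = Y , ∣Y∣ , above
      where
      above : ∀ Z → Generic (L ∪ (img w ∪ Y)) Z → CoreColumn H L (img Z) → ∃ λ l → l ∈ L × Missing (l ∷ join w Z)
      above Z (dZ , ZX) col = find (Fin.any? (λ l → (l ∈? L) ×-dec ¬? (edge? H (l ∷ join w Z))))
        where
        wZ : Disjoint (img w) (img Z)
        wZ p q = ZX q (∈-∪ʳ L (∈-∪ˡ p))
        ZL : Disjoint (img Z) L
        ZL p q = ZX p (∈-∪ˡ q)
        ZY : Disjoint (img Z) Y
        ZY p q = ZX p (∈-∪ʳ L (∈-∪ʳ (img w) q))
        find : Dec (∃ λ l → l ∈ L × ¬ Edge H (l ∷ join w Z)) → ∃ λ l → l ∈ L × Missing (l ∷ join w Z)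
        find (no ¬m) = ⊥-elim (none (img Z , (dw , dZ , wZ , wL , ZL ,
          (λ l l∈ → trans (cong (λ P → edge H (⁅ l ⁆ ∪ P)) (sym (img-join w Z)))
            (decidable-stable (edge? H (l ∷ join w Z)) (λ ¬e → ¬m (l , l∈ , ¬e))))) , col , ZY))
        find (yes (l , l∈ , ¬e)) = l , l∈ , trans (∣⁅⁆∪∣ l (img (join w Z)) l∉) (cong suc dJ) , (l , ∈-∪ˡ (x∈⁅x⁆ l) , l∈) , ¬e
          where
          l∉ : l ∉ img (join w Z)
          l∉ p = [ (λ q → wL q l∈) , (λ q → ZL q l∈) ]′ (x∈p∪q⁻ (img w) (img Z) (subst (l ∈_) (img-join w Z) p))
          dJ : ∣ img (join w Z) ∣ ≡ ρ
          dJ = trans (cong ∣_∣ (img-join w Z)) (trans (disjoint⇒∣∪∣ (img w) (img Z) wZ) (trans (cong₂ _+_ dw dZ) (+-suc a b')))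

    above? : ∀ w Z l → Dec (l ∈ L × Missing (l ∷ join w Z))
    above? w Z l = (l ∈? L) ×-dec missing? (l ∷ join w Z)

    -- At most a quarter of the Z are not generic and at most a quarter are not core columns; each
    -- of the others carries a missing tuple above w.
    loose-heavy : 4 * κ₂ ≤ n → 4 * #noncolumn ≤ n ^ b₁ → ∀ w →
      ι (loose? w) * n ^ b₁ ≤ 2 * (∑[ Z ∈ tuples n b₁ ] ∑[ l ∈ allFin n ] ι (above? w Z l))
    loose-heavy n-large few-non w = go (loose? w)
      where
      m = ∑[ Z ∈ tuples n b₁ ] ∑[ l ∈ allFin n ] ι (above? w Z l)
      quarters : ∀ {p x y m} → p ≤ x + (y + m) → 4 * x ≤ p → 4 * y ≤ p → p ≤ 2 * m
      quarters {p} {x} {y} {m} h hx hy = *-cancelˡ-≤ 2 (+-cancelˡ-≤ (2 * p) _ _ (begin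
        2 * p + 2 * p          ≡⟨ solve 1 (λ p → con 2 :* p :+ con 2 :* p := con 4 :* p) refl p ⟩
        4 * p                  ≤⟨ *-monoʳ-≤ 4 h ⟩
        4 * (x + (y + m))      ≡⟨ solve 3 (λ x y m → con 4 :* (x :+ (y :+ m)) := con 4 :* x :+ con 4 :* y :+ con 4 :* m) refl x y m ⟩
        4 * x + 4 * y + 4 * m  ≤⟨ +-monoˡ-≤ (4 * m) (+-mono-≤ hx hy) ⟩
        p + p + 4 * m          ≡⟨ solve 2 (λ p m → p :+ p :+ con 4 :* m := con 2 :* p :+ con 2 :* (con 2 :* m)) refl p m ⟩
        2 * p + 2 * (2 * m) ∎))
        where
        open ≤-Reasoning
        open +-*-Solver using (solve; _:*_; _:+_; _:=_; con)
      heavy : (∃ λ Y → ∣ Y ∣ ≤ N × (∀ Z → Generic (L ∪ (img w ∪ Y)) Z → CoreColumn H L (img Z) → ∃ λ l → l ∈ L × Missing (l ∷ join w Z))) → n ^ b₁ ≤ 2 * m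
      heavy (Y , ∣Y∣ , above) = quarters {n ^ b₁} {∑[ Z ∈ tuples n b₁ ] ι (¬? (generic? X Z))} {#noncolumn} {m} cover few-gen few-non
        where
        X = L ∪ (img w ∪ Y)
        ∣X∣ : ∣ X ∣ ≤ t' + (a + N)
        ∣X∣ = ≤-trans (∣∪∣≤ L (img w ∪ Y)) (+-mono-≤ (≤-reflexive ∣L∣) (≤-trans (∣∪∣≤ (img w) Y) (+-mono-≤ (∣img∣≤ w) ∣Y∣)))
        few-gen : 4 * (∑[ Z ∈ tuples n b₁ ] ι (¬? (generic? X Z))) ≤ n ^ b₁
        few-gen = *-cancelˡ-≤ κ₂ {{m*n≢0 b₁ (b₁ + (t' + (a + N)))}} (begin
          κ₂ * (4 * γ)                     ≡⟨ trans (sym (*-assoc κ₂ 4 γ)) (cong (_* γ) (*-comm κ₂ 4)) ⟩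
          4 * κ₂ * γ                       ≤⟨ *-monoˡ-≤ γ n-large ⟩
          n * γ                            ≤⟨ count-¬generic X b₁ ⟩
          b₁ * (b₁ + ∣ X ∣) * n ^ b₁       ≤⟨ *-monoˡ-≤ (n ^ b₁) (*-monoʳ-≤ b₁ (+-monoʳ-≤ b₁ ∣X∣)) ⟩
          κ₂ * n ^ b₁ ∎)
          where
          open ≤-Reasoning
          γ = ∑[ Z ∈ tuples n b₁ ] ι (¬? (generic? X Z))
        one : ∀ Z → Dec (Generic X Z) → Dec (CoreColumn H L (img Z)) →
          1 ≤ ι (¬? (generic? X Z)) + (ι (¬? (coreColumn? H L (img Z))) + (∑[ l ∈ allFin n ] ι (above? w Z l)))
        one Z (no ¬g) _ = ≤-trans (ι-≥1 (¬? (generic? X Z)) ¬g) (m≤m+n _ _)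
        one Z (yes _) (no ¬c) = ≤-trans (≤-trans (ι-≥1 (¬? (coreColumn? H L (img Z))) ¬c) (m≤m+n _ (∑[ l ∈ allFin n ] ι (above? w Z l))))
          (m≤n+m _ (ι (¬? (generic? X Z))))
        one Z (yes g) (yes c) = ≤-trans (≤-trans (∑-≥1 (λ l → ι (above? w Z l)) (∈-allFin (proj₁ (above Z g c)))
            (ι-≥1 (above? w Z (proj₁ (above Z g c))) (proj₂ (above Z g c))))
          (m≤n+m _ (ι (¬? (coreColumn? H L (img Z)))))) (m≤n+m _ (ι (¬? (generic? X Z))))
        cover : n ^ b₁ ≤ (∑[ Z ∈ tuples n b₁ ] ι (¬? (generic? X Z))) + (#noncolumn + m)
        cover = begin
          n ^ b₁
            ≡⟨ sym (trans (∑-tuples-const n b₁ 1) (*-identityʳ _)) ⟩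
          (∑[ Z ∈ tuples n b₁ ] 1)
            ≤⟨ ∑-mono (tuples n b₁) (λ Z → one Z (generic? X Z) (coreColumn? H L (img Z))) ⟩
          (∑[ Z ∈ tuples n b₁ ] (ι (¬? (generic? X Z)) + (ι (¬? (coreColumn? H L (img Z))) + (∑[ l ∈ allFin n ] ι (above? w Z l)))))
            ≡⟨ trans (∑-+ (tuples n b₁) _ _) (cong ((∑[ Z ∈ tuples n b₁ ] ι (¬? (generic? X Z))) +_) (∑-+ (tuples n b₁) _ _)) ⟩
          (∑[ Z ∈ tuples n b₁ ] ι (¬? (generic? X Z))) + (#noncolumn + m) ∎
          where open ≤-Reasoning
      go : Dec (Loose w) → ι (loose? w) * n ^ b₁ ≤ 2 * m
      go (no ¬l) = ≤-trans (≤-reflexive (cong (_* n ^ b₁) (ι-no (loose? w) ¬l))) z≤n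
      go (yes l) = ≤-trans (≤-reflexive (trans (cong (_* n ^ b₁) (ι-yes (loose? w) l)) (*-identityˡ (n ^ b₁)))) (heavy (missing-above w l))

    count-loose : 4 * κ₂ ≤ n → 4 * #noncolumn ≤ n ^ b₁ → #loose * n ^ b₁ ≤ 2 * #missing
    count-loose n-large few-non = begin
      #loose * n ^ b₁
        ≡⟨ ∑-*ʳ (tuples n a) (n ^ b₁) _ ⟨
      (∑[ w ∈ tuples n a ] (ι (loose? w) * n ^ b₁))
        ≤⟨ ∑-mono (tuples n a) (loose-heavy n-large few-non) ⟩
      (∑[ w ∈ tuples n a ] (2 * (∑[ Z ∈ tuples n b₁ ] ∑[ l ∈ allFin n ] ι (above? w Z l))))
        ≡⟨ ∑-*ˡ (tuples n a) 2 _ ⟩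
      2 * (∑[ w ∈ tuples n a ] ∑[ Z ∈ tuples n b₁ ] ∑[ l ∈ allFin n ] ι (above? w Z l))
        ≡⟨ cong (2 *_) (∑-join (λ D → ∑[ l ∈ allFin n ] ι ((l ∈? L) ×-dec missing? (l ∷ D)))) ⟩
      2 * (∑[ D ∈ tuples n ρ ] ∑[ l ∈ allFin n ] ι ((l ∈? L) ×-dec missing? (l ∷ D)))
        ≤⟨ *-monoʳ-≤ 2 (∑-mono (tuples n ρ) (λ D → ∑-mono (allFin n) (λ l → ι-mono ((l ∈? L) ×-dec missing? (l ∷ D)) (missing? (l ∷ D)) proj₂))) ⟩
      2 * (∑[ D ∈ tuples n ρ ] ∑[ l ∈ allFin n ] ι (missing? (l ∷ D)))
        ≡⟨ cong (2 *_) (sym (∑-insertAt ρ zero (λ v → ι (missing? v)))) ⟩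
      2 * #missing ∎
      where open ≤-Reasoning

    -- If P were attached, the leaf could be sent to the rest of the stray edge, with L supplying
    -- one vertex for each of the other parts V_j.
    stray-confined : Free E a b H → ∀ v → Stray v → ∀ {P} → P ⊆ img v → ∣ P ∣ ≡ a → Confined H L P
    stray-confined free v (e , vL) {P} P⊆ ∣P∣ = decidable-stable (confined? H L P) impossible
      where
      split : Split H P (img v ─ P)
      split = edge-split H e P⊆ ∣P∣
      not-edge : ¬ Confined H L P → edge H (P ∪ (img v ─ P)) ≡ false
      not-edge ¬c = attached-free H free {L} {L} id ∣L∣ P (img v ─ P) (¬confined⇒attached H L P ¬c)
        (proj₁ (proj₂ split)) (proj₁ (proj₂ (proj₂ split))) (λ p → vL (p─q⊆p (img v) P p))
      impossible : ¬ ¬ Confined H L P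
      impossible ¬c = true≢false (proj₂ (proj₂ (proj₂ split))) (not-edge ¬c)

    LooseRest : Vec (Fin n) ρ → Set
    LooseRest D = Deletions Loose (Vec.take (suc a) D)

    looseRest? : ∀ D → Dec (LooseRest D)
    looseRest? D = deletions? loose? (Vec.take (suc a) D)

    stray-loose : Free E a b H → ∀ v → Stray v → ∀ c → LooseRest (removeAt v c)
    stray-loose free v (e , vL) c j = (proj₁ sub , λ p → vL (proj₁ (proj₂ sub) p)) , stray-confined free v (e , vL) (proj₁ (proj₂ sub)) (proj₁ sub)
      where
      w = removeAt (Vec.take (suc a) (removeAt v c)) j
      sub : Distinct w × img w ⊆ img v × lookup v c ∉ img w
      sub = subtuple a b' v (edge⇒distinct H v e) c j

    #deletions : ℕ
    #deletions = ∑[ D ∈ tuples n (suc a) ] ι (deletions? loose? D)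

    count-looseRest : (∑[ D ∈ tuples n ρ ] ι (looseRest? D)) ≡ n ^ b' * #deletions
    count-looseRest = ∑-take n (suc a) b' (λ D → ι (deletions? loose? D))

    opaque
      some-a : ∃ λ (S : Subset r) → ∣ S ∣ ≡ a
      some-a = let (S , _ , _ , e) = interpolate ⊥ ⊤ a ⊥⊆ (∣⊥∣≤ r) (≤-trans a≤r (≤-reflexive (sym (∣⊤∣≡n r)))) in S , e

    -- An arrow at fixed positions determines one entry up to r * N₂ choices, and among the entries
    -- left over the first a + 1 have only loose deletions, which is the input for Loomis-Whitney.
    count-stray : Free E a b H → (𝒞 : Subset n → Subset n) → (∀ P → ∣ 𝒞 P ∣ ≤ N₂) →
      (∀ P Q → Split H P Q → Meets Q (𝒞 P) ⊎ Meets P (𝒞 Q)) → #stray ≤ r * (N₂ * (n ^ b' * #deletions))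
    count-stray free 𝒞 ∣𝒞∣ meets = ≤-trans (count-arrow-within 𝒞 ∣𝒞∣ S stray? looseRest? arrow (stray-loose free))
      (≤-reflexive (cong (λ k → r * (N₂ * k)) count-looseRest))
      where
      S : Subset r
      S = proj₁ some-a
      arrow : ∀ v → Stray v → ∃ (ArrowAt 𝒞 S v)
      arrow v (e , _) = meets⇒arrow H 𝒞 S v (meets (imgOn S v) (imgOn (∁ S) v)
        ( trans (∣imgOn∣ S v dv) (proj₂ some-a)
        , trans (∣imgOn∣ (∁ S) v dv) (trans (∣∁p∣≡n∸∣p∣ S) (trans (cong (r ∸_) (proj₂ some-a)) (trans (cong (_∸ a) (sym a+b≡r)) (m+n∸m≡n a b))))
        , imgOn-disjoint-∁ S v dv , trans (cong (edge H) (imgOn-∪-∁ S v)) e ))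
        where
        dv : Distinct v
        dv = edge⇒distinct H v e

    -- Loomis-Whitney bounds `#deletions` by n * #loose with a gain of 4 * (r * N₂). This cancels
    -- the factor r * N₂ of `count-stray`, and of the 4 one factor 2 is spent in `count-loose` while
    -- the other remains in the conclusion. In the assumption on `#unlinked`, the 8 serves `few-non`
    -- and the term with G makes the loose tuples sparse.
    few-stray : Free E a b H → ∀ G → (∀ {𝒮 : Vec (Fin n) a → Set} (𝒮? : ∀ v → Dec (𝒮 v)) →
        G * (∑[ v ∈ tuples n a ] ι (𝒮? v)) ≤ n ^ a →
        4 * (r * N₂) * (∑[ w ∈ tuples n (suc a) ] ι (deletions? 𝒮? w)) ≤ n * (∑[ v ∈ tuples n a ] ι (𝒮? v))) →
      4 * κ₂ ≤ n → 8 * (ρ * N₂) ≤ n → 0 < n → (8 + 2 * (G * (r * t'))) * #unlinked ≤ n ^ ρ → 2 * #stray ≤ #missing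
    few-stray free G lw n₁≤n n₂≤n 0<n few = *-cancelˡ-≤ (2 * (r * N₂)) {{m*n≢0 2 (r * N₂) {{_}} {{m*n≢0 r N₂ {{_}} {{>-nonZero 0<N₂}}}}}} (begin
      2 * (r * N₂) * (2 * #stray)
        ≡⟨ solve 2 (λ c x → con 2 :* c :* (con 2 :* x) := con 4 :* c :* x) refl (r * N₂) #stray ⟩
      4 * (r * N₂) * #stray
        ≤⟨ *-monoʳ-≤ (4 * (r * N₂)) (count-stray free (arrowC H) (∣arrowC∣ H) (split-meets H free)) ⟩
      4 * (r * N₂) * (r * (N₂ * (n ^ b' * #deletions)))
        ≡⟨ solve 4 (λ r m p d → con 4 :* (r :* m) :* (r :* (m :* (p :* d))) := r :* m :* p :* (con 4 :* (r :* m) :* d)) refl r N₂ (n ^ b') #deletions ⟩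
      r * N₂ * n ^ b' * (4 * (r * N₂) * #deletions)
        ≤⟨ *-monoʳ-≤ (r * N₂ * n ^ b') (lw loose? sparse) ⟩
      r * N₂ * n ^ b' * (n * #loose)
        ≡⟨ solve 4 (λ c p n x → c :* p :* (n :* x) := c :* (x :* (n :* p))) refl (r * N₂) (n ^ b') n #loose ⟩
      r * N₂ * (#loose * n ^ b₁)
        ≤⟨ *-monoʳ-≤ (r * N₂) loose≤ ⟩
      r * N₂ * (2 * #missing)
        ≡⟨ solve 2 (λ c x → c :* (con 2 :* x) := con 2 :* c :* x) refl (r * N₂) #missing ⟩
      2 * (r * N₂) * #missing ∎)
      where
      open ≤-Reasoning
      open +-*-Solver using (solve; _:*_; _:+_; _:=_; con)
      instance
        n≢0 : NonZero n
        n≢0 = >-nonZero 0<n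
      few-unlinked : 8 * #unlinked ≤ n ^ ρ
      few-unlinked = ≤-trans (*-monoˡ-≤ #unlinked (m≤m+n 8 (2 * (G * (r * t'))))) few
      few-arrows : 8 * (ρ * (N₂ * n ^ (a + b'))) ≤ n ^ ρ
      few-arrows = lower-order 8 {K = ρ * N₂} {n = n} {k = a + b'} (≤-reflexive (sym (*-assoc ρ N₂ (n ^ (a + b'))))) n₂≤n
      few-non : 4 * #noncolumn ≤ n ^ b₁
      few-non = *-cancelˡ-≤ (n ^ a) {{m^n≢0 n a}} (begin
        n ^ a * (4 * #noncolumn)                              ≡⟨ x∙yz≈y∙xz (n ^ a) 4 #noncolumn ⟩
        4 * (n ^ a * #noncolumn)                              ≤⟨ *-monoʳ-≤ 4 count-noncolumn ⟩
        4 * (#unlinked + ρ * (N₂ * n ^ (a + b')))             ≤⟨ halves 4 {#unlinked} {ρ * (N₂ * n ^ (a + b'))} {n ^ ρ} few-unlinked few-arrows ⟩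
        n ^ ρ                                                 ≡⟨ n^ρ n ⟩
        n ^ a * n ^ b₁ ∎)
      loose≤ : #loose * n ^ b₁ ≤ 2 * #missing
      loose≤ = count-loose n₁≤n few-non
      sparse : G * #loose ≤ n ^ a
      sparse = *-cancelʳ-≤ (G * #loose) (n ^ a) (n ^ b₁) {{m^n≢0 n b₁}} (begin
        G * #loose * n ^ b₁                  ≡⟨ *-assoc G #loose (n ^ b₁) ⟩
        G * (#loose * n ^ b₁)                ≤⟨ *-monoʳ-≤ G loose≤ ⟩
        G * (2 * #missing)                   ≤⟨ *-monoʳ-≤ G (*-monoʳ-≤ 2 count-missing) ⟩
        G * (2 * (r * (t' * #unlinked)))     ≡⟨ solve 4 (λ G r t x → G :* (con 2 :* (r :* (t :* x))) := con 2 :* (G :* (r :* t)) :* x) refl G r t' #unlinked ⟩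
        2 * (G * (r * t')) * #unlinked       ≤⟨ *-monoˡ-≤ #unlinked (m≤n+m (2 * (G * (r * t'))) 8) ⟩
        (8 + 2 * (G * (r * t'))) * #unlinked ≤⟨ few ⟩
        n ^ ρ                                ≡⟨ n^ρ n ⟩
        n ^ a * n ^ b₁ ∎)

  exact : ∃ λ n₀ → ∀ n → n₀ ≤ n → (H : RGraph n r) → Free E a b H → Dense H →
    ∃ λ L → Σ (∣ L ∣ ≡ t') λ ∣L∣ → 2 * Exact.#stray H L ∣L∣ ≤ Exact.#missing H L ∣L∣
  exact = combine (stability (8 + 2 * (proj₁ lw * (r * t'))))
    where
    lw = loomis-whitney a (4 * (r * N₂))
    combine : (∃ λ n₁ → ∀ n → n₁ ≤ n → (H : RGraph n r) → Free E a b H → Dense H →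
        ∃ λ L → ∣ L ∣ ≡ t' × (8 + 2 * (proj₁ lw * (r * t'))) * (∑[ D ∈ tuples n ρ ] ι (¬? (linkedTuple? H L D))) ≤ n ^ ρ) →
      ∃ λ n₀ → ∀ n → n₀ ≤ n → (H : RGraph n r) → Free E a b H → Dense H →
      ∃ λ L → Σ (∣ L ∣ ≡ t') λ ∣L∣ → 2 * Exact.#stray H L ∣L∣ ≤ Exact.#missing H L ∣L∣
    combine (n₁ , stable) = n₁ + suc (4 * κ₂ + 8 * (ρ * N₂)) , λ n n₀≤n H free dense →
      finish n (≤-trans (m≤n+m _ n₁) n₀≤n) H free (stable n (≤-trans (m≤m+n n₁ _) n₀≤n) H free dense)
      where
      finish : ∀ n → suc (4 * κ₂ + 8 * (ρ * N₂)) ≤ n → (H : RGraph n r) → Free E a b H →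
        (∃ λ L → ∣ L ∣ ≡ t' × (8 + 2 * (proj₁ lw * (r * t'))) * (∑[ D ∈ tuples n ρ ] ι (¬? (linkedTuple? H L D))) ≤ n ^ ρ) →
        ∃ λ L → Σ (∣ L ∣ ≡ t') λ ∣L∣ → 2 * Exact.#stray H L ∣L∣ ≤ Exact.#missing H L ∣L∣
      finish n n₀≤n H free (L , ∣L∣ , few) = L , ∣L∣ , Exact.few-stray H L ∣L∣ free (proj₁ lw) (proj₂ lw n)
        (≤-trans (≤-trans (m≤m+n (4 * κ₂) _) (n≤1+n _)) n₀≤n) (≤-trans (≤-trans (m≤n+m (8 * (ρ * N₂)) (4 * κ₂)) (n≤1+n _)) n₀≤n)
        (≤-trans (s≤s z≤n) n₀≤n) few

  -- By `C-increase` there are at least t' * C(n - t', ρ) edges, and ρ ! * C(n - t', ρ) counts the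
  -- generic ρ-tuples, that is, all but γ of the n ^ ρ.
  dense : ∀ {n} (H : RGraph n r) → t' ≤ n → n C r ≤ numEdges H + (n ∸ t') C r → Dense H
  dense {n} H t'≤n many = γ , ≤-trans (count-¬generic L₀ ρ) (≤-reflexive (cong (λ k → ρ * (ρ + k) * n ^ ρ) ∣L₀∣)) , (begin
    r * (t' * n ^ ρ)
      ≡⟨ cong (λ k → r * (t' * k)) total ⟩
    r * (t' * (ρ ! * β + γ))
      ≡⟨ solve 5 (λ r t f β γ → r :* (t :* (f :* β :+ γ)) := r :* f :* (t :* β) :+ r :* (t :* γ)) refl r t' (ρ !) β γ ⟩
    r ! * (t' * β) + r * (t' * γ)
      ≤⟨ +-monoˡ-≤ (r * (t' * γ)) (*-monoʳ-≤ (r !) enough) ⟩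
    r ! * numEdges H + r * (t' * γ)
      ≡⟨ cong (_+ r * (t' * γ)) (tuples-numEdges H) ⟨
    (∑[ v ∈ tuples n r ] ι (edge? H v)) + r * (t' * γ) ∎)
    where
    open ≤-Reasoning
    open +-*-Solver using (solve; _:*_; _:+_; _:=_)
    L₀ : Subset n
    L₀ = initial t'
    ∣L₀∣ : ∣ L₀ ∣ ≡ t'
    ∣L₀∣ = ∣initial∣ t' t'≤n
    γ β : ℕ
    γ = ∑[ D ∈ tuples n ρ ] ι (¬? (generic? L₀ D))
    β = (n ∸ t') C ρ
    generic-count : (∑[ D ∈ tuples n ρ ] ι (generic? L₀ D)) ≡ ρ ! * β
    generic-count = trans (∑-cong (tuples n ρ) (λ D → ι-×-≡ (distinct? D) (disjoint? (img D) L₀)))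
      (trans (∑-distinct-tuples ρ (λ S → ι (disjoint? S L₀))) (cong (ρ ! *_) (trans (count-disjoint L₀ ρ)
        (cong (_C ρ) (trans (∣∁p∣≡n∸∣p∣ L₀) (cong (n ∸_) ∣L₀∣))))))
    one : ∀ D → Dec (Generic L₀ D) → 1 ≡ ι (generic? L₀ D) + ι (¬? (generic? L₀ D))
    one D (yes g) = sym (cong₂ _+_ (ι-yes (generic? L₀ D) g) (ι-no (¬? (generic? L₀ D)) (λ ¬g → ¬g g)))
    one D (no ¬g) = sym (cong₂ _+_ (ι-no (generic? L₀ D) ¬g) (ι-yes (¬? (generic? L₀ D)) ¬g))
    total : n ^ ρ ≡ ρ ! * β + γ
    total = trans (sym (trans (∑-tuples-const n ρ 1) (*-identityʳ _)))
      (trans (∑-cong (tuples n ρ) (λ D → one D (generic? L₀ D))) (trans (∑-+ (tuples n ρ) _ _) (cong (_+ γ) generic-count)))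
    enough : t' * β ≤ numEdges H
    enough = +-cancelʳ-≤ ((n ∸ t') C r) _ _ (≤-trans (C-increase t' (n ∸ t') ρ)
      (≤-trans (≤-reflexive (cong (_C r) (m+[n∸m]≡n t'≤n))) many))

  -- Edges and missing tuples together are as many as covering and stray tuples, so enough edges
  -- means that missing tuples are no more than stray ones. As they are also at least twice as many,
  -- both numbers vanish.
  star : ∀ {n} (H : RGraph n r) L (∣L∣ : ∣ L ∣ ≡ t') → n C r ≤ numEdges H + (n ∸ t') C r →
    2 * Exact.#stray H L ∣L∣ ≤ Exact.#missing H L ∣L∣ → Star H L
  star {n} H L ∣L∣ many few S = forward , backward
    where
    open Exact H L ∣L∣ using (Stray; Missing; stray?; missing?; #stray; #missing)
    Covering : Vec (Fin n) r → Set
    Covering v = Distinct v × Meets (img v) L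
    covering-tuple? : ∀ v → Dec (Covering v)
    covering-tuple? v = distinct? v ×-dec meets? (img v) L
    exchange : ∀ v → Dec (Edge H v) → Dec (Meets (img v) L) → Dec (Distinct v) →
      ι (edge? H v) + ι (missing? v) ≡ ι (covering-tuple? v) + ι (stray? v)
    exchange v (yes e) (yes m) _ = cong₂ _+_
      (trans (ι-yes (edge? H v) e) (sym (ι-yes (covering-tuple? v) (edge⇒distinct H v e , m))))
      (trans (ι-no (missing? v) (λ q → proj₂ (proj₂ q) e)) (sym (ι-no (stray? v) (λ q → let (_ , x∈ , x∈L) = m in proj₂ q x∈ x∈L))))
    exchange v (yes e) (no ¬m) _ = trans (cong₂ _+_ (ι-yes (edge? H v) e) (ι-no (missing? v) (λ q → proj₂ (proj₂ q) e)))
      (sym (cong₂ _+_ (ι-no (covering-tuple? v) (¬m ∘ proj₂)) (ι-yes (stray? v) (e , ¬meets⇒disjoint ¬m))))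
    exchange v (no ¬e) (yes m) (yes d) = trans (cong₂ _+_ (ι-no (edge? H v) ¬e) (ι-yes (missing? v) (d , m , ¬e)))
      (sym (cong₂ _+_ (ι-yes (covering-tuple? v) (d , m)) (ι-no (stray? v) (¬e ∘ proj₁))))
    exchange v (no ¬e) (yes m) (no ¬d) = trans (cong₂ _+_ (ι-no (edge? H v) ¬e) (ι-no (missing? v) (¬d ∘ proj₁)))
      (sym (cong₂ _+_ (ι-no (covering-tuple? v) (¬d ∘ proj₁)) (ι-no (stray? v) (¬e ∘ proj₁))))
    exchange v (no ¬e) (no ¬m) _ = trans (cong₂ _+_ (ι-no (edge? H v) ¬e) (ι-no (missing? v) (λ q → ¬m (proj₁ (proj₂ q)))))
      (sym (cong₂ _+_ (ι-no (covering-tuple? v) (¬m ∘ proj₂)) (ι-no (stray? v) (¬e ∘ proj₁))))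
    #edges #covering : ℕ
    #edges = ∑[ v ∈ tuples n r ] ι (edge? H v)
    #covering = ∑[ v ∈ tuples n r ] ι (covering-tuple? v)
    exchanged : #edges + #missing ≡ #covering + #stray
    exchanged = trans (sym (∑-+ (tuples n r) _ _)) (trans (∑-cong (tuples n r) (λ v → exchange v (edge? H v) (meets? (img v) L) (distinct? v)))
      (∑-+ (tuples n r) _ _))
    covering-sets : ℕ
    covering-sets = ∑[ S ∈ allSubsets n ] ι (covering? r L S)
    #covering≡ : #covering ≡ r ! * covering-sets
    #covering≡ = trans (∑-cong (tuples n r) (λ v → ι-×-≡ (distinct? v) (meets? (img v) L)))
      (trans (∑-distinct-tuples r (λ S → ι (meets? S L))) (cong (r ! *_) (∑-cong (allSubsets n) (λ S → sym (ι-×-≡ (∣ S ∣ ≟ r) (meets? S L))))))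
    enough : covering-sets ≤ numEdges H
    enough = +-cancelʳ-≤ ((n ∸ t') C r) _ _ (≤-trans (≤-reflexive (trans (cong (λ k → covering-sets + (n ∸ k) C r) (sym ∣L∣)) (count-covering r L))) many)
    missing≤stray : #missing ≤ #stray
    missing≤stray = +-cancelˡ-≤ #covering _ _ (≤-trans (+-monoˡ-≤ #missing
      (≤-trans (≤-reflexive #covering≡) (≤-trans (*-monoʳ-≤ (r !) enough) (≤-reflexive (sym (tuples-numEdges H)))))) (≤-reflexive exchanged))
    #stray≡0 : #stray ≡ 0
    #stray≡0 = n≤0⇒n≡0 (+-cancelˡ-≤ #stray _ _ (≤-trans (+-monoʳ-≤ #stray (m≤m+n #stray 0))
      (≤-trans few (≤-trans missing≤stray (≤-reflexive (sym (+-identityʳ _)))))))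
    #missing≡0 : #missing ≡ 0
    #missing≡0 = n≤0⇒n≡0 (≤-trans missing≤stray (≤-reflexive #stray≡0))
    none : ∀ {A : Vec (Fin n) r → Set} (A? : ∀ v → Dec (A v)) → (∑[ v ∈ tuples n r ] ι (A? v)) ≡ 0 → ∀ v → ¬ A v
    none A? e v = ι≡0⇒¬ (A? v) (n≤0⇒n≡0 (≤-trans (∑-∈ (λ v → ι (A? v)) (∈-tuples v)) (≤-reflexive e)))
    no-stray : ∀ v → ¬ Stray v
    no-stray = none stray? #stray≡0
    no-missing : ∀ v → ¬ Missing v
    no-missing = none missing? #missing≡0
    forward : edge H S ≡ true → ∣ S ∣ ≡ r × Meets S L
    forward e = uniform H S e , decidable-stable (meets? S L) (λ ¬m → no-stray v
        (trans (cong (edge H) imgv) e , λ {y} p → ¬meets⇒disjoint ¬m (subst (y ∈_) imgv p)))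
      where
      v = proj₁ (enumerate-as S (uniform H S e))
      imgv : img v ≡ S
      imgv = proj₂ (enumerate-as S (uniform H S e))
    backward : ∣ S ∣ ≡ r → Meets S L → edge H S ≡ true
    backward ∣S∣ m = decidable-stable (edge H S Bool.≟ true) (λ ¬e → no-missing v
        (trans (cong ∣_∣ imgv) ∣S∣ , subst (λ S → Meets S L) (sym imgv) m , λ e → ¬e (trans (cong (edge H) (sym imgv)) e)))
      where
      v = proj₁ (enumerate-as S ∣S∣)
      imgv : img v ≡ S
      imgv = proj₂ (enumerate-as S ∣S∣)

  extremal : ∃ λ n₀ → ∀ n → n₀ ≤ n → t' ≤ n → (H : RGraph n r) → Free E a b H → n C r ≤ numEdges H + (n ∸ t') C r →
    ∃ λ L → ∣ L ∣ ≡ t' × Star H L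
  extremal = proj₁ exact , λ n n₀≤n t'≤n H free many →
    let (L , ∣L∣ , few) = proj₂ exact n n₀≤n H free (dense H t'≤n many) in L , ∣L∣ , star H L ∣L∣ many few

-- Deduction of the theorem

unique-neighbour-of-leaf : ∀ {s t} (E : BipGraph s t) x → degV E x ≡ 1 → ∃ λ u → E u x ≡ true × (∀ i → E i x ≡ true → i ≡ u)
unique-neighbour-of-leaf {s} E x deg = find (Fin.any? (λ u → E u x Bool.≟ true))
  where
  degree : (∑[ i ∈ allFin s ] ι (E i x Bool.≟ true)) ≡ 1
  degree = trans (∑-cong (allFin s) (λ i → sym (ι-≟true (E i x)))) (trans (∑-sum (allFin s) _) deg)
  find : Dec (∃ λ u → E u x ≡ true) → ∃ λ u → E u x ≡ true × (∀ i → E i x ≡ true → i ≡ u)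
  find (no none) with trans (sym degree) (∑-zero (λ i → ι-no (E i x Bool.≟ true) (λ e → none (i , e))))
  ... | ()
  find (yes (u , e)) = u , e , λ i e' → decidable-stable (i Fin.≟ u) (λ ne → <-irrefl (sym degree) (two i e' ne))
    where
    two : ∀ i → E i x ≡ true → i ≢ u → 2 ≤ ∑[ j ∈ allFin s ] ι (E j x Bool.≟ true)
    two i e' ne = ≤-trans (+-mono-≤ (hit i) (hit u)) (≤-trans (≤-reflexive (sym (∑-+ (allFin s) _ _))) (∑-mono (allFin s) (λ j → below j (j Fin.≟ i) (j Fin.≟ u))))
      where
      hit : ∀ k → 1 ≤ ∑[ j ∈ allFin s ] ι (j Fin.≟ k)
      hit k = ∑-≥1 (λ j → ι (j Fin.≟ k)) (∈-allFin k) (ι-≥1 (k Fin.≟ k) refl)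
      below : ∀ j → Dec (j ≡ i) → Dec (j ≡ u) → ι (j Fin.≟ i) + ι (j Fin.≟ u) ≤ ι (E j x Bool.≟ true)
      below j (yes refl) _ = ≤-reflexive (trans (cong₂ _+_ (ι-yes (j Fin.≟ j) refl) (ι-no (j Fin.≟ u) ne)) (sym (ι-yes (E j x Bool.≟ true) e')))
      below j (no ¬i) (yes refl) = ≤-reflexive (trans (cong₂ _+_ (ι-no (j Fin.≟ i) ¬i) (ι-yes (j Fin.≟ j) refl)) (sym (ι-yes (E j x Bool.≟ true) e)))
      below j (no ¬i) (no ¬u) = ≤-trans (≤-reflexive (cong₂ _+_ (ι-no (j Fin.≟ i) ¬i) (ι-no (j Fin.≟ u) ¬u))) z≤n

3≤a-from : ∀ {a b r} → 5 ≤ r → a + b ≡ r → b < a → 3 ≤ a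
3≤a-from {a} {b} 5≤r refl b<a with 3 ≤? a
... | yes p = p
... | no ¬p = ⊥-elim (<⇒≱ 5≤r (≤-trans (+-mono-≤ a≤2 (≤-trans (<⇒≤ b<a) a≤2)) ≤-refl))
  where
  a≤2 : a ≤ 2
  a≤2 = ≤-pred (≰⇒> ¬p)

-- Since a < r - 1 excludes b = 0 and b = 1, b has the form 2 + b'. The transport brings r into the
-- form used in `Tree`, and N is exactly what `large` asks for.
extremal-number : ∀ {a b s t} (5≤r : 5 ≤ a + b) → 2 ≤ t → b < a → a < a + b ∸ 1 → (E : BipGraph s t) → IsTree E → HasCriticalLeaf E →
  ∃ λ n₀ → ∀ n → n₀ ≤ n → t ∸ 1 ≤ n → (H : RGraph n (a + b)) → Free E a b H → n C (a + b) ≤ numEdges H + (n ∸ (t ∸ 1)) C (a + b) →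
    ∃ λ L → ∣ L ∣ ≡ t ∸ 1 × Star H L
extremal-number {a} {zero} _ _ _ a<r = λ _ _ _ → ⊥-elim (<⇒≱ a<r (≤-trans (m∸n≤m (a + 0) 1) (≤-reflexive (+-identityʳ a))))
extremal-number {a} {suc zero} _ _ _ a<r = λ _ _ _ → ⊥-elim (<⇒≱ a<r (≤-reflexive (trans (cong (_∸ 1) (+-comm a 1)) refl)))
extremal-number {a} {suc (suc b')} {s} {suc t'} 5≤r (s≤s 1≤t') b<a a<r E (connected , acyclic) (x , deg) with unique-neighbour-of-leaf E x deg
... | u , ux , leaf = subst (λ r → ∃ λ n₀ → ∀ n → n₀ ≤ n → t' ≤ n → (H : RGraph n r) → Free E a (2 + b') H → n C r ≤ numEdges H + (n ∸ t') C r →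
      ∃ λ L → ∣ L ∣ ≡ t' × Star H L) (sym (trans (+-suc a (suc b')) (cong suc (+-suc a b'))))
    (Tree.extremal a b' s t' E acyclic connected x u ux leaf _ ≤-refl (3≤a-from 5≤r refl b<a) 1≤t')

theorem3 : (r s t a b : ℕ) → 5 ≤ r → 2 ≤ t → t ≤ s → a + b ≡ r → b < a → a < r ∸ 1 →
    (E : BipGraph s t) → IsTree E → HasCriticalLeaf E →
    Σ ℕ λ n₀ → ∀ n → n₀ ≤ n →
    ((H : RGraph n r) → Free E a b H → numEdges H ≤ n C r ∸ (n ∸ t + 1) C r) ×
    (TauEq E a b t →
    ExEq E a b n r (n C r ∸ (n ∸ t + 1) C r) ×
    ((H : RGraph n r) → Free E a b H → numEdges H ≡ n C r ∸ (n ∸ t + 1) C r →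
    H ≅ Ψ (t ∸ 1) n r))
theorem3 r s t@(suc t') a b 5≤r 2≤t t≤s refl b<a a<r E tree leaf = proj₁ main + t , λ n n₀≤n →
    bounds n (≤-trans (m≤m+n _ t) n₀≤n) (≤-trans (m≤n+m t (proj₁ main)) n₀≤n)
  where
  main : ∃ λ n₀ → ∀ n → n₀ ≤ n → t' ≤ n → (H : RGraph n r) → Free E a b H → n C r ≤ numEdges H + (n ∸ t') C r →
    ∃ λ L → ∣ L ∣ ≡ t' × Star H L
  main = extremal-number 5≤r 2≤t b<a a<r E tree leaf
  module _ (n : ℕ) (n₁≤n : proj₁ main ≤ n) (t≤n : t ≤ n) where
    m : ℕ
    m = n C r ∸ (n ∸ t + 1) C r
    t'≤n : t' ≤ n
    t'≤n = ≤-trans (n≤1+n t') t≤n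
    -- Truncated subtraction makes this depend on t ≤ n, for which t was added to the threshold.
    n∸t+1 : n ∸ t + 1 ≡ n ∸ t'
    n∸t+1 = trans (+-comm (n ∸ t) 1) (sym (+-∸-assoc 1 t≤n))
    structure : (H : RGraph n r) → Free E a b H → m ≤ numEdges H → ∃ λ L → ∣ L ∣ ≡ t' × Star H L
    structure H free m≤ = proj₂ main n n₁≤n t'≤n H free (≤-trans (m≤n+m∸n (n C r) ((n ∸ t + 1) C r))
      (≤-trans (≤-reflexive (+-comm ((n ∸ t + 1) C r) m)) (+-mono-≤ m≤ (≤-reflexive (cong (_C r) n∸t+1)))))
    star-size : (H : RGraph n r) → ∀ {L} → ∣ L ∣ ≡ t' → Star H L → numEdges H ≡ m
    star-size H {L} ∣L∣ st = trans (sym (m+n∸n≡m (numEdges H) ((n ∸ t') C r)))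
      (cong₂ _∸_ (trans (cong (λ k → numEdges H + (n ∸ k) C r) (sym ∣L∣)) (star-numEdges {H = H} st)) (cong (_C r) (sym n∸t+1)))
    -- The bound follows from the structure: a free graph with at least m edges is a star and has
    -- exactly m.
    upper : (H : RGraph n r) → Free E a b H → numEdges H ≤ m
    upper H free = [ id , (λ m≤ → let (L , ∣L∣ , st) = structure H free m≤ in ≤-reflexive (star-size H ∣L∣ st)) ]′ (≤-total (numEdges H) m)
    bounds : ((H : RGraph n r) → Free E a b H → numEdges H ≤ m) ×
      (TauEq E a b t → ExEq E a b n r m × ((H : RGraph n r) → Free E a b H → numEdges H ≡ m → H ≅ Ψ t' n r))
    bounds = upper , λ (_ , τ) →
      (upper , Ψ t' n r , Ψ-free E n r t' τ , star-size (Ψ t' n r) {initial t'} (∣initial∣ t' t'≤n) (λ S → Ψ-edge⁻ {t'} S , Ψ-edge⁺ {t'} S)) ,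
      λ H free e → let (L , ∣L∣ , st) = structure H free (≤-reflexive (sym e)) in
        subst (λ c → H ≅ Ψ c n r) ∣L∣ (star-iso {H = H} st)
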